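{- Let $n\ge3$, let $(\pi,v)\in\operatorname{Vert}(D_n)$ and let $a,b\in v([n])$. Then $(\pi,v)$ has a rise labelled $(a,b)$ if and only if $\zeta_D(\pi,v)=(\zeta_D(\pi),d_D(\pi,v))$ has a valley labelled $(b,a)$ or $(-a,-b)$. Moreover, $(\pi,v)$ has a rise labelled $(\pm|a|,b)$ if and only if $\zeta_D(\pi,v)$ has a valley labelled $(b,\pm|a|)$.
   Context: $\mathfrak S_n^B$: bijections $w$ of $\{\pm1,\dots,\pm n\}$ with $w(-i)=-w(i)$; $\mathfrak S_n^D$: those with an even number of $i\in[n]$ with $w(i)<0$. Rise $i$: the $i$-th North step is immediately followed by a North step. Valley $(i,j)$: the $i$-th East step is immediately followed by the $j$-th North step; additionally, if a ballot path with $i$ East and $j$ North steps ends with an East step, $(i,j+1)$ is a valley. Signed steps $E^\pm$ count as East steps. Signed lattice paths $\mathcal L^\bullet_{n-1,n}$: words with $n-1$ East and $n$ North steps whose first step, if East, is replaced by $E^+$ or $E^-$; $\epsilon(\pi)=-1$ iff $\pi$ contains $E^-$. $\pi_i$: number of East steps before the $i$-th North step; $\lambda_1=\epsilon(\pi)\pi_1$, $\lambda_i=\pi_i$ ($1<i<n$), $\lambda_n=2\pi_n-\pi_{n-1}$ if $\pi_1+\dots+\pi_{n-2}$ even, $2n-1-2\pi_n+\pi_{n-1}$ if odd. $\nu=(0,1,\dots,n-2,n-1)$ if $n-1\equiv0,3\pmod4$, $\nu=(0,1,\dots,n-2,n)$ if $n-1\equiv1,2\pmod4$. Area vector $\mu=(\lambda_1,\lambda_2-1,\dots,\lambda_{n-1}-(n-2),\lambda_n-(n-1))$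 in the first case and $(-\lambda_1,\lambda_2-1,\dots,\lambda_{n-1}-(n-2),n-\lambda_n)$ in the second. For $a\in\mathbb Z^n$, $j\ge0$: $\overrightarrow{S}^+_j(a)$ reads left to right writing $N$ for entries $j$ and $E$ for $j+1$; $\overleftarrow{S}^+_j$ reads right to left; $\overrightarrow{S}^-_j,\overleftarrow{S}^-_j$ use $N$ for $-j$ and $E$ for $-j-1$. $\zeta_D(\pi)$: from $\overleftarrow{S}^-_{2n-1}(\mu)\overrightarrow{S}^+_{2n-1}(\mu)\cdots\overleftarrow{S}^-_0(\mu)\overrightarrow{S}^+_0(\mu)$ delete the last letter; if the $n$-th North step is immediately followed by an East step, replace that step by $E^+$ if $\#\{r:\mu_r>0\}$ is even and $E^-$ if odd; $\epsilon(\beta)=-1$ iff a path $\beta$ contains $E^-$. $\operatorname{Vert}(D_n)$: pairs $(\pi,v)$, $\pi\in\mathcal L^\bullet_{n-1,n}$, $v\in\mathfrak S_n^B$, with $v(i)<v(i+1)$ for every rise $i$, $|v(1)|<v(2)$ if $\pi$ begins with two North steps, and $\prod_i\operatorname{sgn}v(i)=\epsilon(\pi)(-1)^{\lambda_{n-1}+\lambda_n}$. $d_D(\pi,v)$: for $i=0,1,2,\dots$ write $v(j)$ for rows $j$ with $\mu_j=-i$ in increasing $j$, then $-v(j)$ for rows $j$ with $\mu_j=i+1$ in decreasing $j$; multiply the entry from row $n$ by $(-1)^{1+\mu_{n-1}+\mu_n}$ and the entry from row $1$ by $\epsilon(\pi)(-1)^{1+\nu_{n-1}+\nu_n}$; then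 change the sign of the first entry if $\mu$ has an odd number of positive entries; the result is the window of $d_D(\pi,v)\in\mathfrak S_n^D$. Labels: a rise $i$ of $(\pi,v)$ is labelled $(v(i),v(i+1))$, except that if $\pi$ begins with two North steps, the rise $1$ is labelled by the formal symbol $(\pm|v(1)|,v(2))$. For $(\beta,w)$ with $\beta$ a signed ballot path of length $2n-1$ and $w\in\mathfrak S_n^D$, a valley $(i,j)$ is labelled $(w(n+1-i),w(n+1-j))$ if $j<n$, $(w(n+1-i),\epsilon(\beta)w(1))$ if $j=n$, $(w(n+1-i),-\epsilon(\beta)w(1))$ if $j=n+1$, $(w(n+1-i),w(n-j))$ if $j>n+1$ (with $w(-k)=-w(k)$); except that if $j=n$ and the $n$-th North step of $\beta$ is followed by another North step, the valley is labelled by the formal symbol $(w(n+1-i),\pm|w(1)|)$. A label $(\pm|a|,b)$ resp. $(b,\pm|a|)$ in the claim means one of these formal symbols with $|v(1)|=|a|$, $v(2)=b$ resp. $w(n+1-i)=b$, $|w(1)|=|a|$.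
   Formalization: In the valley labels, an n-th North step that is the last letter of the ballot path also counts as followed by another North step (formal label); read literally the claim fails, e.g. for n=3, π=NNNEE, v=[1,2,3]. -}

module Defs where

open import Data.Bool using (Bool; true; false; if_then_else_; _∧_; _∨_; not)
open import Data.Nat as ℕ using (ℕ; zero; suc; _∸_; _≡ᵇ_; _%_)
open import Data.Integer as ℤ using (ℤ; +_; -_; ∣_∣; 0ℤ; 1ℤ; -1ℤ; _≤ᵇ_)
open import Data.List using (List; []; _∷_; _++_; map; concatMap; reverse; upTo; length; filter; foldr; take)
open import Data.Nat.ListAction using (sum)
open import Data.Maybe using (Maybe; just; nothing)
open import Data.Product using (_×_; _,_; Σ; proj₁; proj₂)
open import Data.List.Membership.Propositional using (_∈_)
open import Data.List.Relation.Binary.Permutation.Propositional using (_↭_)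
open import Relation.Binary.PropositionalEquality using (_≡_)
open import Relation.Nullary using (does)
open import Data.Integer.Properties using () renaming (_≟_ to _≟ℤ_)

infix 4 _==ℤ_ _<ℤᵇ_

_==ℤ_ : ℤ → ℤ → Bool
x ==ℤ y = does (x ≟ℤ y)

_<ℤᵇ_ : ℤ → ℤ → Bool
x <ℤᵇ y = not (y ≤ᵇ x)

evenℕ : ℕ → Bool
evenℕ zero = true
evenℕ (suc k) = not (evenℕ k)

neg1^ : ℤ → ℤ
neg1^ k = if evenℕ ∣ k ∣ then 1ℤ else -1ℤ

sgnℤ : ℤ → ℤ
sgnℤ (+ zero) = 0ℤ
sgnℤ (+ suc _) = 1ℤ
sgnℤ ℤ.-[1+ _ ] = -1ℤ

productℤ : List ℤ → ℤ
productℤ = foldr ℤ._*_ 1ℤ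

nth : {A : Set} → List A → ℕ → Maybe A
nth [] _ = nothing
nth (x ∷ xs) zero = nothing
nth (x ∷ xs) (suc zero) = just x
nth (x ∷ xs) (suc (suc k)) = nth xs (suc k)

-- 1-based lookup with default 0 (out of range never occurs in the statement)
getℤ : List ℤ → ℕ → ℤ
getℤ [] _ = 0ℤ
getℤ (x ∷ xs) zero = 0ℤ
getℤ (x ∷ xs) (suc zero) = x
getℤ (x ∷ xs) (suc (suc k)) = getℤ xs (suc k)

getℕ : List ℕ → ℕ → ℕ
getℕ [] _ = 0
getℕ (x ∷ xs) zero = 0
getℕ (x ∷ xs) (suc zero) = x
getℕ (x ∷ xs) (suc (suc k)) = getℕ xs (suc k)

range1 : ℕ → List ℕ
range1 n = map suc (upTo n)

-- Signed permutations of type B, in window notation: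
-- w is given by the list [w(1), ..., w(n)], and w(-i) = -w(i).
-- The window of a bijection of {±1..±n} commuting with negation is exactly
-- a list whose absolute values are a permutation of 1..n.

IsSignedPerm : ℕ → List ℤ → Set
IsSignedPerm n w = map ∣_∣ w ↭ range1 n

-- evaluate a signed permutation at an integer index, using w(-k) = -w(k)
-- (index 0 is junk and never used)
evalℤ : List ℤ → ℤ → ℤ
evalℤ w (+ zero) = 0ℤ
evalℤ w (+ suc k) = getℤ w (suc k)
evalℤ w ℤ.-[1+ k ] = - getℤ w (suc k)

-- N = North, E = (unsigned) East, Ep = E⁺, Em = E⁻
data Step : Set where
  N E Ep Em : Step

isN : Step → Bool
isN N = true
isN _ = false

isEast : Step → Bool
isEast N = false
isEast _ = true

isPlainE : Step → Bool
isPlainE E = true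
isPlainE _ = false

isEm : Step → Bool
isEm Em = true
isEm _ = false

countE : List Step → ℕ
countE [] = 0
countE (s ∷ p) = if isEast s then suc (countE p) else countE p

countN' : List Step → ℕ
countN' [] = 0
countN' (s ∷ p) = if isN s then suc (countN' p) else countN' p

epsilon : List Step → ℤ
epsilon [] = 1ℤ
epsilon (s ∷ p) = if isEm s then -1ℤ else epsilon p

firstOK : Step → Bool
firstOK N = true
firstOK E = false
firstOK Ep = true
firstOK Em = true

restOK : Step → Bool
restOK N = true
restOK E = true
restOK Ep = false
restOK Em = false

allB : {A : Set} → (A → Bool) → List A → Bool
allB f [] = true
allB f (x ∷ xs) = f x ∧ allB f xs

InSignedPaths : ℕ → List Step → Set
InSignedPaths n [] = Data.Empty.⊥
  where import Data.Empty
InSignedPaths n (s ∷ p) =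
  (firstOK s ≡ true) × (allB restOK p ≡ true) ×
  (countN' (s ∷ p) ≡ n) × (countE (s ∷ p) ≡ n ∸ 1)

nextIsN : List Step → Bool
nextIsN (N ∷ _) = true
nextIsN _ = false

risesAux : ℕ → List Step → List ℕ
risesAux k [] = []
risesAux k (s ∷ p) =
  if isN s then (if nextIsN p then suc k ∷ [] else []) ++ risesAux (suc k) p
  else risesAux k p

rises : List Step → List ℕ
rises = risesAux 0

valleysAux : ℕ → ℕ → List Step → List (ℕ × ℕ)
valleysAux e k [] = []
valleysAux e k (s ∷ p) =
  if isEast s then (if nextIsN p then (suc e , suc k) ∷ [] else []) ++ valleysAux (suc e) k p
  else valleysAux e (suc k) p

endsWithEast : List Step → Bool
endsWithEast [] = false
endsWithEast (s ∷ []) = isEast s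
endsWithEast (s ∷ t ∷ p) = endsWithEast (t ∷ p)

valleys : List Step → List (ℕ × ℕ)
valleys β = valleysAux 0 0 β ++
  (if endsWithEast β then (countE β , suc (countN' β)) ∷ [] else [])

-- A ballot path is read as being followed by an implicit final North step
-- (this is the convention behind the extra valley (#E , #N + 1) above).
nextIsNOrEnd : List Step → Bool
nextIsNOrEnd [] = true
nextIsNOrEnd (N ∷ _) = true
nextIsNOrEnd _ = false

nthNorthFollowedByN : ℕ → List Step → Bool
nthNorthFollowedByN k [] = false
nthNorthFollowedByN k (s ∷ p) =
  if isN s then (if k ≡ᵇ 1 then nextIsNOrEnd p else nthNorthFollowedByN (k ∸ 1) p)
  else nthNorthFollowedByN k p

beginsNN : List Step → Bool
beginsNN (N ∷ N ∷ _) = true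
beginsNN _ = false

piAux : ℕ → List Step → List ℕ
piAux e [] = []
piAux e (s ∷ p) = if isN s then e ∷ piAux e p else piAux (suc e) p

piVec : List Step → List ℕ
piVec = piAux 0

lam : ℕ → List Step → ℕ → ℤ
lam n π i =
  if i ≡ᵇ 1 then epsilon π ℤ.* (+ getℕ ps 1)
  else if i ≡ᵇ n then
    (if evenℕ (sum (take (n ∸ 2) ps))
       then (+ 2) ℤ.* (+ getℕ ps n) ℤ.- (+ getℕ ps (n ∸ 1))
       else (+ (2 ℕ.* n ∸ 1)) ℤ.- (+ 2) ℤ.* (+ getℕ ps n) ℤ.+ (+ getℕ ps (n ∸ 1)))
  else + getℕ ps i
  where ps = piVec π

nuCase1 : ℕ → Bool
nuCase1 n = ((n ∸ 1) % 4 ≡ᵇ 0) ∨ ((n ∸ 1) % 4 ≡ᵇ 3)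

nu : ℕ → List ℤ
nu n = map +_ (upTo (n ∸ 1)) ++ ((if nuCase1 n then + (n ∸ 1) else + n) ∷ [])

muAt : ℕ → List Step → ℕ → ℤ
muAt n π i =
  if i ≡ᵇ 1 then (if nuCase1 n then lam n π 1 else - lam n π 1)
  else if i ≡ᵇ n then (if nuCase1 n then lam n π n ℤ.- + (n ∸ 1) else + n ℤ.- lam n π n)
  else lam n π i ℤ.- + (i ∸ 1)

mu : ℕ → List Step → List ℤ
mu n π = map (muAt n π) (range1 n)

Splus : ℕ → List ℤ → List Step
Splus j = concatMap (λ x → if x ==ℤ (+ j) then N ∷ [] else if x ==ℤ (+ suc j) then E ∷ [] else [])

SminusLeft : ℕ → List ℤ → List Step
SminusLeft j a = concatMap (λ x → if x ==ℤ - (+ j) then N ∷ [] else if x ==ℤ - (+ suc j) then E ∷ [] else []) (reverse a)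

dropLast : {A : Set} → List A → List A
dropLast [] = []
dropLast (x ∷ []) = []
dropLast (x ∷ y ∷ xs) = x ∷ dropLast (y ∷ xs)

replHead : Step → List Step → List Step
replHead s [] = []
replHead s (x ∷ p) = if isPlainE x then s ∷ p else x ∷ p

replAfterNorth : ℕ → Step → List Step → List Step
replAfterNorth k s [] = []
replAfterNorth k s (x ∷ p) =
  if isN x then (if k ≡ᵇ 1 then x ∷ replHead s p else x ∷ replAfterNorth (k ∸ 1) s p)
  else x ∷ replAfterNorth k s p

countPos : List ℤ → ℕ
countPos [] = 0
countPos (x ∷ a) = if 0ℤ <ℤᵇ x then suc (countPos a) else countPos a

zetaWord : ℕ → List Step → List Step
zetaWord n π = concatMap (λ j → SminusLeft j m ++ Splus j m) (reverse (upTo (2 ℕ.* n)))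
  where m = mu n π

zetaD : ℕ → List Step → List Step
zetaD n π = replAfterNorth n (if evenℕ (countPos (mu n π)) then Ep else Em) (dropLast (zetaWord n π))

dStep : ℕ → List ℤ → List ℤ → ℕ → List (ℕ × ℤ)
dStep n m v i =
  concatMap (λ j → if getℤ m j ==ℤ - (+ i) then (j , getℤ v j) ∷ [] else []) (range1 n) ++
  concatMap (λ j → if getℤ m j ==ℤ (+ suc i) then (j , - getℤ v j) ∷ [] else []) (reverse (range1 n))

-- i = 0, 1, 2, ... ; every row j is written at i = -μ_j or i = μ_j - 1, so i ≤ Σ|μ_j|
-- suffices, and we iterate over i = 0 .. Σ|μ_j|.
dD : ℕ → List Step → List ℤ → List ℤ
dD n π v = flipFirst (map adjust pairs)
  where
  m = mu n π
  bound = sum (map ∣_∣ m)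
  pairs = concatMap (dStep n m v) (upTo (suc bound))
  ν = nu n
  adjust : ℕ × ℤ → ℤ
  adjust (j , x) =
    if j ≡ᵇ n then neg1^ (1ℤ ℤ.+ getℤ m (n ∸ 1) ℤ.+ getℤ m n) ℤ.* x
    else if j ≡ᵇ 1 then epsilon π ℤ.* neg1^ (1ℤ ℤ.+ getℤ ν (n ∸ 1) ℤ.+ getℤ ν n) ℤ.* x
    else x
  flipFirst : List ℤ → List ℤ
  flipFirst [] = []
  flipFirst (x ∷ xs) = (if evenℕ (countPos m) then x else - x) ∷ xs

record InVert (n : ℕ) (π : List Step) (v : List ℤ) : Set where
  field
    path : InSignedPaths n π
    perm : IsSignedPerm n v
    riseInc : ∀ i → i ∈ rises π → (getℤ v i <ℤᵇ getℤ v (suc i)) ≡ true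
    beginNN : beginsNN π ≡ true → (+ ∣ getℤ v 1 ∣ <ℤᵇ getℤ v 2) ≡ true
    signCond : productℤ (map sgnℤ v) ≡ epsilon π ℤ.* neg1^ (lam n π (n ∸ 1) ℤ.+ lam n π n)

-- pr a b         : the ordinary label (a , b)
-- pmL |a| b      : the formal symbol (±|a| , b)
-- pmR b |a|      : the formal symbol (b , ±|a|)
data Label : Set where
  pr  : ℤ → ℤ → Label
  pmL : ℕ → ℤ → Label
  pmR : ℤ → ℕ → Label

riseLabel : List Step → List ℤ → ℕ → Label
riseLabel π v i =
  if beginsNN π ∧ (i ≡ᵇ 1) then pmL ∣ getℤ v 1 ∣ (getℤ v 2)
  else pr (getℤ v i) (getℤ v (suc i))

valleyLabel : ℕ → List Step → List ℤ → ℕ × ℕ → Label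
valleyLabel n β w (i , j) =
  if j ℕ.<ᵇ n then pr x (evalℤ w (+ suc n ℤ.- + j))
  else if j ≡ᵇ n then
    (if nthNorthFollowedByN n β then pmR x ∣ getℤ w 1 ∣
     else pr x (epsilon β ℤ.* getℤ w 1))
  else if j ≡ᵇ suc n then pr x (- (epsilon β ℤ.* getℤ w 1))
  else pr x (evalℤ w (+ n ℤ.- + j))
  where x = evalℤ w (+ suc n ℤ.- + i)

HasRise : List Step → List ℤ → Label → Set
HasRise π v l = Σ ℕ λ i → (i ∈ rises π) × (riseLabel π v i ≡ l)

HasValley : ℕ → List Step → List ℤ → Label → Set
HasValley n β w l = Σ (ℕ × ℕ) λ ij → (ij ∈ valleys β) × (valleyLabel n β w ij ≡ l)

{-# OPTIONS --safe #-}
module Submission where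

-- Write b for the sequence (-μ_n , … , -μ_1 , μ_1 , … , μ_n).  The blocks of ζ_D read b from left
-- to right, level by level, and d_D lists the entries of b in the opposite order, an entry of the
-- left half carrying v(r) and one of the right half -v(r).  So the valleys of ζ_D(π), with their
-- labels, are the places where an E of some entry is immediately followed by an N of another one.
--
-- Up to the deleted last letter, words and windows do not change under μ_1 ↦ -μ_1 and
-- μ_n ↦ 1 - μ_n if the corresponding label changes its sign as well.  One may thus assume μ_1 ≥ 0
-- and μ_n ≤ 0, and then the definition of λ (with π_n ≤ n - 1) gives μ_{i+1} ≥ μ_i - 1 for all i, with
-- equality exactly at the rises of π.  Hence b descends by steps of size at most 1, so that an E and the N after it
-- come from neighbouring entries j + 1 , j with j ≥ 0 of b.  A rise i produces exactly one such
-- pair: in the left half if μ_i ≤ 0, with label (v(i+1) , v(i)), and in the right half if μ_i > 0,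
-- with label (-v(i) , -v(i+1)).  The formal symbols occur when μ_1 = 0.

-- Labels are matched by position. An East of level j and a North of level j + 1 come from the same
-- entries of b, those equal to j + 1; so the list of Easts, completed by the zero entries, is the
-- list of Norths. The first n Norths form the window of d_D backwards, as each row contributes
-- exactly one of its copies. The others are the zero entries of the right half, which repeat those
-- of the left half in opposite order with opposite signs. This is the source of w(n + 1 - i), w(n +
-- 1 - j) and, beyond the n-th North, of w(n - j).
--
-- The n-th North closes the left half of level 0. An East follows it exactly if the normalised μ_1
-- is positive; its sign and the sign change of w(1) come from the same parity and cancel.
--
-- The factors in d_D record the reflections: that of row 1 is the sign in μ_1 = ± π_1, and that of
-- row n tells which of two values D, 1 - D is μ_n. Hence the normalised rows carry v(r) and -v(r)
-- wherever a rise needs them, except for the unknown sign of v(1) when π_1 = 0.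
--
-- For the converse, the label of a valley reveals its half, because v([n]) contains no two opposite
-- numbers.

open import Defs
open import Data.Bool using (Bool; true; false; if_then_else_; _∧_)
open import Data.Empty using (⊥; ⊥-elim)
open import Data.Integer as ℤ using (ℤ; +_; -_; ∣_∣; 0ℤ; 1ℤ; -1ℤ; -[1+_])
open import Data.Integer.Solver using (module +-*-Solver)
open import Data.List using (List; []; _∷_; _++_; _∷ʳ_; map; concatMap; reverse; upTo; downFrom; applyUpTo; applyDownFrom; length; take)
open import Data.List.Membership.Propositional using (_∈_)
open import Data.List.Membership.Propositional.Properties using (∈-map⁺)
open import Data.List.Properties
open import Data.List.Relation.Binary.Permutation.Propositional using (↭-sym; ↭⇒↭ₛ)
open import Data.List.Relation.Binary.Permutation.Propositional.Properties using (All-resp-↭; ↭-length)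
open import Data.List.Relation.Unary.All as All using (All; []; _∷_)
open import Data.List.Relation.Unary.AllPairs using (_∷_)
open import Data.List.Relation.Unary.Any using (here; there)
open import Data.List.Relation.Unary.Unique.Propositional using (Unique)
open import Data.Nat as ℕ using (ℕ; zero; suc; _∸_; _≡ᵇ_; _≤_; _<_; z≤n; s≤s)
open import Data.Nat.ListAction using (sum)
open import Data.Nat.Solver renaming (module +-*-Solver to ℕ-Solver)
open import Data.Product using (_×_; _,_; ∃; ∃₂; proj₁; proj₂)
open import Data.Sum using (_⊎_; inj₁; inj₂)
open import Function using (_∘_)
open import Function.Bundles using (_⇔_; mk⇔; Equivalence)
open import Relation.Binary.PropositionalEquality hiding (J)
open import Relation.Nullary using (¬_; yes; no)
open import Relation.Nullary.Decidable using (dec-true; dec-false)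
import Data.Integer.Properties as ℤP
import Data.List.Relation.Binary.Permutation.Setoid.Properties as ↭ₛ
import Data.List.Relation.Unary.All.Properties as AllP
import Data.List.Relation.Unary.Unique.Propositional.Properties as UniqueP
import Data.Nat.Properties as ℕP
open import Algebra.Properties.AbelianGroup ℤP.+-0-abelianGroup using (∙-cancelʳ)

-- Words of a sequence

data Adjacent {A : Set} (x y : A) : List A → Set where
  here  : ∀ {zs} → Adjacent x y (x ∷ y ∷ zs)
  there : ∀ {z zs} → Adjacent x y zs → Adjacent x y (z ∷ zs)

data EndsIn {A : Set} (x : A) : List A → Set where
  here  : EndsIn x (x ∷ [])
  there : ∀ {z zs} → EndsIn x zs → EndsIn x (z ∷ zs)

data StartsWith {A : Set} (x : A) : List A → Set where
  here : ∀ {zs} → StartsWith x (x ∷ zs)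

adjacent-++ˡ : ∀ {A : Set} {x y : A} {xs} ys → Adjacent x y xs → Adjacent x y (xs ++ ys)
adjacent-++ˡ ys here      = here
adjacent-++ˡ ys (there p) = there (adjacent-++ˡ ys p)

adjacent-++ʳ : ∀ {A : Set} {x y : A} xs {ys} → Adjacent x y ys → Adjacent x y (xs ++ ys)
adjacent-++ʳ []       p = p
adjacent-++ʳ (x ∷ xs) p = there (adjacent-++ʳ xs p)

adjacent-++⁻ : ∀ {A : Set} {x y : A} xs {ys} → Adjacent x y (xs ++ ys) →
  Adjacent x y xs ⊎ (EndsIn x xs × StartsWith y ys) ⊎ Adjacent x y ys
adjacent-++⁻ []           p         = inj₂ (inj₂ p)
adjacent-++⁻ (x ∷ [])     here      = inj₂ (inj₁ (here , here))
adjacent-++⁻ (x ∷ [])     (there p) = inj₂ (inj₂ p)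
adjacent-++⁻ (x ∷ y ∷ xs) here      = inj₁ here
adjacent-++⁻ (x ∷ y ∷ xs) (there p) with adjacent-++⁻ (y ∷ xs) p
... | inj₁ q              = inj₁ (there q)
... | inj₂ (inj₁ (q , r)) = inj₂ (inj₁ (there q , r))
... | inj₂ (inj₂ q)       = inj₂ (inj₂ q)

endsIn-++⁻ : ∀ {A : Set} {x : A} xs {ys} → EndsIn x (xs ++ ys) → EndsIn x ys ⊎ (ys ≡ [] × EndsIn x xs)
endsIn-++⁻ []       p = inj₁ p
endsIn-++⁻ (z ∷ []) here = inj₂ (refl , here)
endsIn-++⁻ (z ∷ []) (there p) = inj₁ p
endsIn-++⁻ (z ∷ z′ ∷ xs) (there p) with endsIn-++⁻ (z′ ∷ xs) p
... | inj₁ q       = inj₁ q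
... | inj₂ (e , q) = inj₂ (e , there q)

data Letter (X : Set) : Set where
  north east : X → Letter X

module _ {X : Set} where

  glyph : ℕ → ℤ × X → List (Letter X)
  glyph j (z , x) =
    if z ==ℤ + j then north x ∷ [] else if z ==ℤ + suc j then east x ∷ [] else []

  read : ℕ → List (ℤ × X) → List (Letter X)
  read j = concatMap (glyph j)

  word : ℕ → List (ℤ × X) → List (Letter X)
  word zero    b = read 0 b
  word (suc J) b = read (suc J) b ++ word J b

  data GlyphView (j : ℕ) (z : ℤ) (x : X) : List (Letter X) → Set where
    north-at : z ≡ + j → GlyphView j z x (north x ∷ [])
    east-at  : z ≡ + suc j → GlyphView j z x (east x ∷ [])
    blank    : z ≢ + j → z ≢ + suc j → GlyphView j z x []

  glyph-view : ∀ j z x → GlyphView j z x (glyph j (z , x))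
  glyph-view j z x with z ℤP.≟ + j
  ... | yes p = north-at p
  ... | no ¬p with z ℤP.≟ + suc j
  ...   | yes q = east-at q
  ...   | no ¬q = blank ¬p ¬q

  -- A discrete form of the intermediate value property: from an entry z ≥ 0 on, such a list meets
  -- every level between z and 0.
  data Slope : List (ℤ × X) → Set where
    stop : ∀ {z x} → z ℤ.≤ 0ℤ → Slope ((z , x) ∷ [])
    cons : ∀ {z x z′ x′ b} → z ℤ.≤ ℤ.suc z′ → Slope ((z′ , x′) ∷ b) → Slope ((z , x) ∷ (z′ , x′) ∷ b)

  slope-++ : ∀ {b z x b′} → Slope b → 0ℤ ℤ.≤ z → Slope ((z , x) ∷ b′) → Slope (b ++ (z , x) ∷ b′)
  slope-++ (stop p)   0≤z s′ = cons (ℤP.≤-trans p (ℤP.≤-trans 0≤z (ℤP.i≤suc[i] _))) s′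
  slope-++ (cons p s) 0≤z s′ = cons p (slope-++ s 0≤z s′)

step-down : ∀ {m z} → + suc m ℤ.≤ ℤ.suc z → + m ℤ.≤ z
step-down {m} {+ w}         (ℤ.+≤+ (s≤s p)) = ℤ.+≤+ p
step-down {m} { -[1+ zero ]} (ℤ.+≤+ ())
step-down {m} { -[1+ suc w ]} ()

≤∧≢⇒suc≤ : ∀ {j z} → + j ℤ.≤ z → z ≢ + j → + suc j ℤ.≤ z
≤∧≢⇒suc≤ (ℤ.+≤+ p) ne = ℤ.+≤+ (ℕP.≤∧≢⇒< p (λ e → ne (cong +_ (sym e))))

+j≤0⇒≡ : ∀ {j z} → + j ℤ.≤ z → z ℤ.≤ 0ℤ → z ≡ + j
+j≤0⇒≡ (ℤ.+≤+ z≤n) (ℤ.+≤+ z≤n) = refl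

module _ {X : Set} where

  read-nonempty : ∀ {j z} {x : X} {b} → Slope ((z , x) ∷ b) → + j ℤ.≤ z → read j ((z , x) ∷ b) ≢ []
  read-nonempty {j} {z} {x} s j≤z with glyph j (z , x) | glyph-view j z x
  ... | _ | north-at _ = λ ()
  ... | _ | east-at _  = λ ()
  read-nonempty (stop z≤0) j≤z   | _ | blank p q = λ _ → p (+j≤0⇒≡ j≤z z≤0)
  read-nonempty (cons d s) j≤z | _ | blank p q =
    read-nonempty s (step-down (ℤP.≤-trans (≤∧≢⇒suc≤ j≤z p) d))

  -- The descent from above `j` meets the value `j + 1`, hence an East, before it can meet `j`.
  read-no-north-first : ∀ {j z} {x y : X} {b} → Slope ((z , x) ∷ b) → + suc j ℤ.≤ z →
    ¬ StartsWith (north y) (read j ((z , x) ∷ b))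
  read-no-north-first {j} {z} {x} s j<z with glyph j (z , x) | glyph-view j z x
  read-no-north-first s (ℤ.+≤+ p) | _ | north-at refl = λ _ → ℕP.<-irrefl refl p
  ... | _ | east-at _  = λ ()
  read-no-north-first (stop z≤0) j<z   | _ | blank p q = λ _ → q (+j≤0⇒≡ j<z z≤0)
  read-no-north-first (cons d s) j<z | _ | blank p q =
    read-no-north-first s (step-down (ℤP.≤-trans (≤∧≢⇒suc≤ j<z q) d))

  -- After an entry `j + 1` the list still has to come down to a value at most 0, and on the way it
  -- meets `j`, which yields a further letter.
  read-no-east-last : ∀ {j b} {x : X} → Slope b → ¬ EndsIn (east x) (read j b)
  read-no-east-last {j} {(z , w) ∷ b} s e with endsIn-++⁻ (glyph j (z , w)) e
  read-no-east-last (cons d s) e | inj₁ e′ = read-no-east-last s e′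
  ... | inj₂ (none , e′) with glyph j (z , w) | glyph-view j z w
  read-no-east-last s e | inj₂ (none , there ()) | _ | north-at _
  read-no-east-last (stop (ℤ.+≤+ ())) e | inj₂ (none , e′) | _ | east-at refl
  read-no-east-last (cons d s) e | inj₂ (none , e′) | _ | east-at refl =
    read-nonempty s (step-down d) none
  read-no-east-last s e | inj₂ (none , ()) | _ | blank _ _

  ends-north : (u : List (Letter X)) → u ≢ [] → (∀ {x} → ¬ EndsIn (east x) u) → ∃₂ λ u′ y → u ≡ u′ ∷ʳ north y
  ends-north []           ne ¬e = ⊥-elim (ne refl)
  ends-north (north y ∷ []) ne ¬e = [] , y , refl
  ends-north (east y ∷ [])  ne ¬e = ⊥-elim (¬e here)
  ends-north (l ∷ l′ ∷ u) ne ¬e with ends-north (l′ ∷ u) (λ ()) (λ e → ¬e (there e))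
  ... | u′ , y , eq = l ∷ u′ , y , cong (l ∷_) eq

  adjacent-read⁺ : ∀ {j b} {x y : X} → Adjacent (+ suc j , x) (+ j , y) b → Adjacent (east x) (north y) (read j b)
  adjacent-read⁺ {j} {_} {x} {y} here with glyph j (+ suc j , x) | glyph-view j (+ suc j) x | glyph j (+ j , y) | glyph-view j (+ j) y
  ... | _ | north-at p | _ | _ = ⊥-elim (ℕP.1+n≢n (ℤP.+-injective p))
  ... | _ | blank _ q  | _ | _ = ⊥-elim (q refl)
  ... | _ | east-at _  | _ | north-at _ = here
  ... | _ | east-at _  | _ | east-at q = ⊥-elim (ℕP.1+n≢n (sym (ℤP.+-injective q)))
  ... | _ | east-at _  | _ | blank q _ = ⊥-elim (q refl)
  adjacent-read⁺ {j} {p ∷ _} (there a) = adjacent-++ʳ (glyph j p) (adjacent-read⁺ a)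

  read-north-first : ∀ {j z} {x y : X} {b} → Slope ((z , x) ∷ b) → + j ℤ.≤ z →
    StartsWith (north y) (read j ((z , x) ∷ b)) → (z , x) ≡ (+ j , y)
  read-north-first {j} {z} {x} {y} {b} s j≤z h with glyph j (z , x) in eq | glyph-view j z x
  read-north-first s j≤z here | _ | north-at refl = refl
  read-north-first s j≤z () | _ | east-at _
  ... | _ | blank p _ = ⊥-elim (read-no-north-first s (≤∧≢⇒suc≤ j≤z p) (subst (λ g → StartsWith (north y) (g ++ read j b)) (sym eq) h))

  -- The entry right after that of the East is at least `j`. If it exceeded `j`, another East would
  -- come before any North; so it equals `j` and produces the North itself.
  adjacent-read⁻ : ∀ {j b} {x y : X} → Slope b → Adjacent (east x) (north y) (read j b) →
    Adjacent (+ suc j , x) (+ j , y) b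
  adjacent-read⁻ {j} {(z , w) ∷ b} s a with adjacent-++⁻ (glyph j (z , w)) a
  adjacent-read⁻ (cons d s) a | inj₂ (inj₂ a′) = there (adjacent-read⁻ s a′)
  ... | inj₁ a′ with glyph j (z , w) | glyph-view j z w
  adjacent-read⁻ s a | inj₁ (there ()) | _ | north-at _
  adjacent-read⁻ s a | inj₁ (there ()) | _ | east-at _
  adjacent-read⁻ s a | inj₁ ()         | _ | blank _ _
  adjacent-read⁻ {j} {(z , w) ∷ b} s a | inj₂ (inj₁ (e , h)) with glyph j (z , w) | glyph-view j z w
  adjacent-read⁻ s a | inj₂ (inj₁ (there () , h)) | _ | north-at _
  adjacent-read⁻ s a | inj₂ (inj₁ (() , h))       | _ | blank _ _
  adjacent-read⁻ (stop _) a | inj₂ (inj₁ (here , ())) | _ | east-at refl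
  adjacent-read⁻ (cons d s) a | inj₂ (inj₁ (here , h)) | _ | east-at refl with read-north-first s (step-down d) h
  ... | refl = here

  -- A pair cannot straddle two levels, because no level ends with an East.
  adjacent-word⁻ : ∀ J {b} {x y : X} → Slope b → Adjacent (east x) (north y) (word J b) →
    ∃ λ j → Adjacent (+ suc j , x) (+ j , y) b
  adjacent-word⁻ zero s a = 0 , adjacent-read⁻ s a
  adjacent-word⁻ (suc J) {b} s a with adjacent-++⁻ (read (suc J) b) a
  ... | inj₁ a′             = suc J , adjacent-read⁻ s a′
  ... | inj₂ (inj₁ (e , _)) = ⊥-elim (read-no-east-last s e)
  ... | inj₂ (inj₂ a′)      = adjacent-word⁻ J s a′

  adjacent-word⁺ : ∀ {j J b} {x y : X} → j ℕ.≤′ J → Adjacent (+ suc j , x) (+ j , y) b →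
    Adjacent (east x) (north y) (word J b)
  adjacent-word⁺ {zero}  ℕ.≤′-refl a = adjacent-read⁺ a
  adjacent-word⁺ {suc j} {b = b} ℕ.≤′-refl a = adjacent-++ˡ (word j b) (adjacent-read⁺ a)
  adjacent-word⁺ {b = b} (ℕ.≤′-step {n = J} p) a = adjacent-++ʳ (read (suc J) b) (adjacent-word⁺ p a)

  read-ends-north : ∀ {j z} {x : X} {b} → Slope ((z , x) ∷ b) → + j ℤ.≤ z →
    ∃₂ λ u y → read j ((z , x) ∷ b) ≡ u ∷ʳ north y
  read-ends-north s j≤z = ends-north _ (read-nonempty s j≤z) (read-no-east-last s)

  word-ends-north : ∀ J {z} {x : X} {b} → Slope ((z , x) ∷ b) → 0ℤ ℤ.≤ z →
    ∃₂ λ u y → word J ((z , x) ∷ b) ≡ u ∷ʳ north y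
  word-ends-north zero s 0≤z = read-ends-north s 0≤z
  word-ends-north (suc J) {z} {x} {b} s 0≤z with word-ends-north J s 0≤z
  ... | u , y , eq = read (suc J) ((z , x) ∷ b) ++ u , y ,
    trans (cong (read (suc J) ((z , x) ∷ b) ++_) eq) (sym (++-assoc (read (suc J) ((z , x) ∷ b)) u _))

  -- The lists of labels of North and East letters

  pick : ℕ → ℤ × X → List X
  pick j (z , x) = if z ==ℤ + j then x ∷ [] else []

  labels : ℕ → List (ℤ × X) → List X
  labels j = concatMap (pick j)

  norths : List (Letter X) → List X
  norths []            = []
  norths (north x ∷ u) = x ∷ norths u
  norths (east _ ∷ u)  = norths u

  easts : List (Letter X) → List X
  easts []            = []
  easts (north _ ∷ u) = easts u
  easts (east x ∷ u)  = x ∷ easts u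

  norths-++ : ∀ u u′ → norths (u ++ u′) ≡ norths u ++ norths u′
  norths-++ []            u′ = refl
  norths-++ (north x ∷ u) u′ = cong (x ∷_) (norths-++ u u′)
  norths-++ (east _ ∷ u)  u′ = norths-++ u u′

  easts-++ : ∀ u u′ → easts (u ++ u′) ≡ easts u ++ easts u′
  easts-++ []            u′ = refl
  easts-++ (north _ ∷ u) u′ = easts-++ u u′
  easts-++ (east x ∷ u)  u′ = cong (x ∷_) (easts-++ u u′)

  norths-read : ∀ j b → norths (read j b) ≡ labels j b
  norths-read j [] = refl
  norths-read j ((z , x) ∷ b) with z ℤP.≟ + j
  ... | yes _ = cong (x ∷_) (norths-read j b)
  ... | no _ with z ℤP.≟ + suc j
  ...   | yes _ = norths-read j b
  ...   | no _  = norths-read j b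

  easts-read : ∀ j b → easts (read j b) ≡ labels (suc j) b
  easts-read j [] = refl
  easts-read j ((z , x) ∷ b) with z ℤP.≟ + j | z ℤP.≟ + suc j
  ... | yes p | yes q = ⊥-elim (ℕP.1+n≢n (ℤP.+-injective (trans (sym q) p)))
  ... | yes _ | no _  = easts-read j b
  ... | no _  | yes _ = cong (x ∷_) (easts-read j b)
  ... | no _  | no _  = easts-read j b

  -- The Easts of level `j` and the Norths of level `j + 1` are the same entries in the same order,
  -- so that the two lists differ only at the extreme levels.
  easts-norths-word : ∀ J b → easts (word J b) ++ labels 0 b ≡ labels (suc J) b ++ norths (word J b)
  easts-norths-word zero b rewrite easts-read 0 b | norths-read 0 b = refl
  easts-norths-word (suc J) b
    rewrite easts-++ (read (suc J) b) (word J b) | norths-++ (read (suc J) b) (word J b)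
          | easts-read (suc J) b | norths-read (suc J) b
    = trans (++-assoc (labels (suc (suc J)) b) _ _) (cong (labels (suc (suc J)) b ++_) (easts-norths-word J b))

-- Doubled sequences

-- The value of a row, its label in the left half of the doubled sequence and that in the right half.
Row : Set → Set
Row X = ℤ × X × X

height : ∀ {X} → Row X → ℤ
height = proj₁

left right : ∀ {X} → Row X → ℤ × X
left  (a , x , _) = - a , x
right (a , _ , y) = a , y

lefts rights doubled : ∀ {X} → (ℕ → Row X) → ℕ → List (ℤ × X)
lefts   ρ = applyDownFrom (left ∘ ρ)
rights  ρ = applyUpTo (right ∘ ρ)
doubled ρ n = lefts ρ n ++ rights ρ n

applyUpTo-cong : ∀ {A : Set} {f g : ℕ → A} n → (∀ {k} → k < n → f k ≡ g k) → applyUpTo f n ≡ applyUpTo g n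
applyUpTo-cong zero    eq = refl
applyUpTo-cong (suc n) eq = cong₂ _∷_ (eq ℕ.z<s) (applyUpTo-cong n (eq ∘ s≤s))

applyDownFrom-cong : ∀ {A : Set} {f g : ℕ → A} n → (∀ {k} → k < n → f k ≡ g k) → applyDownFrom f n ≡ applyDownFrom g n
applyDownFrom-cong zero    eq = refl
applyDownFrom-cong (suc n) eq = cong₂ _∷_ (eq (ℕP.n<1+n n)) (applyDownFrom-cong n (eq ∘ ℕP.m<n⇒m<1+n))

-- The window as a list of Norths, and its length

sumTo : ℕ → (ℕ → ℕ) → ℕ
sumTo zero    f = f 0
sumTo (suc J) f = f (suc J) ℕ.+ sumTo J f

sumTo-zero : ∀ J {f} → (∀ i → i ≤ J → f i ≡ 0) → sumTo J f ≡ 0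
sumTo-zero zero    eq = eq 0 z≤n
sumTo-zero (suc J) eq = cong₂ ℕ._+_ (eq (suc J) ℕP.≤-refl) (sumTo-zero J (λ i p → eq i (ℕP.m≤n⇒m≤1+n p)))

sumTo-single : ∀ {J c f} → c ≤ J → f c ≡ 1 → (∀ i → i ≢ c → f i ≡ 0) → sumTo J f ≡ 1
sumTo-single {zero}  z≤n one none = one
sumTo-single {suc J} {c} p one none with c ℕ.≟ suc J
... | yes refl = cong₂ ℕ._+_ one (sumTo-zero J (λ i q → none i (ℕP.<⇒≢ (s≤s q))))
... | no ne    = cong₂ ℕ._+_ (none (suc J) (ne ∘ sym)) (sumTo-single (ℕP.≤-pred (ℕP.≤∧≢⇒< p ne)) one none)

-- The window of d_D read from right to left.
backward : ∀ {X} → ℕ → List (ℤ × X) → List (ℤ × X) → List X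
backward zero    L R = labels 1 R ++ labels 0 L
backward (suc J) L R = (labels (suc (suc J)) R ++ labels (suc J) L) ++ backward J L R

module _ {X : Set} where

  read-++ : ∀ j (b b′ : List (ℤ × X)) → read j (b ++ b′) ≡ read j b ++ read j b′
  read-++ j = concatMap-++ (glyph j)

  labels-++ : ∀ j (b b′ : List (ℤ × X)) → labels j (b ++ b′) ≡ labels j b ++ labels j b′
  labels-++ j = concatMap-++ (pick j)

  -- A block of the window joins the right half of level `i + 1` to the left half of level `i`,
  -- which meet where the word passes to the next level. Regrouping by half a level leaves one right
  -- half over at each end.
  norths-word : ∀ J (L R : List (ℤ × X)) →
    labels (suc J) R ++ norths (word J (L ++ R)) ≡ backward J L R ++ labels 0 R
  norths-word zero L R rewrite norths-read 0 (L ++ R) | labels-++ 0 L R = sym (++-assoc (labels 1 R) _ _)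
  norths-word (suc J) L R
    rewrite norths-++ (read (suc J) (L ++ R)) (word J (L ++ R)) | norths-read (suc J) (L ++ R)
          | labels-++ (suc J) L R = begin
      A ++ (B ++ C) ++ D ≡⟨ cong (A ++_) (++-assoc B C D) ⟩
      A ++ B ++ C ++ D   ≡⟨ ++-assoc A B (C ++ D) ⟨
      (A ++ B) ++ C ++ D ≡⟨ cong ((A ++ B) ++_) (norths-word J L R) ⟩
      (A ++ B) ++ backward J L R ++ labels 0 R ≡⟨ ++-assoc (A ++ B) _ _ ⟨
      ((A ++ B) ++ backward J L R) ++ labels 0 R ∎
    where
    open ≡-Reasoning
    A = labels (suc (suc J)) R
    B = labels (suc J) L
    C = labels (suc J) R
    D = norths (word J (L ++ R))

  Within : ℕ → List (ℤ × X) → Set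
  Within M b = ∀ {j} → M < j → labels j b ≡ []

  pick-outside : ∀ {M j} (e : ℤ × X) → ∣ proj₁ e ∣ ≤ M → M < j → pick j e ≡ []
  pick-outside {M} {j} (z , x) p q with z ℤP.≟ + j
  ... | yes refl = ⊥-elim (ℕP.<-irrefl refl (ℕP.<-≤-trans q p))
  ... | no _     = refl

  glyph-outside : ∀ {j} (e : ℤ × X) → ∣ proj₁ e ∣ < j → glyph j e ≡ []
  glyph-outside {j} (z , x) p with glyph j (z , x) | glyph-view j z x
  ... | _ | north-at refl = ⊥-elim (ℕP.<-irrefl refl p)
  ... | _ | east-at refl  = ⊥-elim (ℕP.<-irrefl refl (ℕP.m<n⇒m<1+n p))
  ... | _ | blank _ _     = refl

  within-rights : ∀ {M} (ρ : ℕ → Row X) n → (∀ {k} → k < n → ∣ height (ρ k) ∣ ≤ M) → Within M (rights ρ n)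
  within-rights ρ zero    bd p = refl
  within-rights ρ (suc n) bd p = cong₂ _++_ (pick-outside (right (ρ 0)) (bd ℕ.z<s) p) (within-rights (ρ ∘ suc) n (bd ∘ s≤s) p)

  within-lefts : ∀ {M} (ρ : ℕ → Row X) n → (∀ {k} → k < n → ∣ height (ρ k) ∣ ≤ M) → Within M (lefts ρ n)
  within-lefts ρ zero    bd p = refl
  within-lefts ρ (suc n) bd p = cong₂ _++_
    (pick-outside (left (ρ n)) (subst (_≤ _) (sym (ℤP.∣-i∣≡∣i∣ (height (ρ n)))) (bd (ℕP.n<1+n n))) p)
    (within-lefts ρ n (bd ∘ ℕP.m<n⇒m<1+n) p)

  backward-extend : ∀ {M} k {L R} → Within M L → Within M R → backward (k ℕ.+ M) L R ≡ backward M L R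
  backward-extend zero    wL wR = refl
  backward-extend {M} (suc k) wL wR
    rewrite wR {suc (suc (k ℕ.+ M))} (s≤s (ℕP.m≤n⇒m≤1+n (ℕP.m≤n+m M k)))
          | wL {suc (k ℕ.+ M)} (s≤s (ℕP.m≤n+m M k)) = backward-extend k wL wR

  -- Reconciles two cut-offs: `dD` runs up to the sum of all |μ_j|, while the word has the levels up
  -- to 2n - 1. Blocks beyond the largest |μ_j| are empty.
  backward-irrelevant : ∀ {M M′ L R} → Within M L → Within M R → Within M′ L → Within M′ R →
    backward M L R ≡ backward M′ L R
  backward-irrelevant {M} {M′} {L} {R} wL wR wL′ wR′ = trans (sym (backward-extend M′ wL wR))
    (trans (cong (λ m → backward m L R) (ℕP.+-comm M′ M)) (backward-extend M wL′ wR′))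

  hits : ℤ × X → ℤ × X → ℕ → ℕ
  hits p q i = length (pick (suc i) q) ℕ.+ length (pick i p)

  length-backward-step : ∀ J p q (L R : List (ℤ × X)) →
    length (backward J (p ∷ L) (R ∷ʳ q)) ≡ sumTo J (hits p q) ℕ.+ length (backward J L R)
  length-backward-step J p q L R = go J
    where
    open ℕ-Solver
    block : ∀ i → length (labels (suc i) (R ∷ʳ q) ++ labels i (p ∷ L)) ≡
      (length (pick (suc i) q) ℕ.+ length (pick i p)) ℕ.+ length (labels (suc i) R ++ labels i L)
    block i rewrite labels-++ (suc i) R (q ∷ []) | ++-identityʳ (pick (suc i) q)
        | length-++ (labels (suc i) R ++ pick (suc i) q) {pick i p ++ labels i L}
        | length-++ (labels (suc i) R) {pick (suc i) q} | length-++ (pick i p) {labels i L}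
        | length-++ (labels (suc i) R) {labels i L} =
      solve 4 (λ a b c d → a :+ b :+ (c :+ d) := b :+ c :+ (a :+ d)) refl
        (length (labels (suc i) R)) (length (pick (suc i) q)) (length (pick i p)) (length (labels i L))
    go : ∀ J → length (backward J (p ∷ L) (R ∷ʳ q)) ≡ sumTo J (hits p q) ℕ.+ length (backward J L R)
    go zero = block 0
    go (suc J) rewrite length-++ (labels (suc (suc J)) (R ∷ʳ q) ++ labels (suc J) (p ∷ L)) {backward J (p ∷ L) (R ∷ʳ q)}
        | length-++ (labels (suc (suc J)) R ++ labels (suc J) L) {backward J L R} | block (suc J) | go J =
      solve 4 (λ a b c d → a :+ b :+ (c :+ d) := (a :+ c) :+ (b :+ d)) refl
        (length (pick (suc (suc J)) q) ℕ.+ length (pick (suc J) p))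
        (length (labels (suc (suc J)) R ++ labels (suc J) L)) (sumTo J (hits p q)) (length (backward J L R))

  pick-yes : ∀ j z (x : X) → z ≡ + j → pick j (z , x) ≡ x ∷ []
  pick-yes j z x e with z ℤP.≟ + j
  ... | yes _ = refl
  ... | no ne = ⊥-elim (ne e)

  pick-no : ∀ j z (x : X) → z ≢ + j → pick j (z , x) ≡ []
  pick-no j z x ne with z ℤP.≟ + j
  ... | yes e = ⊥-elim (ne e)
  ... | no _  = refl

  -- A value a ≤ 0 is taken from the left copy in block -a, a value a > 0 from the right copy in
  -- block a - 1.
  hits-row : ∀ a (x y : X) → ∃ λ c → c ≤ ∣ a ∣ × hits (- a , x) (a , y) c ≡ 1 ×
    (∀ i → i ≢ c → hits (- a , x) (a , y) i ≡ 0)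
  hits-row a@(+ zero) x y = 0 , z≤n ,
    cong₂ count (pick-no 1 a y (λ ())) (pick-yes 0 (- a) x refl) ,
    λ i ne → cong₂ count (pick-no (suc i) a y (λ ())) (pick-no i (- a) x (λ e → ne (sym (ℤP.+-injective e))))
    where count = λ (u u′ : List X) → length u ℕ.+ length u′
  hits-row a@(+ suc k) x y = k , ℕP.n≤1+n k ,
    cong₂ count (pick-yes (suc k) a y refl) (pick-no k (- a) x (λ ())) ,
    λ i ne → cong₂ count (pick-no (suc i) a y (λ e → ne (ℕP.suc-injective (sym (ℤP.+-injective e))))) (pick-no i (- a) x (λ ()))
    where count = λ (u u′ : List X) → length u ℕ.+ length u′
  hits-row a@(-[1+ k ]) x y = suc k , ℕP.≤-refl ,
    cong₂ count (pick-no (suc (suc k)) a y (λ ())) (pick-yes (suc k) (- a) x refl) ,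
    λ i ne → cong₂ count (pick-no (suc i) a y (λ ())) (pick-no i (- a) x (λ e → ne (sym (ℤP.+-injective e))))
    where count = λ (u u′ : List X) → length u ℕ.+ length u′

  length-backward-[] : ∀ J → length (backward {X} J [] []) ≡ 0
  length-backward-[] zero    = refl
  length-backward-[] (suc J) = length-backward-[] J

  length-backward : ∀ J (ρ : ℕ → Row X) n → (∀ {k} → k < n → ∣ height (ρ k) ∣ ≤ J) →
    length (backward J (lefts ρ n) (rights ρ n)) ≡ n
  length-backward J ρ zero bd = length-backward-[] J
  length-backward J ρ (suc n) bd with hits-row (height (ρ n)) (proj₁ (proj₂ (ρ n))) (proj₂ (proj₂ (ρ n)))
  ... | c , c≤ , one , none = begin
    length (backward J (lefts ρ (suc n)) (rights ρ (suc n)))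
      ≡⟨ cong (λ R → length (backward J (lefts ρ (suc n)) R)) (applyUpTo-∷ʳ (right ∘ ρ) n) ⟨
    length (backward J (left (ρ n) ∷ lefts ρ n) (rights ρ n ∷ʳ right (ρ n)))
      ≡⟨ length-backward-step J (left (ρ n)) (right (ρ n)) (lefts ρ n) (rights ρ n) ⟩
    sumTo J (hits (left (ρ n)) (right (ρ n))) ℕ.+ length (backward J (lefts ρ n) (rights ρ n))
      ≡⟨ cong₂ ℕ._+_ (sumTo-single (ℕP.≤-trans c≤ (bd (ℕP.n<1+n n))) one none)
           (length-backward J ρ n (bd ∘ ℕP.m<n⇒m<1+n)) ⟩
    suc n ∎
    where open ≡-Reasoning

-- Invariance under the two reflections

suc-==ℤ : ∀ m j → (ℤ.suc m ==ℤ + suc j) ≡ (m ==ℤ + j)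
suc-==ℤ (+ k)          j = refl
suc-==ℤ -[1+ zero ]    j = refl
suc-==ℤ -[1+ suc k ]   j = refl

suc[-[1-l]]≡l : ∀ l → ℤ.suc (- (1ℤ ℤ.- l)) ≡ l
suc[-[1-l]]≡l l = begin
  ℤ.suc (- (1ℤ ℤ.- l))   ≡⟨ cong ℤ.suc (ℤP.neg-distrib-+ 1ℤ (- l)) ⟩
  ℤ.suc (-1ℤ ℤ.+ - - l)  ≡⟨ ℤP.suc-pred (- - l) ⟩
  - - l                  ≡⟨ ℤP.neg-involutive l ⟩
  l ∎
  where open ≡-Reasoning

dropLast-∷ʳ : ∀ {A : Set} (xs : List A) x → dropLast (xs ∷ʳ x) ≡ xs
dropLast-∷ʳ []           x = refl
dropLast-∷ʳ (y ∷ [])     x = refl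
dropLast-∷ʳ (y ∷ z ∷ xs) x = cong (y ∷_) (dropLast-∷ʳ (z ∷ xs) x)

module _ {X : Set} where

  glyph-suc : ∀ j m (x : X) → glyph (suc j) (ℤ.suc m , x) ≡ glyph j (m , x)
  glyph-suc j m x rewrite suc-==ℤ m j | suc-==ℤ m (suc j) = refl

  pick-suc : ∀ j m (x : X) → pick (suc j) (ℤ.suc m , x) ≡ pick j (m , x)
  pick-suc j m x rewrite suc-==ℤ m j = refl

  -- The two glyphs commute since they are never both nonempty: one needs l > 0, the other l ≤ 0.
  -- Each then changes its level, because raising a value and the level together by 1 does not alter
  -- the glyph.
  glyph-reflect : ∀ j l (x y : X) →
    glyph (suc j) (l , y) ++ glyph j (- l , x) ≡ glyph (suc j) (1ℤ ℤ.- l , x) ++ glyph j (- (1ℤ ℤ.- l) , y)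
  glyph-reflect j l x y = trans commute (sym (cong₂ _++_ (glyph-suc j (- l) x)
      (trans (sym (glyph-suc j (- (1ℤ ℤ.- l)) y)) (cong (λ z → glyph (suc j) (z , y)) (suc[-[1-l]]≡l l)))))
    where
    commute : glyph (suc j) (l , y) ++ glyph j (- l , x) ≡ glyph j (- l , x) ++ glyph (suc j) (l , y)
    commute with glyph (suc j) (l , y) | glyph-view (suc j) l y
    ... | _ | north-at refl = refl
    ... | _ | east-at refl  = refl
    ... | _ | blank _ _     = sym (++-identityʳ _)

  pick-reflect : ∀ j l (x y : X) →
    pick (suc j) (l , y) ++ pick j (- l , x) ≡ pick (suc j) (1ℤ ℤ.- l , x) ++ pick j (- (1ℤ ℤ.- l) , y)
  pick-reflect j l x y = trans commute (sym (cong₂ _++_ (pick-suc j (- l) x)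
      (trans (sym (pick-suc j (- (1ℤ ℤ.- l)) y)) (cong (λ z → pick (suc j) (z , y)) (suc[-[1-l]]≡l l)))))
    where
    commute : pick (suc j) (l , y) ++ pick j (- l , x) ≡ pick j (- l , x) ++ pick (suc j) (l , y)
    commute with l ℤP.≟ + suc j
    ... | yes refl = refl
    ... | no _     = sym (++-identityʳ _)

  -- The word regrouped so that the glyph of q at a level meets the glyph of p at the next lower
  -- level: this pair only depends on the class of the last row under l ↦ 1 - l.
  core : ℕ → ℤ × X → List (ℤ × X) → ℤ × X → List (Letter X)
  core zero    p b q = read 0 b
  core (suc J) p b q = read (suc J) b ++ (glyph (suc J) q ++ glyph J p) ++ core J p b q

  word-core : ∀ J p b q → word J (p ∷ b ∷ʳ q) ≡ glyph J p ++ core J p b q ++ glyph 0 q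
  word-core zero    p b q rewrite read-++ 0 b (q ∷ []) | ++-identityʳ (glyph 0 q) = refl
  word-core (suc J) p b q rewrite read-++ (suc J) b (q ∷ []) | ++-identityʳ (glyph (suc J) q) | word-core J p b q = begin
      (gP ++ (r ++ gq)) ++ gp ++ c ++ g0   ≡⟨ ++-assoc gP (r ++ gq) _ ⟩
      gP ++ (r ++ gq) ++ gp ++ c ++ g0     ≡⟨ cong (gP ++_) (++-assoc r gq _) ⟩
      gP ++ r ++ gq ++ gp ++ c ++ g0       ≡⟨ cong (λ u → gP ++ r ++ u) (++-assoc gq gp _) ⟨
      gP ++ r ++ (gq ++ gp) ++ c ++ g0     ≡⟨ cong (λ u → gP ++ r ++ u) (++-assoc (gq ++ gp) c g0) ⟨
      gP ++ r ++ ((gq ++ gp) ++ c) ++ g0   ≡⟨ cong (gP ++_) (++-assoc r _ g0) ⟨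
      gP ++ (r ++ (gq ++ gp) ++ c) ++ g0 ∎
    where
    open ≡-Reasoning
    gP = glyph (suc J) p
    r  = read (suc J) b
    gq = glyph (suc J) q
    gp = glyph J p
    c  = core J p b q
    g0 = glyph 0 q

  core-reflect : ∀ J l (x y : X) b →
    core J (- l , x) b (l , y) ≡ core J (- (1ℤ ℤ.- l) , y) b (1ℤ ℤ.- l , x)
  core-reflect zero    l x y b = refl
  core-reflect (suc J) l x y b = cong (read (suc J) b ++_) (cong₂ _++_ (glyph-reflect J l x y) (core-reflect J l x y b))

  backward-reflect : ∀ J l (x y : X) L R →
    backward J ((- l , x) ∷ L) (R ∷ʳ (l , y)) ≡ backward J ((- (1ℤ ℤ.- l) , y) ∷ L) (R ∷ʳ (1ℤ ℤ.- l , x))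
  backward-reflect J l x y L R = go J
    where
    block : ∀ i → labels (suc i) (R ∷ʳ (l , y)) ++ labels i ((- l , x) ∷ L) ≡
      labels (suc i) (R ∷ʳ (1ℤ ℤ.- l , x)) ++ labels i ((- (1ℤ ℤ.- l) , y) ∷ L)
    block i rewrite labels-++ (suc i) R ((l , y) ∷ []) | labels-++ (suc i) R ((1ℤ ℤ.- l , x) ∷ [])
      | ++-identityʳ (pick (suc i) (l , y)) | ++-identityʳ (pick (suc i) (1ℤ ℤ.- l , x))
      | ++-assoc (labels (suc i) R) (pick (suc i) (l , y)) (pick i (- l , x) ++ labels i L)
      | ++-assoc (labels (suc i) R) (pick (suc i) (1ℤ ℤ.- l , x)) (pick i (- (1ℤ ℤ.- l) , y) ++ labels i L) =
      cong (labels (suc i) R ++_) (trans (sym (++-assoc (pick (suc i) (l , y)) _ _))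
        (trans (cong (_++ labels i L) (pick-reflect i l x y)) (++-assoc (pick (suc i) (1ℤ ℤ.- l , x)) _ _)))
    go : ∀ J → backward J ((- l , x) ∷ L) (R ∷ʳ (l , y)) ≡ backward J ((- (1ℤ ℤ.- l) , y) ∷ L) (R ∷ʳ (1ℤ ℤ.- l , x))
    go zero    = block 0
    go (suc J) = cong₂ _++_ (block (suc J)) (go J)

  -- l and 1 - l are in {0 , 1} together, and then the level-0 glyph is the deleted last letter.
  dropLast-reflect : ∀ (u : List (Letter X)) l (x y : X) →
    dropLast (u ++ glyph 0 (l , y)) ≡ dropLast (u ++ glyph 0 (1ℤ ℤ.- l , x))
  dropLast-reflect u (+ zero)         x y = trans (dropLast-∷ʳ u _) (sym (dropLast-∷ʳ u _))
  dropLast-reflect u (+ suc zero)     x y = trans (dropLast-∷ʳ u _) (sym (dropLast-∷ʳ u _))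
  dropLast-reflect u (+ suc (suc l))  x y = refl
  dropLast-reflect u -[1+ l ]         x y = refl

  -- Besides `core`, there remain the glyph at the very beginning, which is empty as `J` exceeds
  -- both absolute values, and the one at the very end, whose change `dropLast` hides.
  word-reflect : ∀ {J} l (x y : X) b → ∣ l ∣ < J → ∣ 1ℤ ℤ.- l ∣ < J →
    dropLast (word J ((- l , x) ∷ b ∷ʳ (l , y))) ≡ dropLast (word J ((- (1ℤ ℤ.- l) , y) ∷ b ∷ʳ (1ℤ ℤ.- l , x)))
  word-reflect {J} l x y b bd bd′
    rewrite word-core J (- l , x) b (l , y) | word-core J (- (1ℤ ℤ.- l) , y) b (1ℤ ℤ.- l , x)
          | glyph-outside (- l , x) (subst (_< J) (sym (ℤP.∣-i∣≡∣i∣ l)) bd)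
          | glyph-outside (- (1ℤ ℤ.- l) , y) (subst (_< J) (sym (ℤP.∣-i∣≡∣i∣ (1ℤ ℤ.- l))) bd′)
          | core-reflect J l x y b = dropLast-reflect _ l x y

  -- One of h and -h is negative and yields no letter. For h = 0 there would be two Norths at level
  -- 0, and exchanging them would exchange their labels.
  glyph-commute : ∀ j h (x y : X) → h ≢ 0ℤ →
    glyph j (- h , x) ++ glyph j (h , y) ≡ glyph j (h , y) ++ glyph j (- h , x)
  glyph-commute j h x y ne with glyph j (h , y) | glyph-view j h y
  ... | _ | blank _ _ = ++-identityʳ _
  glyph-commute zero    h x y ne | _ | north-at e = ⊥-elim (ne e)
  glyph-commute (suc j) h x y ne | _ | north-at refl = refl
  glyph-commute j       h x y ne | _ | east-at refl  = refl

  word-commute : ∀ J h (x y : X) b b′ → h ≢ 0ℤ →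
    word J (b ++ (- h , x) ∷ (h , y) ∷ b′) ≡ word J (b ++ (h , y) ∷ (- h , x) ∷ b′)
  word-commute J h x y b b′ ne = go J
    where
    level : ∀ j → read j (b ++ (- h , x) ∷ (h , y) ∷ b′) ≡ read j (b ++ (h , y) ∷ (- h , x) ∷ b′)
    level j rewrite read-++ j b ((- h , x) ∷ (h , y) ∷ b′) | read-++ j b ((h , y) ∷ (- h , x) ∷ b′) =
      cong (read j b ++_) (trans (sym (++-assoc (glyph j (- h , x)) _ _))
        (trans (cong (_++ read j b′) (glyph-commute j h x y ne)) (++-assoc (glyph j (h , y)) _ _)))
    go : ∀ J → word J (b ++ (- h , x) ∷ (h , y) ∷ b′) ≡ word J (b ++ (h , y) ∷ (- h , x) ∷ b′)
    go zero    = level 0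
    go (suc J) = cong₂ _++_ (level (suc J)) (go J)

  doubled-split-first : ∀ (ρ : ℕ → Row X) n →
    doubled ρ (suc n) ≡ lefts (ρ ∘ suc) n ++ left (ρ 0) ∷ right (ρ 0) ∷ rights (ρ ∘ suc) n
  doubled-split-first ρ n = trans (cong (_++ rights ρ (suc n)) (sym (applyDownFrom-∷ʳ (left ∘ ρ) n)))
    (++-assoc (lefts (ρ ∘ suc) n) _ _)

  doubled-split-last : ∀ (ρ : ℕ → Row X) n →
    doubled ρ (suc n) ≡ left (ρ n) ∷ doubled ρ n ∷ʳ right (ρ n)
  doubled-split-last ρ n = cong (left (ρ n) ∷_) (trans (cong (lefts ρ n ++_) (sym (applyUpTo-∷ʳ (right ∘ ρ) n)))
    (sym (++-assoc (lefts ρ n) (rights ρ n) _)))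

  module ReflectLast (ρ ρ′ : ℕ → Row X) (n : ℕ) (same : ∀ {k} → k < n → ρ k ≡ ρ′ k)
    (l : ℤ) (x y : X) (at-n : ρ n ≡ (l , x , y)) (at-n′ : ρ′ n ≡ (1ℤ ℤ.- l , y , x)) where

    word-invariant : ∀ {J} → ∣ l ∣ < J → ∣ 1ℤ ℤ.- l ∣ < J →
      dropLast (word J (doubled ρ (suc n))) ≡ dropLast (word J (doubled ρ′ (suc n)))
    word-invariant bd bd′
      rewrite doubled-split-last ρ n | doubled-split-last ρ′ n | at-n | at-n′
            | applyDownFrom-cong {f = left ∘ ρ} {left ∘ ρ′} n (cong left ∘ same)
            | applyUpTo-cong {f = right ∘ ρ} {right ∘ ρ′} n (cong right ∘ same)
      = word-reflect l x y (doubled ρ′ n) bd bd′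

    backward-invariant : ∀ J → backward J (lefts ρ (suc n)) (rights ρ (suc n)) ≡ backward J (lefts ρ′ (suc n)) (rights ρ′ (suc n))
    backward-invariant J
      rewrite sym (applyUpTo-∷ʳ (right ∘ ρ) n) | sym (applyUpTo-∷ʳ (right ∘ ρ′) n) | at-n | at-n′
            | applyDownFrom-cong {f = left ∘ ρ} {left ∘ ρ′} n (cong left ∘ same)
            | applyUpTo-cong {f = right ∘ ρ} {right ∘ ρ′} n (cong right ∘ same)
      = backward-reflect J l x y (lefts ρ′ n) (rights ρ′ n)

  module NegateFirst (ρ ρ′ : ℕ → Row X) (n : ℕ) (same : ∀ {k} → k < n → ρ (suc k) ≡ ρ′ (suc k))
    (h : ℤ) (x y : X) (at-0 : ρ 0 ≡ (h , x , y)) (at-0′ : ρ′ 0 ≡ (- h , y , x)) (h≢0 : h ≢ 0ℤ) where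

    word-invariant : ∀ J → word J (doubled ρ (suc n)) ≡ word J (doubled ρ′ (suc n))
    word-invariant J
      rewrite doubled-split-first ρ n | doubled-split-first ρ′ n | at-0 | at-0′ | ℤP.neg-involutive h
            | applyDownFrom-cong {f = left ∘ ρ ∘ suc} {left ∘ ρ′ ∘ suc} n (cong left ∘ same)
            | applyUpTo-cong {f = right ∘ ρ ∘ suc} {right ∘ ρ′ ∘ suc} n (cong right ∘ same)
      = word-commute J h x y (lefts (ρ′ ∘ suc) n) (rights (ρ′ ∘ suc) n) h≢0

    -- The entry of the first row moves to a neighbouring block, so the blocks cannot be compared
    -- one by one. The window is instead read off from the Norths of the word, after which come the
    -- zero entries of the right half; a nonzero first row does not touch these.
    backward-invariant : ∀ {J} → (∀ {k} → k < suc n → ∣ height (ρ k) ∣ ≤ J) → (∀ {k} → k < suc n → ∣ height (ρ′ k) ∣ ≤ J) →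
      backward J (lefts ρ (suc n)) (rights ρ (suc n)) ≡ backward J (lefts ρ′ (suc n)) (rights ρ′ (suc n))
    backward-invariant {J} bd bd′ = ++-cancelʳ (labels 0 (rights ρ (suc n))) _ _ (begin
      backward J (lefts ρ (suc n)) (rights ρ (suc n)) ++ labels 0 (rights ρ (suc n))
        ≡⟨ via ρ bd ⟩
      norths (word J (doubled ρ (suc n)))
        ≡⟨ cong norths (word-invariant J) ⟩
      norths (word J (doubled ρ′ (suc n)))
        ≡⟨ via ρ′ bd′ ⟨
      backward J (lefts ρ′ (suc n)) (rights ρ′ (suc n)) ++ labels 0 (rights ρ′ (suc n))
        ≡⟨ cong (backward J (lefts ρ′ (suc n)) (rights ρ′ (suc n)) ++_) zeros ⟨
      backward J (lefts ρ′ (suc n)) (rights ρ′ (suc n)) ++ labels 0 (rights ρ (suc n)) ∎)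
      where
      open ≡-Reasoning
      via : ∀ σ → (∀ {k} → k < suc n → ∣ height (σ k) ∣ ≤ J) →
        backward J (lefts σ (suc n)) (rights σ (suc n)) ++ labels 0 (rights σ (suc n)) ≡ norths (word J (doubled σ (suc n)))
      via σ b = trans (sym (norths-word J (lefts σ (suc n)) (rights σ (suc n))))
        (cong (_++ norths (word J (doubled σ (suc n)))) (within-rights σ (suc n) b (ℕP.n<1+n J)))
      zeros : labels 0 (rights ρ (suc n)) ≡ labels 0 (rights ρ′ (suc n))
      zeros rewrite at-0 | at-0′ | applyUpTo-cong {f = right ∘ ρ ∘ suc} {right ∘ ρ′ ∘ suc} n (cong right ∘ same)
        = cong (_++ labels 0 (rights (ρ′ ∘ suc) n))
            (trans (pick-no 0 h y h≢0) (sym (pick-no 0 (- h) x (λ e → h≢0 (trans (sym (ℤP.neg-involutive h)) (cong -_ e))))))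

-- Valleys of lattice paths

step : ∀ {X} → Letter X → Step
step (north _) = N
step (east _)  = E

steps : ∀ {X} → List (Letter X) → List Step
steps = map step

neg-==ℤ : ∀ z w → (- z ==ℤ w) ≡ (z ==ℤ - w)
neg-==ℤ z w with - z ℤP.≟ w | z ℤP.≟ - w
... | yes _ | yes _ = refl
... | no _  | no _  = refl
... | yes p | no ¬q = ⊥-elim (¬q (trans (sym (ℤP.neg-involutive z)) (cong -_ p)))
... | no ¬p | yes q = ⊥-elim (¬p (trans (cong -_ q) (ℤP.neg-involutive w)))

module _ {X : Set} where

  steps-glyph : ∀ j z (x : X) →
    steps (glyph j (z , x)) ≡ (if z ==ℤ + j then N ∷ [] else if z ==ℤ + suc j then E ∷ [] else [])
  steps-glyph j z x with z ==ℤ + j | z ==ℤ + suc j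
  ... | true  | _     = refl
  ... | false | true  = refl
  ... | false | false = refl

  steps-++ : ∀ (u u′ : List (Letter X)) → steps (u ++ u′) ≡ steps u ++ steps u′
  steps-++ = map-++ step

  Splus-rights : ∀ j (ρ : ℕ → Row X) n → Splus j (applyUpTo (height ∘ ρ) n) ≡ steps (read j (rights ρ n))
  Splus-rights j ρ zero    = refl
  Splus-rights j ρ (suc n) = trans (cong₂ _++_ (sym (steps-glyph j (height (ρ 0)) _)) (Splus-rights j (ρ ∘ suc) n))
    (sym (steps-++ (glyph j (right (ρ 0))) _))

  SminusLeft-lefts : ∀ j (ρ : ℕ → Row X) n → SminusLeft j (applyUpTo (height ∘ ρ) n) ≡ steps (read j (lefts ρ n))
  SminusLeft-lefts j ρ n = trans (cong (concatMap _) (reverse-applyUpTo (height ∘ ρ) n)) (go n)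
    where
    minus : ℤ → List Step
    minus x = if x ==ℤ - (+ j) then N ∷ [] else if x ==ℤ - (+ suc j) then E ∷ [] else []
    go : ∀ n → concatMap minus (applyDownFrom (height ∘ ρ) n) ≡ steps (read j (lefts ρ n))
    go zero    = refl
    go (suc n) = trans (cong₂ _++_ head (go n)) (sym (steps-++ (glyph j (left (ρ n))) _))
      where
      head : minus (height (ρ n)) ≡ steps (glyph j (left (ρ n)))
      head rewrite sym (neg-==ℤ (height (ρ n)) (+ j)) | sym (neg-==ℤ (height (ρ n)) (+ suc j)) =
        sym (steps-glyph j (- height (ρ n)) _)

  blocks-word : ∀ J (ρ : ℕ → Row X) n → let m = applyUpTo (height ∘ ρ) n in
    concatMap (λ j → SminusLeft j m ++ Splus j m) (downFrom (suc J)) ≡ steps (word J (doubled ρ n))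
  blocks-word J ρ n = go J
    where
    m = applyUpTo (height ∘ ρ) n
    level : ∀ j → SminusLeft j m ++ Splus j m ≡ steps (read j (doubled ρ n))
    level j rewrite SminusLeft-lefts j ρ n | Splus-rights j ρ n | read-++ j (lefts ρ n) (rights ρ n) =
      sym (steps-++ (read j (lefts ρ n)) _)
    go : ∀ J → concatMap (λ j → SminusLeft j m ++ Splus j m) (downFrom (suc J)) ≡ steps (word J (doubled ρ n))
    go zero    = trans (++-identityʳ _) (level 0)
    go (suc J) = trans (cong₂ _++_ (level (suc J)) (go J)) (sym (steps-++ (read (suc J) (doubled ρ n)) _))

dropLast-map : ∀ {A B : Set} (f : A → B) xs → dropLast (map f xs) ≡ map f (dropLast xs)
dropLast-map f []           = refl
dropLast-map f (x ∷ [])     = refl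
dropLast-map f (x ∷ y ∷ xs) = cong (f x ∷_) (dropLast-map f (y ∷ xs))

dropLast-++ : ∀ {A : Set} (xs : List A) y ys → dropLast (xs ++ y ∷ ys) ≡ xs ++ dropLast (y ∷ ys)
dropLast-++ []           y ys = refl
dropLast-++ (x ∷ [])     y ys = refl
dropLast-++ (x ∷ z ∷ xs) y ys = cong (x ∷_) (dropLast-++ (z ∷ xs) y ys)

nextIsN-∷-++ : ∀ s p q → nextIsN (s ∷ p) ≡ nextIsN (s ∷ p ++ q)
nextIsN-∷-++ N  p q = refl
nextIsN-∷-++ E  p q = refl
nextIsN-∷-++ Ep p q = refl
nextIsN-∷-++ Em p q = refl

-- The extra valley of a path ending with an East step, offset by the steps already read, as
-- induction on the path requires.
lastValley : ℕ → ℕ → List Step → List (ℕ × ℕ)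
lastValley e k p = if endsWithEast p then (e ℕ.+ countE p , suc (k ℕ.+ countN' p)) ∷ [] else []

lastValley-N : ∀ e k t p → lastValley e k (N ∷ t ∷ p) ≡ lastValley e (suc k) (t ∷ p)
lastValley-N e k t p rewrite ℕP.+-suc k (countN' (t ∷ p)) = refl

lastValley-east : ∀ s → isEast s ≡ true → ∀ e k t p → lastValley e k (s ∷ t ∷ p) ≡ lastValley (suc e) k (t ∷ p)
lastValley-east E  _ e k t p rewrite ℕP.+-suc e (countE (t ∷ p)) = refl
lastValley-east Ep _ e k t p rewrite ℕP.+-suc e (countE (t ∷ p)) = refl
lastValley-east Em _ e k t p rewrite ℕP.+-suc e (countE (t ∷ p)) = refl

east-case : ∀ e k t p {l} → l ≡ lastValley (suc e) k (t ∷ p) →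
  valleysAux (suc e) k (t ∷ p) ++ lastValley (suc e) k (t ∷ p) ≡ valleysAux (suc e) k (t ∷ p ∷ʳ N) →
  ((if nextIsN (t ∷ p) then (suc e , suc k) ∷ [] else []) ++ valleysAux (suc e) k (t ∷ p)) ++ l
    ≡ (if nextIsN (t ∷ p ∷ʳ N) then (suc e , suc k) ∷ [] else []) ++ valleysAux (suc e) k (t ∷ p ∷ʳ N)
east-case e k t p {l} eq ih rewrite sym (nextIsN-∷-++ t p (N ∷ [])) =
  trans (++-assoc (if nextIsN (t ∷ p) then _ else _) _ l)
    (cong ((if nextIsN (t ∷ p) then (suc e , suc k) ∷ [] else []) ++_)
      (trans (cong (valleysAux (suc e) k (t ∷ p) ++_) eq) ih))

valleysAux-∷ʳN : ∀ e k p → valleysAux e k p ++ lastValley e k p ≡ valleysAux e k (p ∷ʳ N)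
valleysAux-∷ʳN e k [] = refl
valleysAux-∷ʳN e k (N ∷ []) = refl
valleysAux-∷ʳN e k (E ∷ []) rewrite ℕP.+-comm e 1 | ℕP.+-identityʳ k = refl
valleysAux-∷ʳN e k (Ep ∷ []) rewrite ℕP.+-comm e 1 | ℕP.+-identityʳ k = refl
valleysAux-∷ʳN e k (Em ∷ []) rewrite ℕP.+-comm e 1 | ℕP.+-identityʳ k = refl
valleysAux-∷ʳN e k (N ∷ p@(t ∷ r)) =
  trans (cong (valleysAux e (suc k) p ++_) (lastValley-N e k t r)) (valleysAux-∷ʳN e (suc k) p)
valleysAux-∷ʳN e k (E ∷ p@(t ∷ r)) = east-case e k t r (lastValley-east E refl e k t r) (valleysAux-∷ʳN (suc e) k p)
valleysAux-∷ʳN e k (Ep ∷ p@(t ∷ r)) = east-case e k t r (lastValley-east Ep refl e k t r) (valleysAux-∷ʳN (suc e) k p)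
valleysAux-∷ʳN e k (Em ∷ p@(t ∷ r)) = east-case e k t r (lastValley-east Em refl e k t r) (valleysAux-∷ʳN (suc e) k p)

-- The convention for a final East step amounts to a further North step. As the letter deleted in
-- ζ_D is a North, this step restores the full word.
valleys-∷ʳN : ∀ p → valleys p ≡ valleysAux 0 0 (p ∷ʳ N)
valleys-∷ʳN = valleysAux-∷ʳN 0 0

data SignedE : Step → Set where
  ep : SignedE Ep
  em : SignedE Em

nextIsN-signedE : ∀ {s} → SignedE s → ∀ p q → nextIsN (p ++ s ∷ q) ≡ nextIsN (p ++ E ∷ q)
nextIsN-signedE ep []      q = refl
nextIsN-signedE em []      q = refl
nextIsN-signedE σ  (t ∷ p) q = trans (sym (nextIsN-∷-++ t p _)) (nextIsN-∷-++ t p _)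

valleysAux-signedE : ∀ {s} → SignedE s → ∀ e k p q → valleysAux e k (p ++ s ∷ q) ≡ valleysAux e k (p ++ E ∷ q)
valleysAux-signedE ep e k []      q = refl
valleysAux-signedE em e k []      q = refl
valleysAux-signedE σ  e k (N ∷ p) q = valleysAux-signedE σ e (suc k) p q
valleysAux-signedE σ  e k (E ∷ p) q rewrite nextIsN-signedE σ p q = cong (_ ++_) (valleysAux-signedE σ (suc e) k p q)
valleysAux-signedE σ  e k (Ep ∷ p) q rewrite nextIsN-signedE σ p q = cong (_ ++_) (valleysAux-signedE σ (suc e) k p q)
valleysAux-signedE σ  e k (Em ∷ p) q rewrite nextIsN-signedE σ p q = cong (_ ++_) (valleysAux-signedE σ (suc e) k p q)

data At {A : Set} (x : A) : ℕ → List A → Set where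
  here  : ∀ {xs} → At x 0 (x ∷ xs)
  there : ∀ {i y xs} → At x i xs → At x (suc i) (y ∷ xs)

record ValleyAt {X : Set} (u : List (Letter X)) (x y : X) (i j : ℕ) : Set where
  constructor valleyAt
  field
    adjacent  : Adjacent (east x) (north y) u
    at-easts  : At x i (easts u)
    at-norths : At y j (norths u)

module _ {X : Set} where

  valleysAux⁻ : ∀ e k (u : List (Letter X)) {ij} → ij ∈ valleysAux e k (steps u) →
    ∃₂ λ i j → ∃₂ λ x y → ij ≡ (suc (e ℕ.+ i) , suc (k ℕ.+ j)) × ValleyAt u x y i j
  valleysAux⁻ e k (north w ∷ u) v with valleysAux⁻ e (suc k) u v
  ... | i , j , x , y , eq , valleyAt a p q =
    i , suc j , x , y , trans eq (cong (λ m → suc (e ℕ.+ i) , suc m) (sym (ℕP.+-suc k j))) , valleyAt (there a) p (there q)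
  valleysAux⁻ e k (east x ∷ north y ∷ u) (here refl) =
    0 , 0 , x , y , cong₂ (λ a b → suc a , suc b) (sym (ℕP.+-identityʳ e)) (sym (ℕP.+-identityʳ k)) , valleyAt here here here
  valleysAux⁻ e k (east _ ∷ u@(north _ ∷ _)) (there v) with valleysAux⁻ (suc e) k u v
  ... | i , j , x , y , eq , valleyAt a p q =
    suc i , j , x , y , trans eq (cong (λ m → suc m , suc (k ℕ.+ j)) (sym (ℕP.+-suc e i))) , valleyAt (there a) (there p) q
  valleysAux⁻ e k (east _ ∷ u@(east _ ∷ _)) v with valleysAux⁻ (suc e) k u v
  ... | i , j , x , y , eq , valleyAt a p q =
    suc i , j , x , y , trans eq (cong (λ m → suc m , suc (k ℕ.+ j)) (sym (ℕP.+-suc e i))) , valleyAt (there a) (there p) q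

  valleysAux⁺ : ∀ e k {u : List (Letter X)} {x y} → Adjacent (east x) (north y) u →
    ∃₂ λ i j → (suc (e ℕ.+ i) , suc (k ℕ.+ j)) ∈ valleysAux e k (steps u) × ValleyAt u x y i j
  valleysAux⁺ e k here = 0 , 0 , here (cong₂ (λ a b → suc a , suc b) (ℕP.+-identityʳ e) (ℕP.+-identityʳ k)) , valleyAt here here here
  valleysAux⁺ e k {north w ∷ u} (there a) with valleysAux⁺ e (suc k) a
  ... | i , j , v , valleyAt a p q = i , suc j ,
    subst (λ m → (suc (e ℕ.+ i) , suc m) ∈ valleysAux e (suc k) (steps u)) (sym (ℕP.+-suc k j)) v , valleyAt (there a) p (there q)
  valleysAux⁺ e k {east _ ∷ u@(north _ ∷ _)} (there a) with valleysAux⁺ (suc e) k a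
  ... | i , j , v , valleyAt a p q = suc i , j ,
    there (subst (λ m → (suc m , suc (k ℕ.+ j)) ∈ valleysAux (suc e) k (steps u)) (sym (ℕP.+-suc e i)) v) , valleyAt (there a) (there p) q
  valleysAux⁺ e k {east _ ∷ u@(east _ ∷ _)} (there a) with valleysAux⁺ (suc e) k a
  ... | i , j , v , valleyAt a p q = suc i , j ,
    subst (λ m → (suc m , suc (k ℕ.+ j)) ∈ valleysAux (suc e) k (steps u)) (sym (ℕP.+-suc e i)) v , valleyAt (there a) (there p) q

  -- Used with `u` the part of the word before its n-th North, so that `rank` is n. The letter after
  -- `north y` decides between the formal symbol and a signed East step.
  module NorthThen (u : List (Letter X)) (y : X) where

    rank : ℕ
    rank = suc (length (norths u))

    -- If `g` is empty, then `north z` is the deleted letter and the path stops after `north y`;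
    -- `nextIsNOrEnd` counts the end as a North step.
    north-north : ∀ z g → nthNorthFollowedByN rank (steps (u ++ north y ∷ dropLast (north z ∷ g))) ≡ true
    north-north z g = go u g
      where
      go : ∀ u g → nthNorthFollowedByN (suc (length (norths u))) (steps (u ++ north y ∷ dropLast (north z ∷ g))) ≡ true
      go (north _ ∷ u) g       = go u g
      go (east _ ∷ u)  g       = go u g
      go []            []      = refl
      go []            (_ ∷ _) = refl

    north-north-unchanged : ∀ s z g → let p = steps (u ++ north y ∷ dropLast (north z ∷ g)) in replAfterNorth rank s p ≡ p
    north-north-unchanged s z g = go u g
      where
      go : ∀ u g → let p = steps (u ++ north y ∷ dropLast (north z ∷ g)) in
        replAfterNorth (suc (length (norths u))) s p ≡ p
      go (north _ ∷ u) g       = cong (N ∷_) (go u g)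
      go (east _ ∷ u)  g       = cong (E ∷_) (go u g)
      go []            []      = refl
      go []            (_ ∷ _) = refl

    north-east : ∀ {s} → SignedE s → ∀ (g : List (Letter X)) → nthNorthFollowedByN rank (steps u ++ N ∷ s ∷ steps g) ≡ false
    north-east {s} σ g = go u σ
      where
      go : ∀ u {s} → SignedE s → nthNorthFollowedByN (suc (length (norths u))) (steps u ++ N ∷ s ∷ steps g) ≡ false
      go (north _ ∷ u) σ  = go u σ
      go (east _ ∷ u)  σ  = go u σ
      go []            ep = refl
      go []            em = refl

    north-east-replaced : ∀ s x (g : List (Letter X)) → replAfterNorth rank s (steps (u ++ north y ∷ east x ∷ g)) ≡ steps u ++ N ∷ s ∷ steps g
    north-east-replaced s x g = go u
      where
      go : ∀ u → replAfterNorth (suc (length (norths u))) s (steps (u ++ north y ∷ east x ∷ g)) ≡ steps u ++ N ∷ s ∷ steps g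
      go (north _ ∷ u) = cong (N ∷_) (go u)
      go (east _ ∷ u)  = cong (E ∷_) (go u)
      go []            = refl

    epsilon-steps : ∀ (g : List (Letter X)) → epsilon (steps g) ≡ 1ℤ
    epsilon-steps []            = refl
    epsilon-steps (north _ ∷ g) = epsilon-steps g
    epsilon-steps (east _ ∷ g)  = epsilon-steps g

    epsilon-replaced : ∀ {s} → SignedE s → ∀ (g : List (Letter X)) → epsilon (steps u ++ N ∷ s ∷ steps g) ≡ (if isEm s then -1ℤ else 1ℤ)
    epsilon-replaced σ g = go u σ
      where
      go : ∀ u {s} → SignedE s → epsilon (steps u ++ N ∷ s ∷ steps g) ≡ (if isEm s then -1ℤ else 1ℤ)
      go (north _ ∷ u) σ  = go u σ
      go (east _ ∷ u)  σ  = go u σ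
      go []            ep = epsilon-steps g
      go []            em = refl

-- The window of d_D

-- The first row gets the tags formal and mirror if its value is 0: its left copy then gives the n-th
-- North step, whose label is a formal symbol, and its right copy the next one, which ends no valley.
data Tag : Set where
  plain formal mirror : Tag

Mark : Set
Mark = ℤ × Tag

value : Mark → ℤ
value = proj₁

sign : ℕ → List Step → ℕ → ℤ
sign n π j =
  if j ≡ᵇ n then neg1^ (1ℤ ℤ.+ getℤ (mu n π) (n ∸ 1) ℤ.+ getℤ (mu n π) n)
  else if j ≡ᵇ 1 then epsilon π ℤ.* neg1^ (1ℤ ℤ.+ getℤ (nu n) (n ∸ 1) ℤ.+ getℤ (nu n) n)
  else 1ℤ

adjusted : ℕ → List Step → ℕ × ℤ → ℤ
adjusted n π (j , x) =
  if j ≡ᵇ n then neg1^ (1ℤ ℤ.+ getℤ (mu n π) (n ∸ 1) ℤ.+ getℤ (mu n π) n) ℤ.* x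
  else if j ≡ᵇ 1 then epsilon π ℤ.* neg1^ (1ℤ ℤ.+ getℤ (nu n) (n ∸ 1) ℤ.+ getℤ (nu n) n) ℤ.* x
  else x

adjusted≡sign* : ∀ n π j x → adjusted n π (j , x) ≡ sign n π j ℤ.* x
adjusted≡sign* n π j x with j ≡ᵇ n | j ≡ᵇ 1
... | true  | _     = refl
... | false | true  = refl
... | false | false = sym (ℤP.*-identityˡ x)

signFirst : Bool → List ℤ → List ℤ
signFirst c []       = []
signFirst c (x ∷ xs) = (if c then x else - x) ∷ xs

window : ℕ → List Step → List ℤ → ℕ → List ℤ
window n π v J = map (adjusted n π) (concatMap (dStep n (mu n π) v) (upTo (suc J)))

-- The local functions of dD have no name here; abstracting the list they are applied to reaches them.
dD≡signFirst-window : ∀ n π v →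
  dD n π v ≡ signFirst (evenℕ (countPos (mu n π))) (window n π v (sum (map ∣_∣ (mu n π))))
dD≡signFirst-window n π v with concatMap (dStep n (mu n π) v) (upTo (suc (sum (map ∣_∣ (mu n π)))))
... | []     = refl
... | x ∷ xs = cong (_ ∷_) (map-adjusted xs)
  where
  map-adjusted : ∀ xs → map _ xs ≡ map (adjusted n π) xs
  map-adjusted []       = refl
  map-adjusted (x ∷ xs) = cong (_ ∷_) (map-adjusted xs)

getℤ-applyUpTo : ∀ (f : ℕ → ℤ) n {k} → k < n → getℤ (applyUpTo f n) (suc k) ≡ f k
getℤ-applyUpTo f (suc n) {zero}  p       = refl
getℤ-applyUpTo f (suc n) {suc k} (s≤s p) = getℤ-applyUpTo (f ∘ suc) n p

mu≡applyUpTo : ∀ n π → mu n π ≡ applyUpTo (muAt n π ∘ suc) n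
mu≡applyUpTo n π = trans (cong (map (muAt n π)) (map-upTo suc n)) (map-applyUpTo suc (muAt n π) n)

∣∣≤sum : ∀ (f : ℕ → ℤ) n {k} → k < n → ∣ f k ∣ ≤ sum (map ∣_∣ (applyUpTo f n))
∣∣≤sum f (suc n) {zero}  p       = ℕP.m≤m+n _ _
∣∣≤sum f (suc n) {suc k} (s≤s p) = ℕP.≤-trans (∣∣≤sum (f ∘ suc) n p) (ℕP.m≤n+m _ ∣ f 0 ∣)

module Window (n : ℕ) (π : List Step) (v : List ℤ) (ρ : ℕ → Row Mark)
  (height-ρ : ∀ k → height (ρ k) ≡ muAt n π (suc k))
  (value-left : ∀ k → value (proj₂ (left (ρ k))) ≡ sign n π (suc k) ℤ.* getℤ v (suc k))
  (value-right : ∀ k → value (proj₂ (right (ρ k))) ≡ - value (proj₂ (left (ρ k)))) where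

  upward downward : ℕ → ℕ → List (ℕ × ℤ)
  upward   i j = if getℤ (mu n π) j ==ℤ - (+ i) then (j , getℤ v j) ∷ [] else []
  downward i j = if getℤ (mu n π) j ==ℤ (+ suc i) then (j , - getℤ v j) ∷ [] else []

  getℤ-mu : ∀ {k} → k < n → getℤ (mu n π) (suc k) ≡ height (ρ k)
  getℤ-mu {k} p = trans (cong (λ m → getℤ m (suc k)) (mu≡applyUpTo n π))
    (trans (getℤ-applyUpTo (muAt n π ∘ suc) n p) (sym (height-ρ k)))

  upward-pick : ∀ i {k} → k < n → map (adjusted n π) (upward i (suc k)) ≡ map value (pick i (left (ρ k)))
  upward-pick i {k} p rewrite getℤ-mu p | sym (neg-==ℤ (height (ρ k)) (+ i)) with - height (ρ k) ==ℤ + i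
  ... | true  = cong (_∷ []) (trans (adjusted≡sign* n π (suc k) _) (sym (value-left k)))
  ... | false = refl

  downward-pick : ∀ i {k} → k < n → map (adjusted n π) (downward i (suc k)) ≡ map value (pick (suc i) (right (ρ k)))
  downward-pick i {k} p rewrite getℤ-mu p with height (ρ k) ==ℤ + suc i
  ... | true  = cong (_∷ []) (trans (adjusted≡sign* n π (suc k) _)
    (trans (sym (ℤP.neg-distribʳ-* (sign n π (suc k)) (getℤ v (suc k)))) (sym (trans (value-right k) (cong -_ (value-left k))))))
  ... | false = refl

  reverse-map-pick : ∀ j (e : ℤ × Mark) → reverse (map value (pick j e)) ≡ map value (pick j e)
  reverse-map-pick j (z , _) with z ==ℤ + j
  ... | true  = refl
  ... | false = refl

  upwards : ∀ i m → m ≤ n → reverse (map (adjusted n π) (concatMap (upward i) (applyUpTo suc m))) ≡ map value (labels i (lefts ρ m))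
  upwards i zero    p = refl
  upwards i (suc m) p = begin
    reverse (map (adjusted n π) (concatMap (upward i) (applyUpTo suc (suc m))))
      ≡⟨ cong (λ l → reverse (map (adjusted n π) (concatMap (upward i) l))) (applyUpTo-∷ʳ suc m) ⟨
    reverse (map (adjusted n π) (concatMap (upward i) (applyUpTo suc m ∷ʳ suc m)))
      ≡⟨ cong (reverse ∘ map (adjusted n π)) (concatMap-++ (upward i) (applyUpTo suc m) (suc m ∷ [])) ⟩
    reverse (map (adjusted n π) (concatMap (upward i) (applyUpTo suc m) ++ upward i (suc m) ++ []))
      ≡⟨ cong reverse (map-++ (adjusted n π) (concatMap (upward i) (applyUpTo suc m)) _) ⟩
    reverse (map (adjusted n π) (concatMap (upward i) (applyUpTo suc m)) ++ map (adjusted n π) (upward i (suc m) ++ []))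
      ≡⟨ reverse-++ (map (adjusted n π) (concatMap (upward i) (applyUpTo suc m))) _ ⟩
    reverse (map (adjusted n π) (upward i (suc m) ++ [])) ++ reverse (map (adjusted n π) (concatMap (upward i) (applyUpTo suc m)))
      ≡⟨ cong₂ _++_ (cong (reverse ∘ map (adjusted n π)) (++-identityʳ (upward i (suc m)))) (upwards i m (ℕP.<⇒≤ p)) ⟩
    reverse (map (adjusted n π) (upward i (suc m))) ++ map value (labels i (lefts ρ m))
      ≡⟨ cong (_++ _) (trans (cong reverse (upward-pick i p)) (reverse-map-pick i (left (ρ m)))) ⟩
    map value (pick i (left (ρ m))) ++ map value (labels i (lefts ρ m))
      ≡⟨ map-++ value (pick i (left (ρ m))) _ ⟨
    map value (labels i (lefts ρ (suc m))) ∎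
    where open ≡-Reasoning

  downwards : ∀ i m → m ≤ n → map (adjusted n π) (concatMap (downward i) (applyDownFrom suc m)) ≡ reverse (map value (labels (suc i) (rights ρ m)))
  downwards i zero    p = refl
  downwards i (suc m) p = begin
    map (adjusted n π) (downward i (suc m) ++ concatMap (downward i) (applyDownFrom suc m))
      ≡⟨ map-++ (adjusted n π) (downward i (suc m)) _ ⟩
    map (adjusted n π) (downward i (suc m)) ++ map (adjusted n π) (concatMap (downward i) (applyDownFrom suc m))
      ≡⟨ cong₂ _++_ (downward-pick i p) (downwards i m (ℕP.<⇒≤ p)) ⟩
    map value (pick (suc i) (right (ρ m))) ++ reverse (map value (labels (suc i) (rights ρ m)))
      ≡⟨ cong (_++ reverse (map value (labels (suc i) (rights ρ m)))) (reverse-map-pick (suc i) (right (ρ m))) ⟨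
    reverse (map value (pick (suc i) (right (ρ m)))) ++ reverse (map value (labels (suc i) (rights ρ m)))
      ≡⟨ reverse-++ (map value (labels (suc i) (rights ρ m))) _ ⟨
    reverse (map value (labels (suc i) (rights ρ m)) ++ map value (pick (suc i) (right (ρ m))))
      ≡⟨ cong reverse (map-++ value (labels (suc i) (rights ρ m)) _) ⟨
    reverse (map value (labels (suc i) (rights ρ m) ++ pick (suc i) (right (ρ m))))
      ≡⟨ cong (λ l → reverse (map value (labels (suc i) (rights ρ m) ++ l))) (++-identityʳ (pick (suc i) (right (ρ m)))) ⟨
    reverse (map value (labels (suc i) (rights ρ m) ++ pick (suc i) (right (ρ m)) ++ []))
      ≡⟨ cong (reverse ∘ map value) (labels-++ (suc i) (rights ρ m) (right (ρ m) ∷ [])) ⟨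
    reverse (map value (labels (suc i) (rights ρ m ∷ʳ right (ρ m))))
      ≡⟨ cong (reverse ∘ map value ∘ labels (suc i)) (applyUpTo-∷ʳ (right ∘ ρ) m) ⟩
    reverse (map value (labels (suc i) (rights ρ (suc m)))) ∎
    where open ≡-Reasoning

  -- Reversal puts the rows of value i + 1, written by decreasing index, in front and in increasing
  -- order, as in the right half; the rows of value -i follow in decreasing order, as in the left
  -- half.
  block : ∀ i → reverse (map (adjusted n π) (dStep n (mu n π) v i)) ≡ map value (labels (suc i) (rights ρ n) ++ labels i (lefts ρ n))
  block i = begin
    reverse (map (adjusted n π) (concatMap (upward i) (range1 n) ++ concatMap (downward i) (reverse (range1 n))))
      ≡⟨ cong (λ l → reverse (map (adjusted n π) (concatMap (upward i) l ++ concatMap (downward i) (reverse l)))) (map-upTo suc n) ⟩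
    reverse (map (adjusted n π) (concatMap (upward i) (applyUpTo suc n) ++ concatMap (downward i) (reverse (applyUpTo suc n))))
      ≡⟨ cong reverse (map-++ (adjusted n π) (concatMap (upward i) (applyUpTo suc n)) _) ⟩
    reverse (map (adjusted n π) (concatMap (upward i) (applyUpTo suc n)) ++ map (adjusted n π) (concatMap (downward i) (reverse (applyUpTo suc n))))
      ≡⟨ reverse-++ (map (adjusted n π) (concatMap (upward i) (applyUpTo suc n))) _ ⟩
    reverse (map (adjusted n π) (concatMap (downward i) (reverse (applyUpTo suc n)))) ++ reverse (map (adjusted n π) (concatMap (upward i) (applyUpTo suc n)))
      ≡⟨ cong₂ _++_ (cong reverse (trans (cong (map (adjusted n π) ∘ concatMap (downward i)) (reverse-applyUpTo suc n)) (downwards i n ℕP.≤-refl)))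
          (upwards i n ℕP.≤-refl) ⟩
    reverse (reverse (map value (labels (suc i) (rights ρ n)))) ++ map value (labels i (lefts ρ n))
      ≡⟨ cong (_++ map value (labels i (lefts ρ n))) (reverse-involutive (map value (labels (suc i) (rights ρ n)))) ⟩
    map value (labels (suc i) (rights ρ n)) ++ map value (labels i (lefts ρ n))
      ≡⟨ map-++ value (labels (suc i) (rights ρ n)) _ ⟨
    map value (labels (suc i) (rights ρ n) ++ labels i (lefts ρ n)) ∎
    where open ≡-Reasoning

  reverse-window : ∀ J → reverse (window n π v J) ≡ map value (backward J (lefts ρ n) (rights ρ n))
  reverse-window zero    = trans (cong (reverse ∘ map (adjusted n π)) (++-identityʳ (dStep n (mu n π) v 0))) (block 0)
  reverse-window (suc J) = begin
    reverse (map (adjusted n π) (concatMap (dStep n m v) (upTo (suc (suc J)))))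
      ≡⟨ cong (λ l → reverse (map (adjusted n π) (concatMap (dStep n m v) l))) (upTo-∷ʳ (suc J)) ⟨
    reverse (map (adjusted n π) (concatMap (dStep n m v) (upTo (suc J) ∷ʳ suc J)))
      ≡⟨ cong (reverse ∘ map (adjusted n π)) (concatMap-++ (dStep n m v) (upTo (suc J)) (suc J ∷ [])) ⟩
    reverse (map (adjusted n π) (concatMap (dStep n m v) (upTo (suc J)) ++ dStep n m v (suc J) ++ []))
      ≡⟨ cong reverse (map-++ (adjusted n π) (concatMap (dStep n m v) (upTo (suc J))) _) ⟩
    reverse (window n π v J ++ map (adjusted n π) (dStep n m v (suc J) ++ []))
      ≡⟨ reverse-++ (window n π v J) _ ⟩
    reverse (map (adjusted n π) (dStep n m v (suc J) ++ [])) ++ reverse (window n π v J)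
      ≡⟨ cong₂ _++_ (trans (cong (reverse ∘ map (adjusted n π)) (++-identityʳ (dStep n m v (suc J)))) (block (suc J))) (reverse-window J) ⟩
    map value (labels (suc (suc J)) (rights ρ n) ++ labels (suc J) (lefts ρ n)) ++ map value (backward J (lefts ρ n) (rights ρ n))
      ≡⟨ map-++ value (labels (suc (suc J)) (rights ρ n) ++ labels (suc J) (lefts ρ n)) _ ⟨
    map value (backward (suc J) (lefts ρ n) (rights ρ n)) ∎
    where
    open ≡-Reasoning
    m = mu n π

-- Valleys of a normalised sequence

adjacent-applyUpTo⁺ : ∀ {A : Set} (f : ℕ → A) n {k} → suc k < n → Adjacent (f k) (f (suc k)) (applyUpTo f n)
adjacent-applyUpTo⁺ f (suc (suc n)) {zero}  p       = here
adjacent-applyUpTo⁺ f (suc n)       {suc k} (s≤s p) = there (adjacent-applyUpTo⁺ (f ∘ suc) n p)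

adjacent-applyUpTo⁻ : ∀ {A : Set} (f : ℕ → A) n {x y} → Adjacent x y (applyUpTo f n) →
  ∃ λ k → suc k < n × x ≡ f k × y ≡ f (suc k)
adjacent-applyUpTo⁻ f (suc (suc n)) here = 0 , s≤s (s≤s z≤n) , refl , refl
adjacent-applyUpTo⁻ f (suc n) (there a) with adjacent-applyUpTo⁻ (f ∘ suc) n a
... | k , p , eq , eq′ = suc k , s≤s p , eq , eq′

adjacent-applyDownFrom⁺ : ∀ {A : Set} (f : ℕ → A) n {k} → suc k < n → Adjacent (f (suc k)) (f k) (applyDownFrom f n)
adjacent-applyDownFrom⁺ f (suc (suc n)) (s≤s p) =
  Data.Sum.[ (λ q → there (adjacent-applyDownFrom⁺ f (suc n) q)) , (λ { refl → here }) ]′ (ℕP.m≤n⇒m<n∨m≡n p)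

adjacent-applyDownFrom⁻ : ∀ {A : Set} (f : ℕ → A) n {x y} → Adjacent x y (applyDownFrom f n) →
  ∃ λ k → suc k < n × x ≡ f (suc k) × y ≡ f k
adjacent-applyDownFrom⁻ f (suc (suc n)) here = n , ℕP.≤-refl , refl , refl
adjacent-applyDownFrom⁻ f (suc n) (there a) with adjacent-applyDownFrom⁻ f n a
... | k , p , eq , eq′ = k , ℕP.m<n⇒m<1+n p , eq , eq′

at-++⁻ : ∀ {A : Set} {x : A} {i} xs {ys} → At x i (xs ++ ys) →
  (i < length xs × At x i xs) ⊎ (∃ λ j → i ≡ length xs ℕ.+ j × At x j ys)
at-++⁻ []       a    = inj₂ (_ , refl , a)
at-++⁻ (x ∷ xs) here = inj₁ (ℕ.z<s , here)
at-++⁻ (x ∷ xs) (there a) with at-++⁻ xs a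
... | inj₁ (p , b)      = inj₁ (s≤s p , there b)
... | inj₂ (j , eq , b) = inj₂ (j , cong suc eq , b)

at-++ˡ : ∀ {A : Set} {x : A} {i xs} ys → At x i xs → At x i (xs ++ ys)
at-++ˡ ys here      = here
at-++ˡ ys (there a) = there (at-++ˡ ys a)

at-length : ∀ {A : Set} {x : A} {i xs} → At x i xs → i < length xs
at-length here      = ℕ.z<s
at-length (there a) = s≤s (at-length a)

at-All : ∀ {A : Set} {P : A → Set} {x i xs} → All P xs → At x i xs → P x
at-All (p ∷ _)  here      = p
at-All (_ ∷ ps) (there a) = at-All ps a

at-singleton : ∀ {A : Set} {x y : A} {i} → At x i (y ∷ []) → i ≡ 0 × x ≡ y
at-singleton here = refl , refl

getℤ-∷ʳ : ∀ xs x → getℤ (xs ∷ʳ x) (suc (length xs)) ≡ x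
getℤ-∷ʳ []       x = refl
getℤ-∷ʳ (_ ∷ xs) x = getℤ-∷ʳ xs x

getℤ-++ˡ : ∀ xs ys {k} → k < length xs → getℤ (xs ++ ys) (suc k) ≡ getℤ xs (suc k)
getℤ-++ˡ (x ∷ xs) ys {zero}  p       = refl
getℤ-++ˡ (x ∷ xs) ys {suc k} (s≤s p) = getℤ-++ˡ xs ys p

getℤ-at : ∀ {A : Set} (f : A → ℤ) {x i xs} → At x i xs → getℤ (map f xs) (suc i) ≡ f x
getℤ-at f here      = refl
getℤ-at f (there a) = getℤ-at f a

getℤ-neg : ∀ xs k → getℤ (map -_ xs) k ≡ - getℤ xs k
getℤ-neg []       k             = refl
getℤ-neg (x ∷ xs) zero          = refl
getℤ-neg (x ∷ xs) (suc zero)    = refl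
getℤ-neg (x ∷ xs) (suc (suc k)) = getℤ-neg xs (suc k)

getℤ-reverse : ∀ {A : Set} (f : A → ℤ) {x i xs} → At x i xs → getℤ (reverse (map f xs)) (length xs ∸ i) ≡ f x
getℤ-reverse f {x} {xs = _ ∷ xs} here rewrite unfold-reverse (f x) (map f xs)
  | sym (trans (length-reverse (map f xs)) (length-map f xs)) = getℤ-∷ʳ (reverse (map f xs)) (f x)
getℤ-reverse f {x} {suc i} {y ∷ xs} (there a) rewrite unfold-reverse (f y) (map f xs)
  with length xs ∸ i in eq | getℤ-reverse f a
... | zero  | ih = ⊥-elim (ℕP.<⇒≱ (at-length a) (ℕP.m∸n≡0⇒m≤n eq))
... | suc k | ih = trans (getℤ-++ˡ (reverse (map f xs)) _ (ℕP.≤-trans (ℕP.≤-reflexive (sym eq))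
  (ℕP.≤-trans (ℕP.m∸n≤m (length xs) i) (ℕP.≤-reflexive (sym (trans (length-reverse (map f xs)) (length-map f xs))))))) ih

getℤ-signFirst-1 : ∀ c xs → getℤ (signFirst c xs) 1 ≡ (if c then getℤ xs 1 else - getℤ xs 1)
getℤ-signFirst-1 true  []       = refl
getℤ-signFirst-1 false []       = refl
getℤ-signFirst-1 c     (x ∷ xs) = refl

getℤ-signFirst-2+ : ∀ c xs k → getℤ (signFirst c xs) (suc (suc k)) ≡ getℤ xs (suc (suc k))
getℤ-signFirst-2+ c []       k = refl
getℤ-signFirst-2+ c (x ∷ xs) k = refl

<ᵇ-true : ∀ {i j} → i < j → (i ℕ.<ᵇ j) ≡ true
<ᵇ-true p = dec-true (_ ℕ.<? _) p

<ᵇ-false : ∀ {i j} → j ≤ i → (i ℕ.<ᵇ j) ≡ false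
<ᵇ-false p = dec-false (_ ℕ.<? _) (ℕP.≤⇒≯ p)

≡ᵇ-true : ∀ i → (i ≡ᵇ i) ≡ true
≡ᵇ-true i = dec-true (i ℕ.≟ i) refl

≡ᵇ-false : ∀ {i j} → i ≢ j → (i ≡ᵇ j) ≡ false
≡ᵇ-false ne = dec-false (_ ℕ.≟ _) ne

leftMark rightMark : Row Mark → Mark
leftMark  = proj₂ ∘ left
rightMark = proj₂ ∘ right

tag : Mark → Tag
tag = proj₂

label : Mark → Mark → Label
label (x , _) (y , formal) = pmR x ∣ y ∣
label (x , _) (y , _)      = pr x y

label-plain : ∀ x {y} → tag y ≡ plain → label x y ≡ pr (value x) (value y)
label-plain x refl = refl

glyph-north : ∀ j z (x : Mark) → z ≡ + j → glyph j (z , x) ≡ north x ∷ []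
glyph-north j z x e with z ℤP.≟ + j
... | yes _ = refl
... | no ne = ⊥-elim (ne e)

Plain : Mark → Set
Plain y = tag y ≡ plain

all-pick : ∀ j (e : ℤ × Mark) → Plain (proj₂ e) → All Plain (pick j e)
all-pick j (z , x) p with z ==ℤ + j
... | true  = p ∷ []
... | false = []

plain-rights : ∀ j f m → (∀ k → Plain (rightMark (f k))) → All Plain (labels j (rights f m))
plain-rights j f zero    p = []
plain-rights j f (suc m) p = AllP.++⁺ (all-pick j (right (f 0)) (p 0)) (plain-rights j (f ∘ suc) m (p ∘ suc))

signedE : ∀ c → SignedE (if c then Ep else Em)
signedE true  = ep
signedE false = em

-- The left half negates the values and reverses their order, and the two changes together preserve
-- the slope condition.
neg-slope : ∀ {z z′} → z ℤ.≤ ℤ.suc z′ → - z′ ℤ.≤ ℤ.suc (- z)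
neg-slope {z} {z′} p = ℤP.≤-trans (ℤP.≤-reflexive eq) (ℤP.suc-mono (ℤP.neg-mono-≤ p))
  where
  eq : - z′ ≡ ℤ.suc (- ℤ.suc z′)
  eq = sym (trans (cong ℤ.suc (ℤP.neg-distrib-+ 1ℤ z′)) (ℤP.suc-pred (- z′)))

slope-rights : ∀ m (f : ℕ → Row Mark) → (∀ {k} → suc k < suc m → height (f k) ℤ.≤ ℤ.suc (height (f (suc k)))) →
  height (f m) ℤ.≤ 0ℤ → Slope (rights f (suc m))
slope-rights zero    f s e = stop e
slope-rights (suc m) f s e = cons (s (s≤s (s≤s z≤n))) (slope-rights m (f ∘ suc) (s ∘ s≤s) e)

pred[-j] : ∀ j → -[1+ j ] ≡ ℤ.pred (- (+ j))
pred[-j] j = ℤP.neg-distrib-+ 1ℤ (+ j)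

flip-neg : ∀ {z w} → - z ≡ w → z ≡ - w
flip-neg {z} e = trans (sym (ℤP.neg-involutive z)) (cong -_ e)

ends-applyDownFrom : ∀ {A : Set} (f : ℕ → A) m {x} → EndsIn x (applyDownFrom f (suc m)) → x ≡ f 0
ends-applyDownFrom f zero    here      = refl
ends-applyDownFrom f (suc m) (there e) = ends-applyDownFrom f m e

neg-==0 : ∀ z → (- z ==ℤ 0ℤ) ≡ (z ==ℤ 0ℤ)
neg-==0 z = neg-==ℤ z 0ℤ

data Ground (r : Row Mark) : Set where
  zero : height r ≡ 0ℤ → tag (leftMark r) ≡ formal → tag (rightMark r) ≡ mirror → Ground r
  positive : 0ℤ ℤ.< height r → tag (leftMark r) ≡ plain → Ground r

ground-≥0 : ∀ {r} → Ground r → 0ℤ ℤ.≤ height r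
ground-≥0 (zero e _ _)   = ℤP.≤-reflexive (sym e)
ground-≥0 (positive p _) = ℤP.<⇒≤ p

module Core (n′ J : ℕ) (r : ℕ → Row Mark)
  (bounded : ∀ {k} → k < suc n′ → ∣ height (r k) ∣ ≤ J)
  (slope : ∀ {k} → suc k < suc n′ → height (r k) ℤ.≤ ℤ.suc (height (r (suc k))))
  (ground : Ground (r 0)) (last≤0 : height (r n′) ℤ.≤ 0ℤ)
  (opposite : ∀ k → value (rightMark (r k)) ≡ - value (leftMark (r k)))
  (plain-left  : ∀ k → tag (leftMark (r (suc k))) ≡ plain)
  (plain-right : ∀ k → tag (rightMark (r (suc k))) ≡ plain)
  where

  n : ℕ
  n = suc n′

  L R b : List (ℤ × Mark)
  L = lefts r n
  R = rights r n
  b = doubled r n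

  data Fall : Mark → Mark → Set where
    in-left  : ∀ {k} → suc k < n → height (r k) ≡ ℤ.suc (height (r (suc k))) → height (r k) ℤ.≤ 0ℤ →
      Fall (leftMark (r (suc k))) (leftMark (r k))
    in-right : ∀ {k} → suc k < n → height (r k) ≡ ℤ.suc (height (r (suc k))) → 0ℤ ℤ.< height (r k) →
      Fall (rightMark (r k)) (rightMark (r (suc k)))

  first≥0 : 0ℤ ℤ.≤ height (r 0)
  first≥0 = ground-≥0 ground

  slope-R : Slope R
  slope-R = slope-rights n′ r slope last≤0

  slope-lefts : ∀ m → m < n → Slope (lefts r (suc m))
  slope-lefts zero    p = stop (ℤP.neg-mono-≤ first≥0)
  slope-lefts (suc m) p = cons (neg-slope (slope p)) (slope-lefts m (ℕP.<⇒≤ p))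

  slope-L : Slope L
  slope-L = slope-lefts n′ (ℕP.n<1+n n′)

  slope-b : Slope b
  slope-b = slope-++ slope-L first≥0 slope-R

  fall⁺-left : ∀ {k} j → suc k < n → height (r k) ≡ ℤ.suc (height (r (suc k))) → height (r k) ≡ - (+ j) →
    ∃ λ j → j ≤ J × Adjacent (+ suc j , leftMark (r (suc k))) (+ j , leftMark (r k)) b
  fall⁺-left {k} j p e hk = j , j≤J ,
    subst₂ (λ s t → Adjacent (s , leftMark (r (suc k))) (t , leftMark (r k)) b) next this
      (adjacent-++ˡ R (adjacent-applyDownFrom⁺ (left ∘ r) n p))
    where
    this : - height (r k) ≡ + j
    this = trans (cong -_ hk) (ℤP.neg-involutive (+ j))
    next : - height (r (suc k)) ≡ + suc j
    next = cong -_ (trans (sym (ℤP.pred-suc (height (r (suc k))))) (trans (cong ℤ.pred (trans (sym e) hk)) (sym (pred[-j] j))))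
    j≤J : j ≤ J
    j≤J = subst (_≤ J) (trans (sym (ℤP.∣-i∣≡∣i∣ (height (r k)))) (cong ∣_∣ this)) (bounded (ℕP.<⇒≤ p))

  fall⁺-right : ∀ {k} j → suc k < n → height (r k) ≡ ℤ.suc (height (r (suc k))) → height (r k) ≡ + suc j →
    ∃ λ j → j ≤ J × Adjacent (+ suc j , rightMark (r k)) (+ j , rightMark (r (suc k))) b
  fall⁺-right {k} j p e hk = j , subst (_≤ J) (cong ∣_∣ next) (bounded p) ,
    subst₂ (λ s t → Adjacent (s , rightMark (r k)) (t , rightMark (r (suc k))) b) hk next
      (adjacent-++ʳ L (adjacent-applyUpTo⁺ (right ∘ r) n p))
    where
    next : height (r (suc k)) ≡ + j
    next = trans (sym (ℤP.pred-suc (height (r (suc k))))) (cong ℤ.pred (trans (sym e) hk))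

  fall⁺ : ∀ {x y} → Fall x y → ∃ λ j → j ≤ J × Adjacent (+ suc j , x) (+ j , y) b
  fall⁺ (in-left {k} p e q) with height (r k) in hk
  fall⁺ (in-left p e q) | + zero = fall⁺-left 0 p (trans hk e) hk
  fall⁺ (in-left p e (ℤ.+≤+ ())) | + suc _
  fall⁺ (in-left p e q) | -[1+ j ] = fall⁺-left (suc j) p (trans hk e) hk
  fall⁺ (in-right {k} p e q) with height (r k) in hk
  fall⁺ (in-right p e (ℤ.+<+ ())) | + zero
  fall⁺ (in-right p e q) | + suc j = fall⁺-right j p (trans hk e) hk
  fall⁺ (in-right p e ()) | -[1+ _ ]

  fall⁻ : ∀ {j x y} → Adjacent (+ suc j , x) (+ j , y) b → Fall x y
  fall⁻ {j} a with adjacent-++⁻ L a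
  ... | inj₁ a′ with adjacent-applyDownFrom⁻ (left ∘ r) n a′
  ...   | k , p , eq , eq′ = subst₂ Fall (sym (cong proj₂ eq)) (sym (cong proj₂ eq′))
            (in-left p (trans this (sym (trans (cong ℤ.suc next) (ℤP.suc-pred (- (+ j)))))) (subst (ℤ._≤ 0ℤ) (sym this) (ℤP.neg-mono-≤ (ℤ.+≤+ (z≤n {j})))))
    where
    this : height (r k) ≡ - (+ j)
    this = flip-neg (sym (cong proj₁ eq′))
    next : height (r (suc k)) ≡ ℤ.pred (- (+ j))
    next = trans (flip-neg (sym (cong proj₁ eq))) (pred[-j] j)
  fall⁻ {j} a | inj₂ (inj₂ a′) with adjacent-applyUpTo⁻ (right ∘ r) n a′
  ... | k , p , eq , eq′ = subst₂ Fall (sym (cong proj₂ eq)) (sym (cong proj₂ eq′))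
            (in-right p (trans (sym (cong proj₁ eq)) (cong ℤ.suc (cong proj₁ eq′))) (subst (0ℤ ℤ.<_) (cong proj₁ eq) (ℤ.+<+ (s≤s z≤n))))
  -- At the seam of the two halves the left neighbour is minus the height of the first row, hence at
  -- most 0 and different from `j + 1`.
  fall⁻ {j} a | inj₂ (inj₁ (e , h)) with cong proj₁ (ends-applyDownFrom (left ∘ r) n′ e)
  ... | eq with subst (0ℤ ℤ.≤_) (flip-neg (sym eq)) first≥0
  ...   | ()

  u : List (Letter Mark)
  u = word J b

  fall : ∀ {x y} → Adjacent (east x) (north y) u → Fall x y
  fall a = fall⁻ (proj₂ (adjacent-word⁻ J slope-b a))

  letters : ∀ {x y} → Fall x y → Adjacent (east x) (north y) u
  letters f = let (_ , p , a) = fall⁺ f in adjacent-word⁺ (ℕP.≤⇒≤′ p) a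

  B L₀ R₀ : List Mark
  B  = backward J L R
  L₀ = labels 0 L
  R₀ = labels 0 R

  length-B : length B ≡ n
  length-B = length-backward J r n bounded

  beyond : labels (suc J) b ≡ []
  beyond = trans (labels-++ (suc J) L R)
    (cong₂ _++_ (within-lefts r n bounded (ℕP.n<1+n J)) (within-rights r n bounded (ℕP.n<1+n J)))

  norths-u : norths u ≡ B ++ R₀
  norths-u = trans (sym (cong (_++ norths u) (within-rights r n bounded (ℕP.n<1+n J)))) (norths-word J L R)

  -- With `R₀` appended, both sides become the list of all Norths. Thus the i-th East carries the
  -- i-th entry of `B`, which has position n + 1 - i in `d`.
  easts-u : easts u ++ L₀ ≡ B
  easts-u = ++-cancelʳ R₀ _ _ (begin
    (easts u ++ L₀) ++ R₀        ≡⟨ ++-assoc (easts u) L₀ R₀ ⟩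
    easts u ++ L₀ ++ R₀          ≡⟨ cong (easts u ++_) (labels-++ 0 L R) ⟨
    easts u ++ labels 0 b        ≡⟨ easts-norths-word J b ⟩
    labels (suc J) b ++ norths u ≡⟨ cong (_++ norths u) beyond ⟩
    norths u                     ≡⟨ norths-u ⟩
    B ++ R₀ ∎)
    where open ≡-Reasoning

  -- A row of value 0 occurs at level 0 in both halves, which run through the rows in opposite
  -- directions and carry opposite labels.
  mirrored : map value R₀ ≡ map -_ (reverse (map value L₀))
  mirrored = go n
    where
    go : ∀ m → map value (labels 0 (rights r m)) ≡ map -_ (reverse (map value (labels 0 (lefts r m))))
    row : ∀ k → map value (pick 0 (right (r k))) ≡ map -_ (reverse (map value (pick 0 (left (r k)))))
    row k rewrite neg-==0 (height (r k)) with height (r k) ==ℤ 0ℤ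
    ... | true  = cong (_∷ []) (opposite k)
    ... | false = refl
    go zero    = refl
    go (suc m) = begin
      map value (labels 0 (rights r (suc m)))
        ≡⟨ cong (map value ∘ labels 0) (applyUpTo-∷ʳ (right ∘ r) m) ⟨
      map value (labels 0 (rights r m ∷ʳ right (r m)))
        ≡⟨ cong (map value) (labels-++ 0 (rights r m) (right (r m) ∷ [])) ⟩
      map value (labels 0 (rights r m) ++ pick 0 (right (r m)) ++ [])
        ≡⟨ cong (λ l → map value (labels 0 (rights r m) ++ l)) (++-identityʳ (pick 0 (right (r m)))) ⟩
      map value (labels 0 (rights r m) ++ pick 0 (right (r m)))
        ≡⟨ map-++ value (labels 0 (rights r m)) _ ⟩
      map value (labels 0 (rights r m)) ++ map value (pick 0 (right (r m)))
        ≡⟨ cong₂ _++_ (go m) (row m) ⟩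
      map -_ (reverse (map value (labels 0 (lefts r m)))) ++ map -_ (reverse (map value (pick 0 (left (r m)))))
        ≡⟨ map-++ -_ (reverse (map value (labels 0 (lefts r m)))) _ ⟨
      map -_ (reverse (map value (labels 0 (lefts r m))) ++ reverse (map value (pick 0 (left (r m)))))
        ≡⟨ cong (map -_) (reverse-++ (map value (pick 0 (left (r m)))) _) ⟨
      map -_ (reverse (map value (pick 0 (left (r m))) ++ map value (labels 0 (lefts r m))))
        ≡⟨ cong (map -_ ∘ reverse) (map-++ value (pick 0 (left (r m))) _) ⟨
      map -_ (reverse (map value (labels 0 (lefts r (suc m))))) ∎
      where open ≡-Reasoning

  d : List ℤ
  d = reverse (map value B)

  d-at-B : ∀ {x i} → At x i B → getℤ d (n ∸ i) ≡ value x
  d-at-B {x} {i} a = subst (λ l → getℤ d (l ∸ i) ≡ value x) length-B (getℤ-reverse value a)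

  -- `L₀` closes `B` and therefore opens the window `d`; `mirrored` turns these first entries into
  -- the labels of the Norths after the n-th.
  d-at-R₀ : ∀ {x i} → At x i R₀ → - getℤ d (suc i) ≡ value x
  d-at-R₀ {x} {i} a = begin
    - getℤ d (suc i)
      ≡⟨ cong (λ l → - getℤ (reverse (map value l)) (suc i)) easts-u ⟨
    - getℤ (reverse (map value (easts u ++ L₀))) (suc i)
      ≡⟨ cong (λ l → - getℤ (reverse l) (suc i)) (map-++ value (easts u) L₀) ⟩
    - getℤ (reverse (map value (easts u) ++ map value L₀)) (suc i)
      ≡⟨ cong (λ l → - getℤ l (suc i)) (reverse-++ (map value (easts u)) (map value L₀)) ⟩
    - getℤ (reverse (map value L₀) ++ reverse (map value (easts u))) (suc i)
      ≡⟨ cong -_ (getℤ-++ˡ (reverse (map value L₀)) _ short) ⟩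
    - getℤ (reverse (map value L₀)) (suc i)
      ≡⟨ getℤ-neg (reverse (map value L₀)) (suc i) ⟨
    getℤ (map -_ (reverse (map value L₀))) (suc i)
      ≡⟨ cong (λ l → getℤ l (suc i)) mirrored ⟨
    getℤ (map value R₀) (suc i)
      ≡⟨ getℤ-at value a ⟩
    value x ∎
    where
    open ≡-Reasoning
    short : i < length (reverse (map value L₀))
    short = subst (i <_) (trans (sym (length-map value R₀)) (trans (cong length mirrored) (length-map -_ (reverse (map value L₀))))) (at-length a)

  top : ℕ → List (Letter Mark)
  top zero    = []
  top (suc J) = read (suc J) b ++ top J

  word-top : ∀ J → word J b ≡ top J ++ read 0 b
  word-top zero    = refl
  word-top (suc J) = trans (cong (read (suc J) b ++_) (word-top J)) (sym (++-assoc (read (suc J) b) (top J) _))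

  -last≥0 : 0ℤ ℤ.≤ - height (r n′)
  -last≥0 = ℤP.neg-mono-≤ last≤0

  left-ends : ∃₂ λ w y → read 0 L ≡ w ∷ʳ north y
  left-ends = read-ends-north slope-L -last≥0

  w₀ : List (Letter Mark)
  w₀ = top J ++ proj₁ left-ends

  y₀ : Mark
  y₀ = proj₁ (proj₂ left-ends)

  -- Cuts the word at its n-th North: the left half of level 0 ends with a North, and the Norths
  -- after that one are exactly `R₀`.
  u-split : u ≡ w₀ ++ north y₀ ∷ read 0 R
  u-split = begin
    word J b                                     ≡⟨ word-top J ⟩
    top J ++ read 0 b                            ≡⟨ cong (top J ++_) (read-++ 0 L R) ⟩
    top J ++ read 0 L ++ read 0 R                ≡⟨ cong (λ l → top J ++ l ++ read 0 R) (proj₂ (proj₂ left-ends)) ⟩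
    top J ++ (proj₁ left-ends ∷ʳ north y₀) ++ read 0 R  ≡⟨ cong (top J ++_) (++-assoc (proj₁ left-ends) _ _) ⟩
    top J ++ proj₁ left-ends ++ north y₀ ∷ read 0 R     ≡⟨ ++-assoc (top J) (proj₁ left-ends) _ ⟨
    w₀ ++ north y₀ ∷ read 0 R ∎
    where open ≡-Reasoning

  B-split : B ≡ norths w₀ ∷ʳ y₀
  B-split = sym (++-cancelʳ R₀ _ _ (begin
    (norths w₀ ∷ʳ y₀) ++ R₀             ≡⟨ ++-assoc (norths w₀) _ R₀ ⟩
    norths w₀ ++ y₀ ∷ R₀                ≡⟨ cong (λ l → norths w₀ ++ y₀ ∷ l) (norths-read 0 R) ⟨
    norths w₀ ++ y₀ ∷ norths (read 0 R) ≡⟨ norths-++ w₀ _ ⟨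
    norths (w₀ ++ north y₀ ∷ read 0 R)  ≡⟨ cong norths u-split ⟨
    norths u                            ≡⟨ norths-u ⟩
    B ++ R₀ ∎))
    where open ≡-Reasoning

  length-norths-w₀ : suc (length (norths w₀)) ≡ n
  length-norths-w₀ = trans (sym (length-∷ʳ y₀ (norths w₀))) (trans (cong length (sym B-split)) length-B)
    where
    length-∷ʳ : ∀ {A : Set} (x : A) xs → length (xs ∷ʳ x) ≡ suc (length xs)
    length-∷ʳ x xs = trans (length-++ xs) (ℕP.+-comm (length xs) 1)

  L₀-nonempty : 0 < length L₀
  L₀-nonempty = subst (λ l → 0 < length l) (trans (cong norths (sym (proj₂ (proj₂ left-ends)))) (norths-read 0 L))
    (nonempty (proj₁ left-ends))
    where
    nonempty : ∀ w → 0 < length (norths (w ∷ʳ north y₀))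
    nonempty []            = ℕ.z<s
    nonempty (north _ ∷ w) = ℕ.z<s
    nonempty (east _ ∷ w)  = nonempty w

  -- Ensures n + 1 - i ≥ 2 for every East, so that the sign change of w(1) never reaches the first
  -- component of a label.
  easts-short : length (easts u) ≤ n′
  easts-short = ℕP.≤-pred (ℕP.≤-trans (ℕP.m<m+n (length (easts u)) L₀-nonempty)
    (ℕP.≤-reflexive (trans (sym (length-++ (easts u))) (trans (cong length easts-u) length-B))))

  -- `c` is to be the parity for the original μ, which the normalised heights need not share. It may
  -- be arbitrary here, because w(1) enters the labels only through ε(β) w(1) and |w(1)|.
  module Ending (c : Bool) where

    s : Step
    s = if c then Ep else Em

    β : List Step
    β = replAfterNorth n s (steps (dropLast u))

    w : List ℤ
    w = signFirst c d

    data Shape : Set where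
      flat : height (r 0) ≡ 0ℤ → tag (leftMark (r 0)) ≡ formal → tag (rightMark (r 0)) ≡ mirror →
        nthNorthFollowedByN n β ≡ true → Shape
      hill : tag (leftMark (r 0)) ≡ plain → nthNorthFollowedByN n β ≡ false →
        epsilon β ≡ (if isEm s then -1ℤ else 1ℤ) → Shape

    open NorthThen w₀ y₀ using (rank)

    rank≡n : rank ≡ n
    rank≡n = length-norths-w₀

    dropLast-u : ∀ {l g} → read 0 R ≡ l ∷ g → dropLast u ≡ w₀ ++ north y₀ ∷ dropLast (l ∷ g)
    dropLast-u {l} {g} eq = trans (cong dropLast (trans u-split (cong (λ v → w₀ ++ north y₀ ∷ v) eq)))
      (dropLast-++ w₀ (north y₀) (l ∷ g))

    steps-dropLast-u : steps (dropLast u) ∷ʳ N ≡ steps u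
    steps-dropLast-u with word-ends-north J slope-b -last≥0
    ... | v , z , eq = begin
      steps (dropLast u) ∷ʳ N              ≡⟨ cong (λ t → steps (dropLast t) ∷ʳ N) eq ⟩
      steps (dropLast (v ∷ʳ north z)) ∷ʳ N ≡⟨ cong (λ t → steps t ∷ʳ N) (dropLast-∷ʳ v (north z)) ⟩
      steps v ∷ʳ N                         ≡⟨ steps-++ v (north z ∷ []) ⟨
      steps (v ∷ʳ north z)                 ≡⟨ cong steps eq ⟨
      steps u ∎
      where open ≡-Reasoning

    flat-case : ∀ {z g} → read 0 R ≡ north z ∷ g → β ≡ steps (dropLast u) × nthNorthFollowedByN n β ≡ true
    flat-case {z} {g} eq = unchanged , trans (cong (nthNorthFollowedByN n) unchanged)
        (trans (cong₂ (λ m v → nthNorthFollowedByN m (steps v)) (sym rank≡n) (dropLast-u eq)) (NorthThen.north-north w₀ y₀ z g))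
      where
      unchanged : β ≡ steps (dropLast u)
      unchanged = begin
        replAfterNorth n s (steps (dropLast u))
          ≡⟨ cong₂ (λ m v → replAfterNorth m s (steps v)) (sym rank≡n) (dropLast-u eq) ⟩
        replAfterNorth rank s (steps (w₀ ++ north y₀ ∷ dropLast (north z ∷ g)))
          ≡⟨ NorthThen.north-north-unchanged w₀ y₀ s z g ⟩
        steps (w₀ ++ north y₀ ∷ dropLast (north z ∷ g))
          ≡⟨ cong steps (dropLast-u eq) ⟨
        steps (dropLast u) ∎
        where open ≡-Reasoning

    -- As `g` is nonempty, the East after the n-th North is not the deleted letter. It is the step
    -- that gets replaced, and its sign moves no valley.
    hill-case : ∀ {x g} → read 0 R ≡ east x ∷ g → g ≢ [] →
      valleys β ≡ valleysAux 0 0 (steps u) × nthNorthFollowedByN n β ≡ false × epsilon β ≡ (if isEm s then -1ℤ else 1ℤ)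
    hill-case {g = []} eq ne = ⊥-elim (ne refl)
    hill-case {x} {g@(l ∷ g′)} eq _ = valleys-β ,
        trans (cong₂ nthNorthFollowedByN (sym rank≡n) shape) (NorthThen.north-east w₀ y₀ (signedE c) (dropLast g)) ,
        trans (cong epsilon shape) (NorthThen.epsilon-replaced w₀ y₀ (signedE c) (dropLast g))
      where
      open ≡-Reasoning
      shape : β ≡ steps w₀ ++ N ∷ s ∷ steps (dropLast g)
      shape = begin
        replAfterNorth n s (steps (dropLast u))
          ≡⟨ cong₂ (λ m v → replAfterNorth m s (steps v)) (sym rank≡n) (dropLast-u eq) ⟩
        replAfterNorth rank s (steps (w₀ ++ north y₀ ∷ east x ∷ dropLast g))
          ≡⟨ NorthThen.north-east-replaced w₀ y₀ s x (dropLast g) ⟩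
        steps w₀ ++ N ∷ s ∷ steps (dropLast g) ∎
      regroup : ∀ t → (steps w₀ ++ N ∷ t ∷ steps (dropLast g)) ∷ʳ N ≡ (steps w₀ ∷ʳ N) ++ t ∷ (steps (dropLast g) ∷ʳ N)
      regroup t = trans (++-assoc (steps w₀) _ _) (sym (++-assoc (steps w₀) (N ∷ []) _))
      valleys-β : valleys β ≡ valleysAux 0 0 (steps u)
      valleys-β = begin
        valleys β
          ≡⟨ valleys-∷ʳN β ⟩
        valleysAux 0 0 (β ∷ʳ N)
          ≡⟨ cong (valleysAux 0 0) (trans (cong (_∷ʳ N) shape) (regroup s)) ⟩
        valleysAux 0 0 ((steps w₀ ∷ʳ N) ++ s ∷ (steps (dropLast g) ∷ʳ N))
          ≡⟨ valleysAux-signedE (signedE c) 0 0 (steps w₀ ∷ʳ N) _ ⟩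
        valleysAux 0 0 ((steps w₀ ∷ʳ N) ++ E ∷ (steps (dropLast g) ∷ʳ N))
          ≡⟨ cong (valleysAux 0 0) (regroup E) ⟨
        valleysAux 0 0 ((steps w₀ ++ N ∷ E ∷ steps (dropLast g)) ∷ʳ N)
          ≡⟨ cong (λ p → valleysAux 0 0 (p ∷ʳ N)) (trans (cong steps (dropLast-u eq)) (steps-++ w₀ _)) ⟨
        valleysAux 0 0 (steps (dropLast u) ∷ʳ N)
          ≡⟨ cong (valleysAux 0 0) steps-dropLast-u ⟩
        valleysAux 0 0 (steps u) ∎

    shape-from : Ground (r 0) → valleys β ≡ valleysAux 0 0 (steps u) × Shape
    shape-from (zero e fl mr) = valleys-β , flat e fl mr (proj₂ (flat-case eq))
      where
      eq : read 0 R ≡ north (rightMark (r 0)) ∷ read 0 (rights (r ∘ suc) n′)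
      eq = cong (_++ read 0 (rights (r ∘ suc) n′)) (glyph-north 0 (height (r 0)) _ e)
      valleys-β : valleys β ≡ valleysAux 0 0 (steps u)
      valleys-β = trans (cong valleys (proj₁ (flat-case eq)))
        (trans (valleys-∷ʳN (steps (dropLast u))) (cong (valleysAux 0 0) steps-dropLast-u))
    -- From a positive entry the right half meets 1 before 0, so its letters of level 0 begin with
    -- an East and still end with a North.
    shape-from (positive p pl) with read-ends-north slope-R first≥0
    ... | [] , z , eq = ⊥-elim (read-no-north-first slope-R (ℤP.i<j⇒suc[i]≤j p) (subst (StartsWith (north z)) (sym eq) here))
    ... | north y ∷ v , z , eq = ⊥-elim (read-no-north-first slope-R (ℤP.i<j⇒suc[i]≤j p) (subst (StartsWith (north y)) (sym eq) here))
    ... | east x ∷ v , z , eq = let (vs , nf , ε) = hill-case eq (v-nonempty v) in vs , hill pl nf ε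
      where
      v-nonempty : ∀ v → v ∷ʳ north z ≢ []
      v-nonempty []      ()
      v-nonempty (_ ∷ _) ()

    valleys-u : valleys β ≡ valleysAux 0 0 (steps u)
    valleys-u = proj₁ (shape-from ground)

    shape : Shape
    shape = proj₂ (shape-from ground)

    getℤ-w : ∀ {k} → 2 ≤ k → getℤ w k ≡ getℤ d k
    getℤ-w {suc (suc k)} _ = getℤ-signFirst-2+ c d k
    getℤ-w {suc zero} (s≤s ())

    evalℤ-w : ∀ {x i} → At x i B → i < n′ → evalℤ w (+ suc n ℤ.- + suc i) ≡ value x
    evalℤ-w {x} {i} a i<n′ = begin
      evalℤ w (+ suc n ℤ.- + suc i) ≡⟨ cong (evalℤ w) (trans (ℤP.m-n≡m⊖n (suc n) (suc i)) (ℤP.⊖-≥ (s≤s (ℕP.<⇒≤ (ℕP.m<n⇒m<1+n i<n′))))) ⟩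
      evalℤ w (+ (n ∸ i))           ≡⟨ evalℤ-pos (ℕP.m<n⇒0<n∸m (ℕP.m<n⇒m<1+n i<n′)) ⟩
      getℤ w (n ∸ i)                ≡⟨ getℤ-w (subst (2 ≤_) (sym (ℕP.+-∸-assoc 1 (ℕP.<⇒≤ i<n′))) (s≤s (ℕP.m<n⇒0<n∸m i<n′))) ⟩
      getℤ d (n ∸ i)                ≡⟨ d-at-B a ⟩
      value x ∎
      where
      open ≡-Reasoning
      evalℤ-pos : ∀ {k} → 0 < k → evalℤ w (+ k) ≡ getℤ w k
      evalℤ-pos {suc k} _ = refl

    evalℤ-w-neg : ∀ {y j} → At y (suc j) R₀ → evalℤ w (+ n ℤ.- + suc (n ℕ.+ suc j)) ≡ value y
    evalℤ-w-neg {y} {j} a = begin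
      evalℤ w (+ n ℤ.- + suc (n ℕ.+ suc j)) ≡⟨ cong (evalℤ w) (trans (ℤP.m-n≡m⊖n n (suc (n ℕ.+ suc j))) (ℤP.⊖-< (s≤s (ℕP.m≤m+n n (suc j))))) ⟩
      evalℤ w (- (+ (suc (n ℕ.+ suc j) ∸ n))) ≡⟨ cong (λ m → evalℤ w (- (+ m))) (trans (cong (_∸ n) (sym (ℕP.+-suc n (suc j)))) (ℕP.m+n∸m≡n n (suc (suc j)))) ⟩
      - getℤ w (suc (suc j))                ≡⟨ cong -_ (getℤ-signFirst-2+ c d j) ⟩
      - getℤ d (suc (suc j))                ≡⟨ d-at-R₀ a ⟩
      value y ∎
      where open ≡-Reasoning

    1+n∸n : suc n′ ∸ n′ ≡ 1
    1+n∸n = ℕP.m+n∸n≡m 1 n′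

    d-first : ∀ {y} → At y n′ B → getℤ d 1 ≡ value y
    d-first a = trans (cong (getℤ d) (sym 1+n∸n)) (d-at-B a)

    -- The first entry of `d` is negated exactly when the signed step is `Em`, so the two signs
    -- cancel.
    ε-w : epsilon β ≡ (if isEm s then -1ℤ else 1ℤ) → epsilon β ℤ.* getℤ w 1 ≡ getℤ d 1
    ε-w e rewrite e | getℤ-signFirst-1 c d = go c
      where
      go : ∀ c → (if isEm (if c then Ep else Em) then -1ℤ else 1ℤ) ℤ.* (if c then getℤ d 1 else - getℤ d 1) ≡ getℤ d 1
      go true  = ℤP.*-identityˡ _
      go false = trans (ℤP.-1*i≡-i (- getℤ d 1)) (ℤP.neg-involutive _)

    ∣w∣ : ∣ getℤ w 1 ∣ ≡ ∣ getℤ d 1 ∣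
    ∣w∣ rewrite getℤ-signFirst-1 c d = go c
      where
      go : ∀ c → ∣ (if c then getℤ d 1 else - getℤ d 1) ∣ ≡ ∣ getℤ d 1 ∣
      go true  = refl
      go false = ℤP.∣-i∣≡∣i∣ (getℤ d 1)

    X : ℕ → ℤ
    X i = evalℤ w (+ suc n ℤ.- + suc i)

    label-low : ∀ i {j} → j < n′ → valleyLabel n β w (suc i , suc j) ≡ pr (X i) (X j)
    label-low i {j} p rewrite <ᵇ-true p = refl

    label-n-flat : ∀ i → nthNorthFollowedByN n β ≡ true → valleyLabel n β w (suc i , n) ≡ pmR (X i) ∣ getℤ w 1 ∣
    label-n-flat i T rewrite <ᵇ-false (ℕP.≤-refl {n′}) | ≡ᵇ-true n′ | T = refl

    label-n-hill : ∀ i → nthNorthFollowedByN n β ≡ false → valleyLabel n β w (suc i , n) ≡ pr (X i) (epsilon β ℤ.* getℤ w 1)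
    label-n-hill i T rewrite <ᵇ-false (ℕP.≤-refl {n′}) | ≡ᵇ-true n′ | T = refl

    label-1+n : ∀ i → valleyLabel n β w (suc i , suc n) ≡ pr (X i) (- (epsilon β ℤ.* getℤ w 1))
    label-1+n i rewrite <ᵇ-false (ℕP.n≤1+n n′) | ≡ᵇ-false (ℕP.1+n≢n {n′}) | ≡ᵇ-true n′ = refl

    label-high : ∀ i j → valleyLabel n β w (suc i , suc (n ℕ.+ suc j)) ≡ pr (X i) (evalℤ w (+ n ℤ.- + suc (n ℕ.+ suc j)))
    label-high i j rewrite <ᵇ-false {n ℕ.+ suc j} {n′} (ℕP.≤-trans (ℕP.n≤1+n n′) (ℕP.m≤m+n n (suc j)))
      | ≡ᵇ-false {n ℕ.+ suc j} {n′} (λ e → ℕP.<-irrefl (sym e) (ℕP.m≤m+n n (suc j)))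
      | ≡ᵇ-false {n ℕ.+ suc j} {n} (λ e → ℕP.<-irrefl (sym e) (ℕP.m<m+n n (ℕ.z<s {j}))) = refl

    fall-not-mirror : (tag (leftMark (r 0)) ≢ mirror) → ∀ {x y} → Fall x y → tag y ≢ mirror
    fall-not-mirror ne (in-left {zero} _ _ _)  = ne
    fall-not-mirror ne (in-left {suc k} _ _ _) e with trans (sym (plain-left k)) e
    ... | ()
    fall-not-mirror ne (in-right {k} _ _ _) e with trans (sym (plain-right k)) e
    ... | ()

    fall-plain : tag (leftMark (r 0)) ≡ plain → ∀ {x y} → Fall x y → tag y ≡ plain
    fall-plain pl (in-left {zero} _ _ _)  = pl
    fall-plain pl (in-left {suc k} _ _ _) = plain-left k
    fall-plain pl (in-right {k} _ _ _)    = plain-right k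

    plain-lefts : ∀ j m → All Plain (labels j (lefts (r ∘ suc) m))
    plain-lefts j zero    = []
    plain-lefts j (suc m) = AllP.++⁺ (all-pick j (left (r (suc m))) (plain-left m)) (plain-lefts j m)

    -- The two copies of the first row now meet in the middle of level 0: the left one closes `B` as
    -- North number n, and the right one opens `R₀` as number n + 1. All other Norths are plain.
    module Flat (h≡0 : height (r 0) ≡ 0ℤ) where

      L′ R′ : List (ℤ × Mark)
      L′ = lefts (r ∘ suc) n′
      R′ = rights (r ∘ suc) n′

      upper : ℕ → List Mark
      upper zero    = []
      upper (suc j) = labels (suc j) b ++ upper j

      norths-upper : ∀ J → norths (word J b) ≡ upper J ++ labels 0 b
      norths-upper zero    = norths-read 0 b
      norths-upper (suc J) = begin
        norths (read (suc J) b ++ word J b)             ≡⟨ norths-++ (read (suc J) b) (word J b) ⟩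
        norths (read (suc J) b) ++ norths (word J b)    ≡⟨ cong₂ _++_ (norths-read (suc J) b) (norths-upper J) ⟩
        labels (suc J) b ++ upper J ++ labels 0 b       ≡⟨ ++-assoc (labels (suc J) b) _ _ ⟨
        upper (suc J) ++ labels 0 b ∎
        where open ≡-Reasoning

      labels-upper : ∀ j → labels (suc j) b ≡ labels (suc j) L′ ++ labels (suc j) R′
      labels-upper j = trans (cong (labels (suc j)) (doubled-split-first r n′))
        (trans (labels-++ (suc j) L′ (left (r 0) ∷ right (r 0) ∷ R′)) (cong (labels (suc j) L′ ++_) zeros))
        where
        zeros : labels (suc j) (left (r 0) ∷ right (r 0) ∷ R′) ≡ labels (suc j) R′
        zeros rewrite h≡0 = refl

      plain-upper : ∀ j → All Plain (upper j)
      plain-upper zero    = []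
      plain-upper (suc j) = AllP.++⁺ (subst (All Plain) (sym (labels-upper j))
        (AllP.++⁺ (plain-lefts (suc j) n′) (plain-rights (suc j) (r ∘ suc) n′ plain-right))) (plain-upper j)

      R₀≡ : R₀ ≡ rightMark (r 0) ∷ labels 0 R′
      R₀≡ rewrite h≡0 = refl

      before : List Mark
      before = upper J ++ labels 0 L′

      L₀≡ : L₀ ≡ labels 0 L′ ∷ʳ leftMark (r 0)
      L₀≡ = trans (cong (labels 0) (sym (applyDownFrom-∷ʳ (left ∘ r) n′)))
        (trans (labels-++ 0 L′ (left (r 0) ∷ [])) (cong (labels 0 L′ ++_) last))
        where
        last : labels 0 (left (r 0) ∷ []) ≡ leftMark (r 0) ∷ []
        last rewrite h≡0 = refl

      B≡ : B ≡ before ∷ʳ leftMark (r 0)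
      B≡ = ++-cancelʳ R₀ _ _ (begin
        B ++ R₀                                       ≡⟨ norths-u ⟨
        norths u                                      ≡⟨ norths-upper J ⟩
        upper J ++ labels 0 b                         ≡⟨ cong (upper J ++_) (labels-++ 0 L R) ⟩
        upper J ++ L₀ ++ R₀                           ≡⟨ ++-assoc (upper J) L₀ R₀ ⟨
        (upper J ++ L₀) ++ R₀                         ≡⟨ cong (λ l → (upper J ++ l) ++ R₀) L₀≡ ⟩
        (upper J ++ labels 0 L′ ∷ʳ leftMark (r 0)) ++ R₀ ≡⟨ cong (_++ R₀) (++-assoc (upper J) (labels 0 L′) _) ⟨
        (before ∷ʳ leftMark (r 0)) ++ R₀ ∎)
        where open ≡-Reasoning

      length-before : length before ≡ n′
      length-before = ℕP.suc-injective (trans (ℕP.+-comm 1 (length before)) (trans (sym (length-++ before)) (trans (cong length (sym B≡)) length-B)))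

      at-B-low : ∀ {y j} → At y j B → j < n′ → Plain y
      at-B-low {y} {j} a p with at-++⁻ before (subst (At y j) B≡ a)
      ... | inj₁ (_ , a′)        = at-All (AllP.++⁺ (plain-upper J) (plain-lefts 0 n′)) a′
      ... | inj₂ (i , refl , _) = ⊥-elim (ℕP.<⇒≱ p (ℕP.≤-trans (ℕP.≤-reflexive (sym length-before)) (ℕP.m≤m+n _ i)))

      at-B-last : ∀ {y} → At y n′ B → y ≡ leftMark (r 0)
      at-B-last {y} a with at-++⁻ before (subst (At y n′) B≡ a)
      ... | inj₁ (p , _)      = ⊥-elim (ℕP.<-irrefl (sym length-before) p)
      ... | inj₂ (i , _ , a′) = proj₂ (at-singleton a′)

      at-R₀-0 : ∀ {y} → At y 0 R₀ → y ≡ rightMark (r 0)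
      at-R₀-0 {y} a with subst (At y 0) R₀≡ a
      ... | here = refl

      at-R₀-suc : ∀ {y j} → At y (suc j) R₀ → Plain y
      at-R₀-suc {y} {j} a with subst (At y (suc j)) R₀≡ a
      ... | there a′ = at-All (plain-rights 0 (r ∘ suc) n′ plain-right) a′

    X-value : ∀ {x i} → At x i (easts u) → X i ≡ value x
    X-value {x} {i} a = evalℤ-w (subst (At x i) easts-u (at-++ˡ L₀ a)) (ℕP.<-≤-trans (at-length a) easts-short)

    -- The cases are those of `valleyLabel` with positions counted from 0: j < n - 1 and j = n - 1
    -- lie in `B`, j = n and j > n in `R₀`.
    valleyLabel-correct : ∀ {x y i j} → Fall x y → At x i (easts u) → At y j (norths u) →
      valleyLabel n β w (suc i , suc j) ≡ label x y
    valleyLabel-correct {x} {y} {i} {j} f p q with at-++⁻ B (subst (At y j) norths-u q)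
    ... | inj₁ (j<∣B∣ , a) with ℕP.m≤n⇒m<n∨m≡n (ℕP.≤-pred (subst (j <_) length-B j<∣B∣))
    ...   | inj₁ j<n′ = trans (label-low i j<n′) (trans (cong₂ pr (X-value p) (evalℤ-w a j<n′)) (sym (label-plain x (tag-plain shape))))
      where
      tag-plain : Shape → tag y ≡ plain
      tag-plain (flat e _ _ _) = Flat.at-B-low e a j<n′
      tag-plain (hill pl _ _)  = fall-plain pl f
    ...   | inj₂ refl = by-shape shape
      where
      by-shape : Shape → valleyLabel n β w (suc i , n) ≡ label x y
      by-shape (flat e fl _ T) with Flat.at-B-last e a
      ... | refl = trans (label-n-flat i T) (trans (cong₂ pmR (X-value p) (trans ∣w∣ (cong ∣_∣ (d-first a)))) (label-formal fl))
        where
        label-formal : ∀ {y} → tag y ≡ formal → pmR (value x) ∣ value y ∣ ≡ label x y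
        label-formal refl = refl
      by-shape (hill pl T ε) = trans (label-n-hill i T)
        (trans (cong₂ pr (X-value p) (trans (ε-w ε) (d-first a))) (sym (label-plain x (fall-plain pl f))))
    valleyLabel-correct {x} {y} {i} f p q | inj₂ (zero , refl , a)
      rewrite length-B | ℕP.+-identityʳ n′ = by-shape shape
      where
      by-shape : Shape → valleyLabel n β w (suc i , suc n) ≡ label x y
      by-shape (flat e fl mr _) with Flat.at-R₀-0 e a
      ... | refl = ⊥-elim (fall-not-mirror (λ m → formal≢mirror (trans (sym fl) m)) f mr)
        where
        formal≢mirror : formal ≢ mirror
        formal≢mirror ()
      by-shape (hill pl T ε) = trans (label-1+n i)
        (trans (cong₂ pr (X-value p) (trans (cong -_ (ε-w ε)) (d-at-R₀ a))) (sym (label-plain x (fall-plain pl f))))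
    valleyLabel-correct {x} {y} {i} f p q | inj₂ (suc j , refl , a)
      rewrite length-B = trans (label-high i j)
        (trans (cong₂ pr (X-value p) (evalℤ-w-neg a)) (sym (label-plain x (tag-plain shape))))
      where
      tag-plain : Shape → tag y ≡ plain
      tag-plain (flat e _ _ _) = Flat.at-R₀-suc e a
      tag-plain (hill pl _ _)  = fall-plain pl f

    valley⇔fall : ∀ {l} → HasValley n β w l ⇔ (∃₂ λ x y → Fall x y × label x y ≡ l)
    valley⇔fall {l} = mk⇔ to from
      where
      to : HasValley n β w l → ∃₂ λ x y → Fall x y × label x y ≡ l
      to (ij , v , eq) with valleysAux⁻ 0 0 u (subst (ij ∈_) valleys-u v)
      ... | i , j , x , y , refl , valleyAt a p q = x , y , fall a , trans (sym (valleyLabel-correct (fall a) p q)) eq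
      from : (∃₂ λ x y → Fall x y × label x y ≡ l) → HasValley n β w l
      from (x , y , f , eq) with valleysAux⁺ 0 0 (letters f)
      ... | i , j , v , valleyAt a p q = (suc i , suc j) , subst (_ ∈_) (sym valleys-u) v , trans (valleyLabel-correct f p q) eq

-- Rises of lattice paths

-- Rows are counted from 0: easts-before 0 π k is π_{k+1}.
easts-before : ℕ → List Step → ℕ → ℕ
easts-before e p k = getℕ (piAux e p) (suc k)

≤-easts-before : ∀ e p {k} → k < countN' p → e ≤ easts-before e p k
≤-easts-before e (N ∷ p)  {zero}  q       = ℕP.≤-refl
≤-easts-before e (N ∷ p)  {suc k} (s≤s q) = ≤-easts-before e p q
≤-easts-before e (E ∷ p)  q = ℕP.≤-trans (ℕP.n≤1+n e) (≤-easts-before (suc e) p q)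
≤-easts-before e (Ep ∷ p) q = ℕP.≤-trans (ℕP.n≤1+n e) (≤-easts-before (suc e) p q)
≤-easts-before e (Em ∷ p) q = ℕP.≤-trans (ℕP.n≤1+n e) (≤-easts-before (suc e) p q)

easts-before-≤ : ∀ e p {k} → k < countN' p → easts-before e p k ≤ e ℕ.+ countE p
easts-before-≤ e (N ∷ p)  {zero}  q       = ℕP.m≤m+n e _
easts-before-≤ e (N ∷ p)  {suc k} (s≤s q) = easts-before-≤ e p q
easts-before-≤ e (E ∷ p)  q = ℕP.≤-trans (easts-before-≤ (suc e) p q) (ℕP.≤-reflexive (sym (ℕP.+-suc e _)))
easts-before-≤ e (Ep ∷ p) q = ℕP.≤-trans (easts-before-≤ (suc e) p q) (ℕP.≤-reflexive (sym (ℕP.+-suc e _)))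
easts-before-≤ e (Em ∷ p) q = ℕP.≤-trans (easts-before-≤ (suc e) p q) (ℕP.≤-reflexive (sym (ℕP.+-suc e _)))

easts-before-mono : ∀ e p {k} → suc k < countN' p → easts-before e p k ≤ easts-before e p (suc k)
easts-before-mono e (N ∷ p)  {zero}  (s≤s q) = ≤-easts-before e p q
easts-before-mono e (N ∷ p)  {suc k} (s≤s q) = easts-before-mono e p q
easts-before-mono e (E ∷ p)  q = easts-before-mono (suc e) p q
easts-before-mono e (Ep ∷ p) q = easts-before-mono (suc e) p q
easts-before-mono e (Em ∷ p) q = easts-before-mono (suc e) p q

nextIsN⇒≡ : ∀ e p → nextIsN p ≡ true → easts-before e p 0 ≡ e × 0 < countN' p
nextIsN⇒≡ e (N ∷ p) _ = refl , ℕ.z<s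

≡⇒nextIsN : ∀ e p → 0 < countN' p → easts-before e p 0 ≡ e → nextIsN p ≡ true
≡⇒nextIsN e (N ∷ p)  q eq = refl
≡⇒nextIsN e (E ∷ p)  q eq = ⊥-elim (ℕP.<-irrefl (sym eq) (≤-easts-before (suc e) p q))
≡⇒nextIsN e (Ep ∷ p) q eq = ⊥-elim (ℕP.<-irrefl (sym eq) (≤-easts-before (suc e) p q))
≡⇒nextIsN e (Em ∷ p) q eq = ⊥-elim (ℕP.<-irrefl (sym eq) (≤-easts-before (suc e) p q))

-- The rise k + 1 in the form π_{k+1} = π_{k+2}, which can be compared with the area vector.
Flat-at : ℕ → List Step → ℕ → Set
Flat-at e p k = suc k < countN' p × easts-before e p (suc k) ≡ easts-before e p k

rises⁻ : ∀ e r p {i} → i ∈ risesAux r p → ∃ λ k → i ≡ suc (r ℕ.+ k) × Flat-at e p k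
rises⁻ e r (E ∷ p)  m = rises⁻ (suc e) r p m
rises⁻ e r (Ep ∷ p) m = rises⁻ (suc e) r p m
rises⁻ e r (Em ∷ p) m = rises⁻ (suc e) r p m
rises⁻ e r (N ∷ p) m with nextIsN p in eq
rises⁻ e r (N ∷ p) (here refl) | true = 0 , cong suc (sym (ℕP.+-identityʳ r)) , s≤s (proj₂ (nextIsN⇒≡ e p eq)) , proj₁ (nextIsN⇒≡ e p eq)
rises⁻ e r (N ∷ p) (there m) | true with rises⁻ e (suc r) p m
... | k , eq′ , q , f = suc k , trans eq′ (cong suc (sym (ℕP.+-suc r k))) , s≤s q , f
rises⁻ e r (N ∷ p) m | false with rises⁻ e (suc r) p m
... | k , eq′ , q , f = suc k , trans eq′ (cong suc (sym (ℕP.+-suc r k))) , s≤s q , f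

rises⁺ : ∀ e r p {k} → Flat-at e p k → suc (r ℕ.+ k) ∈ risesAux r p
rises⁺ e r (E ∷ p)  f = rises⁺ (suc e) r p f
rises⁺ e r (Ep ∷ p) f = rises⁺ (suc e) r p f
rises⁺ e r (Em ∷ p) f = rises⁺ (suc e) r p f
rises⁺ e r (N ∷ p) {zero} (s≤s q , f) rewrite ≡⇒nextIsN e p q f = here (cong suc (ℕP.+-identityʳ r))
rises⁺ e r (N ∷ p) {suc k} (s≤s q , f) with nextIsN p
... | true  = there (subst (λ m → suc m ∈ risesAux (suc r) p) (sym (ℕP.+-suc r k)) (rises⁺ e (suc r) p (q , f)))
... | false = subst (λ m → suc m ∈ risesAux (suc r) p) (sym (ℕP.+-suc r k)) (rises⁺ e (suc r) p (q , f))

beginsNN⇒≡0 : ∀ p → beginsNN p ≡ true → easts-before 0 p 0 ≡ 0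
beginsNN⇒≡0 (N ∷ N ∷ p) _ = refl

≡0⇒beginsNN : ∀ p → easts-before 0 p 0 ≡ 0 → Flat-at 0 p 0 → beginsNN p ≡ true
≡0⇒beginsNN (N ∷ p)  z (s≤s q , f) with p | ≡⇒nextIsN 0 p q f
... | N ∷ _ | _ = refl
≡0⇒beginsNN (E ∷ p)  z (q , _) = ⊥-elim (ℕP.<-irrefl (sym z) (≤-easts-before 1 p (ℕP.<⇒≤ q)))
≡0⇒beginsNN (Ep ∷ p) z (q , _) = ⊥-elim (ℕP.<-irrefl (sym z) (≤-easts-before 1 p (ℕP.<⇒≤ q)))
≡0⇒beginsNN (Em ∷ p) z (q , _) = ⊥-elim (ℕP.<-irrefl (sym z) (≤-easts-before 1 p (ℕP.<⇒≤ q)))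

-- Normalised rows of a path

evenℕ-double : ∀ k → evenℕ (k ℕ.+ k) ≡ true
evenℕ-double zero    = refl
evenℕ-double (suc k) rewrite ℕP.+-suc k k | evenℕ-double k = refl

neg1^-even : ∀ z → neg1^ (z ℤ.+ z) ≡ 1ℤ
neg1^-even (+ k)    rewrite evenℕ-double k = refl
neg1^-even -[1+ k ] rewrite evenℕ-double k = refl

neg1^-odd : ∀ z → neg1^ (ℤ.suc (z ℤ.+ z)) ≡ -1ℤ
neg1^-odd (+ k)    rewrite evenℕ-double k = refl
neg1^-odd -[1+ k ] rewrite evenℕ-double k = refl

data Unit± : ℤ → Set where
  +1′ : Unit± 1ℤ
  -1′ : Unit± -1ℤ

epsilon-unit : ∀ p → Unit± (epsilon p)
epsilon-unit []       = +1′
epsilon-unit (N ∷ p)  = epsilon-unit p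
epsilon-unit (E ∷ p)  = epsilon-unit p
epsilon-unit (Ep ∷ p) = epsilon-unit p
epsilon-unit (Em ∷ p) = -1′

neg-unit : ∀ {z} → Unit± z → Unit± (- z)
neg-unit +1′ = -1′
neg-unit -1′ = +1′

opposed : Row Mark → Set
opposed ρ = value (rightMark ρ) ≡ - value (leftMark ρ)

swap-opposed : ∀ a x y → value y ≡ - value x → opposed (a , y , x)
swap-opposed a x y e = trans (sym (ℤP.neg-involutive (value x))) (cong -_ (sym e))

normFirst normLast : Row Mark → Row Mark
normFirst (-[1+ h ] , x , y)  = - -[1+ h ] , y , x
normFirst (+ h , x , y)       = + h , x , y
normLast (+ suc l , x , y)    = 1ℤ ℤ.- + suc l , y , x
normLast (+ zero , x , y)     = + zero , x , y
normLast (-[1+ l ] , x , y)   = -[1+ l ] , x , y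

normLast-opposed : ∀ ρ → opposed ρ → opposed (normLast ρ)
normLast-opposed (+ suc l , x , y) e  = swap-opposed (1ℤ ℤ.- + suc l) x y e
normLast-opposed (+ zero , x , y) e   = e
normLast-opposed (-[1+ l ] , x , y) e = e

normFirst-opposed : ∀ ρ → opposed ρ → opposed (normFirst ρ)
normFirst-opposed (+ h , x , y) e      = e
normFirst-opposed (-[1+ h ] , x , y) e = swap-opposed (+ suc h) x y e

normLast≤0 : ∀ ρ → height (normLast ρ) ℤ.≤ 0ℤ
normLast≤0 (+ suc zero , x , y)    = ℤP.≤-refl
normLast≤0 (+ suc (suc l) , x , y) = ℤ.-≤+
normLast≤0 (+ zero , x , y)        = ℤP.≤-refl
normLast≤0 (-[1+ l ] , x , y)      = ℤ.-≤+

module NormLast (ρ : ℕ → Row Mark) (n′ : ℕ) where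

  apply : ℕ → Row Mark
  apply k = if k ≡ᵇ n′ then normLast (ρ k) else ρ k

  apply-below : ∀ {k} → k < n′ → apply k ≡ ρ k
  apply-below {k} p rewrite dec-false (k ℕ.≟ n′) (ℕP.<⇒≢ p) = refl

  apply-last : apply n′ ≡ normLast (ρ n′)
  apply-last rewrite dec-true (n′ ℕ.≟ n′) refl = refl

  -- Forgets which value triggered the reflection, so that `ReflectLast` applies with a variable
  -- height.
  data Flip : Row Mark → Row Mark → Set where
    kept    : ∀ {ρ} → Flip ρ ρ
    flipped : ∀ l x y → Flip (l , x , y) (1ℤ ℤ.- l , y , x)

  flip : ∀ ρ → Flip ρ (normLast ρ)
  flip (+ suc l , x , y)  = flipped _ _ _
  flip (+ zero , x , y)   = kept
  flip (-[1+ l ] , x , y) = kept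

  record Invariant : Set where
    constructor invariant
    field
      word≡ : ∀ {J} → ∣ height (ρ n′) ∣ < J → ∣ 1ℤ ℤ.- height (ρ n′) ∣ < J →
        dropLast (word J (doubled ρ (suc n′))) ≡ dropLast (word J (doubled apply (suc n′)))
      backward≡ : ∀ J → backward J (lefts ρ (suc n′)) (rights ρ (suc n′)) ≡ backward J (lefts apply (suc n′)) (rights apply (suc n′))

  invariant-from : ∀ {a a′} → Flip a a′ → ρ n′ ≡ a → apply n′ ≡ a′ → Invariant
  invariant-from kept e e′ = invariant
      (λ {J} _ _ → cong₂ (λ L R → dropLast (word J (L ++ R))) lefts≡ rights≡)
      (λ J → cong₂ (backward J) lefts≡ rights≡)
    where
    same : ∀ {k} → k < suc n′ → ρ k ≡ apply k
    same p = Data.Sum.[ (λ q → sym (apply-below q)) , (λ { refl → trans e (sym e′) }) ]′ (ℕP.m≤n⇒m<n∨m≡n (ℕP.≤-pred p))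
    lefts≡  = applyDownFrom-cong (suc n′) (cong left ∘ same)
    rights≡ = applyUpTo-cong (suc n′) (cong right ∘ same)
  invariant-from (flipped l x y) e e′ = invariant
      (λ p q → word-invariant (subst (λ z → ∣ z ∣ < _) (cong height e) p) (subst (λ z → ∣ 1ℤ ℤ.- z ∣ < _) (cong height e) q))
      backward-invariant
    where open ReflectLast ρ apply n′ (λ p → sym (apply-below p)) l x y e e′

  invariance : Invariant
  invariance = invariant-from (flip (ρ n′)) refl apply-last

module NormFirst (ρ : ℕ → Row Mark) (n′ : ℕ) where

  apply : ℕ → Row Mark
  apply zero    = normFirst (ρ 0)
  apply (suc k) = ρ (suc k)

  ∣normFirst∣ : ∀ r → ∣ height (normFirst r) ∣ ≡ ∣ height r ∣
  ∣normFirst∣ (+ h , _)      = refl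
  ∣normFirst∣ (-[1+ h ] , _) = refl

  ∣apply∣ : ∀ k → ∣ height (apply k) ∣ ≡ ∣ height (ρ k) ∣
  ∣apply∣ zero    = ∣normFirst∣ (ρ 0)
  ∣apply∣ (suc k) = refl

  record Invariant : Set where
    constructor invariant
    field
      word≡ : ∀ J → word J (doubled ρ (suc n′)) ≡ word J (doubled apply (suc n′))
      backward≡ : ∀ {J} → (∀ {k} → k < suc n′ → ∣ height (ρ k) ∣ ≤ J) →
        backward J (lefts ρ (suc n′)) (rights ρ (suc n′)) ≡ backward J (lefts apply (suc n′)) (rights apply (suc n′))

  invariant-from : ∀ a → ρ 0 ≡ a → Invariant
  invariant-from (+ h , x , y) e = invariant
      (λ J → cong₂ (λ L R → word J (L ++ R)) lefts≡ rights≡)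
      (λ {J} _ → cong₂ (backward J) lefts≡ rights≡)
    where
    same : ∀ {k} → k < suc n′ → ρ k ≡ apply k
    same {zero}  _ = trans e (cong normFirst (sym e))
    same {suc k} _ = refl
    lefts≡  = applyDownFrom-cong (suc n′) (λ {k} p → cong left (same {k} p))
    rights≡ = applyUpTo-cong (suc n′) (λ {k} p → cong right (same {k} p))
  invariant-from (-[1+ h ] , x , y) e = invariant word-invariant
      (λ bd → backward-invariant bd (λ {k} p → ℕP.≤-trans (ℕP.≤-reflexive (∣apply∣ k)) (bd p)))
    where open NegateFirst ρ apply n′ (λ _ → refl) -[1+ h ] x y e (cong normFirst e) (λ ())

  invariance : Invariant
  invariance = invariant-from (ρ 0) refl

getℤ-nu-last : ∀ m z → getℤ (map +_ (upTo (suc m)) ++ z ∷ []) (suc (suc m)) ≡ z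
getℤ-nu-last m z = subst (λ l → getℤ (map +_ (upTo (suc m)) ++ z ∷ []) (suc l) ≡ z)
  (trans (length-map +_ (upTo (suc m))) (length-upTo (suc m))) (getℤ-∷ʳ (map +_ (upTo (suc m))) z)

getℤ-nu : ∀ m z → getℤ (map +_ (upTo (suc m)) ++ z ∷ []) (suc m) ≡ + m
getℤ-nu m z = trans (getℤ-++ˡ (map +_ (upTo (suc m))) _ (subst (m <_) (sym (trans (length-map +_ (upTo (suc m))) (length-upTo (suc m)))) (ℕP.n<1+n m)))
  (trans (cong (λ l → getℤ l (suc m)) (map-upTo +_ (suc m))) (getℤ-applyUpTo +_ (suc m) (ℕP.n<1+n m)))

-- Evaluated at π_1 + k for the row of index k: this number is 0 only at the first row, and only if
-- no East step precedes the first North step.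
leftTag rightTag : ℕ → Tag
leftTag zero     = formal
leftTag (suc _)  = plain
rightTag zero    = mirror
rightTag (suc _) = plain

leftTag-suc : ∀ p k → leftTag (p ℕ.+ suc k) ≡ plain
leftTag-suc p k rewrite ℕP.+-suc p k = refl

rightTag-suc : ∀ p k → rightTag (p ℕ.+ suc k) ≡ plain
rightTag-suc p k rewrite ℕP.+-suc p k = refl

plainRow : ℤ → ℤ → Row Mark
plainRow a z = a , (z , plain) , (- z , plain)

normLast-height : ∀ ρ → height (normLast ρ) ≡ height ρ ⊎ height (normLast ρ) ≡ 1ℤ ℤ.- height ρ
normLast-height (+ zero , _)   = inj₁ refl
normLast-height (+ suc _ , _)  = inj₂ refl
normLast-height (-[1+ _ ] , _) = inj₁ refl

normLast-bound : ∀ a {N} → ∣ height a ∣ ≤ N → ∣ 1ℤ ℤ.- height a ∣ ≤ N → ∣ height (normLast a) ∣ ≤ N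
normLast-bound a p q with normLast-height a
... | inj₁ e = subst (λ z → ∣ z ∣ ≤ _) (sym e) p
... | inj₂ e = subst (λ z → ∣ z ∣ ≤ _) (sym e) q

-- Arithmetic of the heights

≤-suc-strict : ∀ {a b} → a ℤ.≤ b → a ℤ.≤ ℤ.suc b × a ≢ ℤ.suc b
≤-suc-strict {b = b} p = ℤP.≤-trans p (ℤP.i≤suc[i] b) , λ e → ℤP.<-irrefl e (ℤP.≤-<-trans p (ℤP.suc[i]≤j⇒i<j ℤP.≤-refl))

suc-shift : ∀ a k → ℤ.suc (a ℤ.- + suc k) ≡ a ℤ.- + k
suc-shift a k = solve 2 (λ a k → con 1ℤ :+ (a :- (con 1ℤ :+ k)) := a :- k) refl a (+ k)
  where open +-*-Solver

∣unit*∣ : ∀ {t} → Unit± t → ∀ z → ∣ t ℤ.* z ∣ ≡ ∣ z ∣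
∣unit*∣ +1′ z = cong ∣_∣ (ℤP.*-identityˡ z)
∣unit*∣ -1′ z = trans (cong ∣_∣ (ℤP.-1*i≡-i z)) (ℤP.∣-i∣≡∣i∣ z)

-- Here p, q, N are π_{n-1}, π_n, n - 1, with differences d = q - p and s = N - q. The names refer
-- to the parity in the definition of λ_n and to the case of ν; N + (1 + N + 0) is the form to which
-- 2n - 1 reduces.
module _ (p d s : ℤ) {q N : ℤ} (q≡ : q ≡ p ℤ.+ d) (N≡ : N ≡ p ℤ.+ d ℤ.+ s) where

  open +-*-Solver

  even-case-1 : + 2 ℤ.* q ℤ.- p ℤ.- N ≡ d ℤ.- s
  even-case-1 rewrite q≡ | N≡ =
    solve 3 (λ p d s → con (+ 2) :* (p :+ d) :- p :- (p :+ d :+ s) := d :- s) refl p d s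

  odd-case-1 : N ℤ.+ (1ℤ ℤ.+ N ℤ.+ 0ℤ) ℤ.- + 2 ℤ.* q ℤ.+ p ℤ.- N ≡ 1ℤ ℤ.- (d ℤ.- s)
  odd-case-1 rewrite q≡ | N≡ =
    solve 3 (λ p d s → (p :+ d :+ s) :+ (con 1ℤ :+ (p :+ d :+ s) :+ con 0ℤ) :- con (+ 2) :* (p :+ d) :+ p :- (p :+ d :+ s)
      := con 1ℤ :- (d :- s)) refl p d s

  even-case-2 : 1ℤ ℤ.+ N ℤ.- (+ 2 ℤ.* q ℤ.- p) ≡ 1ℤ ℤ.- (d ℤ.- s)
  even-case-2 rewrite q≡ | N≡ =
    solve 3 (λ p d s → con 1ℤ :+ (p :+ d :+ s) :- (con (+ 2) :* (p :+ d) :- p) := con 1ℤ :- (d :- s)) refl p d s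

  odd-case-2 : 1ℤ ℤ.+ N ℤ.- (N ℤ.+ (1ℤ ℤ.+ N ℤ.+ 0ℤ) ℤ.- + 2 ℤ.* q ℤ.+ p) ≡ d ℤ.- s
  odd-case-2 rewrite q≡ | N≡ =
    solve 3 (λ p d s → con 1ℤ :+ (p :+ d :+ s) :- ((p :+ d :+ s) :+ (con 1ℤ :+ (p :+ d :+ s) :+ con 0ℤ) :- con (+ 2) :* (p :+ d) :+ p)
      := d :- s) refl p d s

  height-before-last : ∀ {k} → N ≡ 1ℤ ℤ.+ k → p ℤ.- k ≡ 1ℤ ℤ.- (d ℤ.+ s)
  height-before-last {k} N≡1+k = trans (cong (λ z → p ℤ.- z) k≡) (trans (cong (λ z → p ℤ.- (z ℤ.- 1ℤ)) N≡)
    (solve 3 (λ p d s → p :- (p :+ d :+ s :- con 1ℤ) := con 1ℤ :- (d :+ s)) refl p d s))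
    where
    k≡ : k ≡ N ℤ.- 1ℤ
    k≡ = trans (solve 1 (λ k → k := con 1ℤ :+ k :- con 1ℤ) refl k) (cong (ℤ._- 1ℤ) (sym N≡1+k))

  -- The exponent 1 + μ_{n-1} + μ_n is 2 (1 - s) here and 1 + 2 (1 - d) for the reflected value, so
  -- the factor of row n detects the reflection.
  sign-direct : ∀ {a l} → a ≡ 1ℤ ℤ.- (d ℤ.+ s) → l ≡ d ℤ.- s → neg1^ (1ℤ ℤ.+ a ℤ.+ l) ≡ 1ℤ
  sign-direct refl refl = trans (cong neg1^
    (solve 2 (λ d s → con 1ℤ :+ (con 1ℤ :- (d :+ s)) :+ (d :- s) := (con 1ℤ :- s) :+ (con 1ℤ :- s)) refl d s)) (neg1^-even (1ℤ ℤ.- s))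

  sign-reflected : ∀ {a l} → a ≡ 1ℤ ℤ.- (d ℤ.+ s) → l ≡ 1ℤ ℤ.- (d ℤ.- s) → neg1^ (1ℤ ℤ.+ a ℤ.+ l) ≡ -1ℤ
  sign-reflected refl refl = trans (cong neg1^
    (solve 2 (λ d s → con 1ℤ :+ (con 1ℤ :- (d :+ s)) :+ (con 1ℤ :- (d :- s)) := con 1ℤ :+ ((con 1ℤ :- d) :+ (con 1ℤ :- d))) refl d s)) (neg1^-odd (1ℤ ℤ.- d))

1-+suc : ∀ k → 1ℤ ℤ.- + suc k ≡ - (+ k)
1-+suc zero    = refl
1-+suc (suc k) = refl

0-+s : ∀ s → + 0 ℤ.- + s ≡ - (+ s)
0-+s s = ℤP.+-identityˡ (- (+ s))

1-[0-s] : ∀ s → 1ℤ ℤ.- (+ 0 ℤ.- + s) ≡ + suc s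
1-[0-s] s = trans (cong (λ z → 1ℤ ℤ.- z) (0-+s s)) (cong (λ z → 1ℤ ℤ.+ z) (ℤP.neg-involutive (+ s)))

reflect-involutive : ∀ z → 1ℤ ℤ.- (1ℤ ℤ.- z) ≡ z
reflect-involutive z = solve 1 (λ z → con 1ℤ :- (con 1ℤ :- z) := z) refl z
  where open +-*-Solver

≤-from-sum : ∀ {a b} k → b ≡ a ℤ.+ + k → a ℤ.≤ b
≤-from-sum {a} k refl = ℤP.i≤i+j a (+ k)

below-direct : ∀ t s → 1ℤ ℤ.- (+ suc t ℤ.+ + s) ℤ.≤ + suc t ℤ.- + s
below-direct t s = ≤-from-sum (t ℕ.+ suc t)
  (solve 2 (λ t s → con 1ℤ :+ t :- s := con 1ℤ :- (con 1ℤ :+ t :+ s) :+ (t :+ (con 1ℤ :+ t))) refl (+ t) (+ s))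
  where open +-*-Solver

below-reflected : ∀ t s → 1ℤ ℤ.- (+ suc t ℤ.+ + s) ℤ.≤ 1ℤ ℤ.- (+ suc t ℤ.- + s)
below-reflected t s = ≤-from-sum (s ℕ.+ s)
  (solve 2 (λ t s → con 1ℤ :- (con 1ℤ :+ t :- s) := con 1ℤ :- (con 1ℤ :+ t :+ s) :+ (s :+ s)) refl (+ t) (+ s))
  where open +-*-Solver

∣+-+∣≤ : ∀ {a b N} → a ≤ N → b ≤ N → ∣ + a ℤ.- + b ∣ ≤ N
∣+-+∣≤ {a} {b} p q = ℕP.≤-trans (ℕP.≤-reflexive (cong ∣_∣ (ℤP.m-n≡m⊖n a b)))
  (ℕP.≤-trans (ℤP.∣m⊝n∣≤m⊔n a b) (ℕP.⊔-lub p q))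

module Rows (m : ℕ) (π : List Step) (v : List ℤ)
  (norths≡ : countN' π ≡ suc (suc (suc m))) (easts≡ : countE π ≡ suc (suc m)) where

  n′ n J : ℕ
  n′ = suc (suc m)
  n  = suc n′
  -- In this form `suc J` and `2 ℕ.* n` agree by computation: `J` is the top level 2n - 1 of ζ_D.
  J  = n′ ℕ.+ (n ℕ.+ 0)

  P : ℕ → ℕ
  P k = easts-before 0 π k

  V : ℕ → ℤ
  V k = getℤ v (suc k)

  P≤n′ : ∀ {k} → k < n → P k ≤ n′
  P≤n′ p = ℕP.≤-trans (easts-before-≤ 0 π (subst (_ <_) (sym norths≡) p)) (ℕP.≤-reflexive easts≡)

  P-mono : ∀ {k} → suc k < n → P k ≤ P (suc k)
  P-mono p = easts-before-mono 0 π (subst (_ <_) (sym norths≡) p)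

  ρ : ℕ → Row Mark
  ρ k = muAt n π (suc k) , (z , leftTag (P 0 ℕ.+ k)) , (- z , rightTag (P 0 ℕ.+ k))
    where z = sign n π (suc k) ℤ.* V k

  module Last  = NormLast ρ n′
  module First = NormFirst Last.apply n′

  r : ℕ → Row Mark
  r = First.apply

  -- The common sign in μ_1 = ± π_1 and in the adjustment of the entry from row 1.
  τ : ℤ
  τ = if nuCase1 n then epsilon π else - epsilon π

  τ-unit : Unit± τ
  τ-unit with nuCase1 n
  ... | true  = epsilon-unit π
  ... | false = neg-unit (epsilon-unit π)

  -- The exponent 1 + ν_{n-1} + ν_n is 2 (n - 1) in the first case of ν and 2 (n - 1) + 1 in the
  -- second, where μ_1 is -λ_1.
  sign-1 : sign n π 1 ≡ τ
  sign-1 = trans (cong (epsilon π ℤ.*_) parity) (distribute (nuCase1 n))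
    where
    parity : neg1^ (1ℤ ℤ.+ getℤ (nu n) (n ∸ 1) ℤ.+ getℤ (nu n) n) ≡ (if nuCase1 n then 1ℤ else -1ℤ)
    parity rewrite getℤ-nu (suc m) (if nuCase1 n then + n′ else + n) | getℤ-nu-last (suc m) (if nuCase1 n then + n′ else + n)
      with nuCase1 n
    ... | true  = neg1^-even (+ n′)
    ... | false = trans (cong (λ k → neg1^ (+ k)) (ℕP.+-suc n′ n′)) (neg1^-odd (+ n′))
    distribute : ∀ c → epsilon π ℤ.* (if c then 1ℤ else -1ℤ) ≡ (if c then epsilon π else - epsilon π)
    distribute true  = ℤP.*-identityʳ _
    distribute false = trans (ℤP.*-comm (epsilon π) -1ℤ) (ℤP.-1*i≡-i (epsilon π))

  mu-1 : muAt n π 1 ≡ τ ℤ.* + P 0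
  mu-1 with nuCase1 n
  ... | true  = refl
  ... | false = ℤP.neg-distribˡ-* (epsilon π) (+ P 0)

  firstRow : ℕ → ℤ → Row Mark
  firstRow p t = t ℤ.* + p , (t ℤ.* V 0 , leftTag (p ℕ.+ 0)) , (- (t ℤ.* V 0) , rightTag (p ℕ.+ 0))

  r-0 : r 0 ≡ normFirst (firstRow (P 0) τ)
  r-0 = cong normFirst (trans (Last.apply-below ℕ.z<s) (cong₂ (λ a z → a , (z ℤ.* V 0 , leftTag (P 0 ℕ.+ 0)) , (- (z ℤ.* V 0) , rightTag (P 0 ℕ.+ 0))) mu-1 sign-1))

  -- If π_1 > 0, normalising removes `τ` from the height and the labels together. If π_1 = 0, the
  -- height does not see `τ`, and only |v(1)| is retained; this is the origin of the formal symbols.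
  data FirstRow (p : ℕ) : Row Mark → Set where
    ground : ∀ {z z′} → p ≡ 0 → ∣ z ∣ ≡ ∣ V 0 ∣ → FirstRow p (0ℤ , (z , formal) , (z′ , mirror))
    raised : ∀ {k} → p ≡ suc k → FirstRow p (+ suc k , (V 0 , plain) , (- V 0 , plain))

  firstRow-normal : ∀ p {t} → Unit± t → FirstRow p (normFirst (firstRow p t))
  firstRow-normal zero    +1′ = ground refl (cong ∣_∣ (ℤP.*-identityˡ (V 0)))
  firstRow-normal zero    -1′ = ground refl (trans (cong ∣_∣ (ℤP.-1*i≡-i (V 0))) (ℤP.∣-i∣≡∣i∣ (V 0)))
  firstRow-normal (suc p) +1′ rewrite ℤP.*-identityˡ (V 0) | ℕP.+-identityʳ p = raised refl
  firstRow-normal (suc p) -1′ rewrite ℤP.-1*i≡-i (V 0) | ℤP.neg-involutive (V 0) | ℕP.+-identityʳ p = raised refl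

  first-row : FirstRow (P 0) (r 0)
  first-row = subst (FirstRow (P 0)) (sym r-0) (firstRow-normal (P 0) τ-unit)

  ρ-suc : ∀ k → ρ (suc k) ≡ plainRow (muAt n π (suc (suc k))) (sign n π (suc (suc k)) ℤ.* V (suc k))
  ρ-suc k rewrite leftTag-suc (P 0) k | rightTag-suc (P 0) k = refl

  mu-middle : ∀ {k} → suc k < n′ → muAt n π (suc (suc k)) ≡ + P (suc k) ℤ.- + suc k
  mu-middle {k} p rewrite dec-false (suc k ℕ.≟ n′) (ℕP.<⇒≢ p) = refl

  sign-middle : ∀ {k} → suc k < n′ → sign n π (suc (suc k)) ≡ 1ℤ
  sign-middle {k} p rewrite dec-false (suc k ℕ.≟ n′) (ℕP.<⇒≢ p) = refl

  r-middle : ∀ {k} → suc k < n′ → r (suc k) ≡ plainRow (+ P (suc k) ℤ.- + suc k) (V (suc k))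
  r-middle {k} p = begin
    Last.apply (suc k) ≡⟨ Last.apply-below p ⟩
    ρ (suc k)          ≡⟨ ρ-suc k ⟩
    plainRow (muAt n π (suc (suc k))) (sign n π (suc (suc k)) ℤ.* V (suc k))
      ≡⟨ cong₂ plainRow (mu-middle p) (trans (cong (ℤ._* V (suc k)) (sign-middle p)) (ℤP.*-identityˡ (V (suc k)))) ⟩
    plainRow (+ P (suc k) ℤ.- + suc k) (V (suc k)) ∎
    where open ≡-Reasoning

  -- In these terms μ_{n-1} = 1 - (δ + s), and μ_n is D or 1 - D according to the sign of the
  -- adjustment of the entry from row n.
  δ s : ℕ
  δ = P n′ ∸ P (suc m)
  s = n′ ∸ P n′

  P-last : P n′ ≡ P (suc m) ℕ.+ δ
  P-last = sym (ℕP.m+[n∸m]≡n (P-mono ℕP.≤-refl))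

  n′-split : n′ ≡ P (suc m) ℕ.+ δ ℕ.+ s
  n′-split = trans (sym (ℕP.m+[n∸m]≡n (P≤n′ ℕP.≤-refl))) (cong (ℕ._+ s) P-last)

  D : ℤ
  D = + δ ℤ.- + s

  data LastLambda : ℤ → Set where
    even-sum : LastLambda (+ 2 ℤ.* + P n′ ℤ.- + P (suc m))
    odd-sum  : LastLambda (+ (2 ℕ.* n ∸ 1) ℤ.- + 2 ℤ.* + P n′ ℤ.+ + P (suc m))

  last-lambda : LastLambda (lam n π n)
  last-lambda rewrite ≡ᵇ-true m with evenℕ (sum (take (suc m) (piVec π)))
  ... | true  = even-sum
  ... | false = odd-sum

  data LastMu : ℤ → Set where
    direct    : LastMu D
    reflected : LastMu (1ℤ ℤ.- D)

  +n′ : + n′ ≡ + P (suc m) ℤ.+ + δ ℤ.+ + s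
  +n′ = cong +_ n′-split

  +P-last : + P n′ ≡ + P (suc m) ℤ.+ + δ
  +P-last = cong +_ P-last

  mu-last : muAt n π n ≡ (if nuCase1 n then lam n π n ℤ.- + n′ else + n ℤ.- lam n π n)
  mu-last rewrite ≡ᵇ-true m = refl

  last-mu : LastMu (muAt n π n)
  last-mu = subst LastMu (sym mu-last) (by-case (nuCase1 n) last-lambda)
    where
    by-case : ∀ c {l} → LastLambda l → LastMu (if c then l ℤ.- + n′ else + n ℤ.- l)
    by-case true  even-sum = subst LastMu (sym (even-case-1 (+ P (suc m)) (+ δ) (+ s) +P-last +n′)) direct
    by-case true  odd-sum  = subst LastMu (sym (odd-case-1 (+ P (suc m)) (+ δ) (+ s) +P-last +n′)) reflected
    by-case false even-sum = subst LastMu (sym (even-case-2 (+ P (suc m)) (+ δ) (+ s) +P-last +n′)) reflected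
    by-case false odd-sum  = subst LastMu (sym (odd-case-2 (+ P (suc m)) (+ δ) (+ s) +P-last +n′)) direct

  h : ℕ → ℤ
  h k = height (r k)

  h-first : h 0 ≡ + P 0 ℤ.- 0ℤ
  h-first = trans (from first-row) (sym (ℤP.+-identityʳ (+ P 0)))
    where
    from : ∀ {a} → FirstRow (P 0) a → height a ≡ + P 0
    from (ground e _) = cong +_ (sym e)
    from (raised e)   = cong +_ (sym e)

  h-below : ∀ {k} → k < n′ → h k ≡ + P k ℤ.- + k
  h-below {zero}  _ = h-first
  h-below {suc k} p = cong height (r-middle p)

  mu-before-last : muAt n π n′ ≡ 1ℤ ℤ.- (+ δ ℤ.+ + s)
  mu-before-last = trans (mu-middle ℕP.≤-refl) (height-before-last (+ P (suc m)) (+ δ) (+ s) +P-last +n′ {+ suc m} refl)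

  h-before-last : h (suc m) ≡ 1ℤ ℤ.- (+ δ ℤ.+ + s)
  h-before-last = trans (h-below ℕP.≤-refl) (height-before-last (+ P (suc m)) (+ δ) (+ s) +P-last +n′ {+ suc m} refl)

  getℤ-mu-at : ∀ {k} → k < n → getℤ (mu n π) (suc k) ≡ muAt n π (suc k)
  getℤ-mu-at {k} p = trans (cong (λ l → getℤ l (suc k)) (mu≡applyUpTo n π)) (getℤ-applyUpTo (muAt n π ∘ suc) n p)

  sign-last : sign n π n ≡ neg1^ (1ℤ ℤ.+ muAt n π n′ ℤ.+ muAt n π n)
  sign-last = trans unfold (cong₂ (λ a b → neg1^ (1ℤ ℤ.+ a ℤ.+ b)) (getℤ-mu-at (ℕP.m<n⇒m<1+n (ℕP.n<1+n (suc m)))) (getℤ-mu-at (ℕP.n<1+n n′)))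
    where
    unfold : sign n π n ≡ neg1^ (1ℤ ℤ.+ getℤ (mu n π) n′ ℤ.+ getℤ (mu n π) n)
    unfold rewrite ≡ᵇ-true m = refl

  data LastRow : Row Mark → Set where
    direct    : LastRow (plainRow D (V n′))
    reflected : LastRow (plainRow (1ℤ ℤ.- D) (- V n′))

  last-row : LastRow (ρ n′)
  last-row = subst LastRow (sym (ρ-suc (suc m))) (by-case last-mu refl)
    where
    by-case : ∀ {l} → LastMu l → muAt n π n ≡ l → LastRow (plainRow (muAt n π n) (sign n π n ℤ.* V n′))
    by-case direct e
      rewrite trans sign-last (sign-direct (+ P (suc m)) (+ δ) (+ s) +P-last +n′ mu-before-last e) | e | ℤP.*-identityˡ (V n′) = direct
    by-case reflected e
      rewrite trans sign-last (sign-reflected (+ P (suc m)) (+ δ) (+ s) +P-last +n′ mu-before-last e) | e | ℤP.-1*i≡-i (V n′) = reflected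

  r-last : r n′ ≡ normLast (ρ n′)
  r-last = Last.apply-last

  -- If δ = 0 then D = -s ≤ 0 < 1 - D, so that normLast restores D in both cases.
  flat-last : δ ≡ 0 → r n′ ≡ plainRow (- (+ s)) (V n′)
  flat-last δ≡0 = trans r-last (by-case last-row)
    where
    keep : ∀ k z → normLast (plainRow (- (+ k)) z) ≡ plainRow (- (+ k)) z
    keep zero    z = refl
    keep (suc k) z = refl
    by-case : ∀ {a} → LastRow a → normLast a ≡ plainRow (- (+ s)) (V n′)
    by-case direct rewrite δ≡0 | 0-+s s = keep s (V n′)
    by-case reflected rewrite δ≡0 | 1-[0-s] s | 1-+suc s | ℤP.neg-involutive (V n′) = refl

  h-last : h n′ ≡ D ⊎ h n′ ≡ 1ℤ ℤ.- D
  h-last = subst (λ a → height a ≡ D ⊎ height a ≡ 1ℤ ℤ.- D) (sym r-last) (by-case last-row)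
    where
    by-case : ∀ {a} → LastRow a → height (normLast a) ≡ D ⊎ height (normLast a) ≡ 1ℤ ℤ.- D
    by-case {a} direct    = normLast-height a
    by-case {a} reflected = Data.Sum.[ inj₂ , (λ e → inj₁ (trans e (reflect-involutive D))) ]′ (normLast-height a)

  -- Both D and 1 - D are at least 1 - (δ + s) once δ > 0, so either choice made by `normLast` is
  -- harmless.
  climb-last : ∀ {t} → δ ≡ suc t → h (suc m) ℤ.≤ h n′
  climb-last {t} δ≡ rewrite h-before-last with h-last
  ... | inj₁ e rewrite e | δ≡ = below-direct t s
  ... | inj₂ e rewrite e | δ≡ = below-reflected t s

  -- `marks` is limited to rises, because normalising may exchange the labels of row n when π_n >
  -- π_{n-1}.
  record Edge (k : ℕ) : Set where
    field
      slope  : h k ℤ.≤ ℤ.suc (h (suc k))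
      flat⇒≡ : P (suc k) ≡ P k → h k ≡ ℤ.suc (h (suc k))
      ≡⇒flat : h k ≡ ℤ.suc (h (suc k)) → P (suc k) ≡ P k
      marks  : P (suc k) ≡ P k → leftMark (r (suc k)) ≡ (V (suc k) , plain) × rightMark (r (suc k)) ≡ (- V (suc k) , plain)

  edge-middle : ∀ {k} → suc k < n′ → Edge k
  edge-middle {k} p = record
    { slope  = subst₂ ℤ._≤_ (sym this) (sym next) (ℤP.+-monoˡ-≤ (- (+ k)) (ℤ.+≤+ (P-mono (ℕP.m<n⇒m<1+n p))))
    ; flat⇒≡ = λ e → trans this (trans (cong (λ a → + a ℤ.- + k) (sym e)) (sym next))
    ; ≡⇒flat = λ e → sym (ℤP.+-injective (∙-cancelʳ (- (+ k)) (+ P k) (+ P (suc k)) (trans (sym this) (trans e next))))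
    ; marks  = λ _ → cong leftMark (r-middle p) , cong rightMark (r-middle p)
    }
    where
    this : h k ≡ + P k ℤ.- + k
    this = h-below (ℕP.<⇒≤ p)
    next : ℤ.suc (h (suc k)) ≡ + P (suc k) ℤ.- + k
    next = trans (cong ℤ.suc (h-below p)) (suc-shift (+ P (suc k)) k)

  edge-last : ∀ d → δ ≡ d → Edge (suc m)
  edge-last zero δ≡0 = record
    { slope  = ℤP.≤-reflexive down
    ; flat⇒≡ = λ _ → down
    ; ≡⇒flat = λ _ → trans P-last (trans (cong (P (suc m) ℕ.+_) δ≡0) (ℕP.+-identityʳ _))
    ; marks  = λ _ → cong leftMark (flat-last δ≡0) , cong rightMark (flat-last δ≡0)
    }
    where
    down : h (suc m) ≡ ℤ.suc (h n′)
    down = trans h-before-last (trans (cong (λ d → 1ℤ ℤ.- (+ d ℤ.+ + s)) δ≡0)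
      (cong ℤ.suc (sym (cong height (flat-last δ≡0)))))
  edge-last (suc t) δ≡ = record
    { slope  = proj₁ strict
    ; flat⇒≡ = ⊥-elim ∘ not-flat
    ; ≡⇒flat = ⊥-elim ∘ proj₂ strict
    ; marks  = ⊥-elim ∘ not-flat
    }
    where
    strict = ≤-suc-strict (climb-last δ≡)
    not-flat : P n′ ≢ P (suc m)
    not-flat e = ℕP.1+n≢0 (trans (sym δ≡) (trans (cong (_∸ P (suc m)) e) (ℕP.n∸n≡0 (P (suc m)))))

  edge : ∀ {k} → suc k < n → Edge k
  edge p = Data.Sum.[ edge-middle , (λ { refl → edge-last δ refl }) ]′ (ℕP.m≤n⇒m<n∨m≡n (ℕP.≤-pred p))

  D-bound : ∣ D ∣ ≤ n′
  D-bound = ∣+-+∣≤ (ℕP.≤-trans (ℕP.m∸n≤m (P n′) (P (suc m))) (P≤n′ ℕP.≤-refl)) (ℕP.m∸n≤m n′ (P n′))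

  1-D-bound : ∣ 1ℤ ℤ.- D ∣ ≤ n
  1-D-bound = ℕP.≤-trans (ℤP.∣i-j∣≤∣i∣+∣j∣ 1ℤ D) (s≤s D-bound)

  last-bound : ∣ height (ρ n′) ∣ ≤ n × ∣ 1ℤ ℤ.- height (ρ n′) ∣ ≤ n
  last-bound = by-case last-row
    where
    by-case : ∀ {a} → LastRow a → ∣ height a ∣ ≤ n × ∣ 1ℤ ℤ.- height a ∣ ≤ n
    by-case direct    = ℕP.m≤n⇒m≤1+n D-bound , 1-D-bound
    by-case reflected = 1-D-bound , subst (λ z → ∣ z ∣ ≤ n) (sym (reflect-involutive D)) (ℕP.m≤n⇒m≤1+n D-bound)

  ρ-bound-below : ∀ {k} → k < n′ → ∣ height (ρ k) ∣ ≤ n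
  ρ-bound-below {zero}  p = ℕP.≤-trans (ℕP.≤-reflexive (trans (cong ∣_∣ mu-1) (∣unit*∣ τ-unit (+ P 0))))
    (ℕP.m≤n⇒m≤1+n (P≤n′ ℕ.z<s))
  ρ-bound-below {suc k} p = ℕP.≤-trans (ℕP.≤-reflexive (cong ∣_∣ (mu-middle p)))
    (ℕP.m≤n⇒m≤1+n (∣+-+∣≤ (P≤n′ (ℕP.m<n⇒m<1+n p)) (ℕP.<⇒≤ p)))

  ρ-bound : ∀ {k} → k < n → ∣ height (ρ k) ∣ ≤ n
  ρ-bound p = Data.Sum.[ ρ-bound-below , (λ { refl → proj₁ last-bound }) ]′ (ℕP.m≤n⇒m<n∨m≡n (ℕP.≤-pred p))

  apply-bound : ∀ {k} → k < n → ∣ height (Last.apply k) ∣ ≤ n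
  apply-bound {k} p = Data.Sum.[
    (λ q → subst (λ a → ∣ height a ∣ ≤ n) (sym (Last.apply-below q)) (ρ-bound-below q)) ,
    (λ { refl → subst (λ a → ∣ height a ∣ ≤ n) (sym Last.apply-last) (normLast-bound (ρ n′) (proj₁ last-bound) (proj₂ last-bound)) })
    ]′ (ℕP.m≤n⇒m<n∨m≡n (ℕP.≤-pred p))

  n<J : n < J
  n<J = s≤s (s≤s (ℕP.≤-trans (ℕP.≤-trans (ℕP.n≤1+n n′) (ℕP.m≤m+n n 0)) (ℕP.m≤n+m (n ℕ.+ 0) m)))

  r-bound : ∀ {k} → k < n → ∣ h k ∣ ≤ J
  r-bound {k} p = ℕP.≤-trans (ℕP.≤-reflexive (First.∣apply∣ k)) (ℕP.≤-trans (apply-bound p) (ℕP.<⇒≤ n<J))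

  word-r : dropLast (word J (doubled ρ n)) ≡ dropLast (word J (doubled r n))
  word-r = trans (Last.Invariant.word≡ Last.invariance (ℕP.≤-<-trans (proj₁ last-bound) n<J) (ℕP.≤-<-trans (proj₂ last-bound) n<J))
    (cong dropLast (First.Invariant.word≡ First.invariance J))

  backward-r : backward J (lefts ρ n) (rights ρ n) ≡ backward J (lefts r n) (rights r n)
  backward-r = trans (Last.Invariant.backward≡ Last.invariance J)
    (First.Invariant.backward≡ First.invariance (λ p → ℕP.≤-trans (apply-bound p) (ℕP.<⇒≤ n<J)))

-- Rises and valleys

getℤ-∈ : ∀ xs {k} → k < length xs → getℤ xs (suc k) ∈ xs
getℤ-∈ (x ∷ xs) {zero}  p       = here refl
getℤ-∈ (x ∷ xs) {suc k} (s≤s p) = there (getℤ-∈ xs p)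

neg-fixed : ∀ z → - z ≡ z → z ≡ 0ℤ
neg-fixed (+ zero) e = refl

no-opposite : ∀ {v a} → Unique (map ∣_∣ v) → All (0 <_) (map ∣_∣ v) → a ∈ v → - a ∈ v → ⊥
no-opposite (u ∷ _) (p ∷ _) (here refl) (here e) = ℕP.<-irrefl (sym (cong ∣_∣ (neg-fixed _ e))) p
no-opposite {a = a} (u ∷ _) _ (here refl) (there q) =
  All.lookup u (∈-map⁺ ∣_∣ q) (sym (ℤP.∣-i∣≡∣i∣ a))
no-opposite {a = a} (u ∷ _) _ (there q) (here refl) =
  All.lookup u (∈-map⁺ ∣_∣ q) (ℤP.∣-i∣≡∣i∣ a)
no-opposite (_ ∷ u) (_ ∷ p) (there q) (there q′) = no-opposite u p q q′

signedPerm-no-opposite : ∀ {n v a} → IsSignedPerm n v → a ∈ v → - a ∈ v → ⊥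
signedPerm-no-opposite {n} σ = no-opposite
  (↭ₛ.Unique-resp-↭ (setoid ℕ) (↭⇒↭ₛ (↭-sym σ)) (UniqueP.map⁺ ℕP.suc-injective (UniqueP.upTo⁺ n)))
  (All-resp-↭ (↭-sym σ) (AllP.map⁺ (All.universal (λ _ → ℕ.z<s) (upTo n))))

signedPerm-length : ∀ {n v} → IsSignedPerm n v → length v ≡ n
signedPerm-length {n} {v} σ = trans (sym (length-map ∣_∣ v)) (trans (↭-length σ) (trans (length-map suc (upTo n)) (length-upTo n)))

≤0⊎>0 : ∀ z → z ℤ.≤ 0ℤ ⊎ 0ℤ ℤ.< z
≤0⊎>0 (+ zero)  = inj₁ ℤP.≤-refl
≤0⊎>0 (+ suc _) = inj₂ (ℤ.+<+ ℕ.z<s)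
≤0⊎>0 -[1+ _ ]  = inj₁ ℤ.-≤+

firstRow-ground : ∀ {m π v p a} {nn : countN' π ≡ suc (suc (suc m))} {ne : countE π ≡ suc (suc m)} →
  Rows.FirstRow m π v nn ne p a → Ground a
firstRow-ground (Rows.ground _ _) = zero refl refl refl
firstRow-ground (Rows.raised _)   = positive (ℤ.+<+ ℕ.z<s) refl

if-preserves : ∀ {A : Set} (Q : A → Set) c {x y : A} → Q x → Q y → Q (if c then x else y)
if-preserves Q true  p q = p
if-preserves Q false p q = q

PlainRow : Row Mark → Set
PlainRow a = tag (leftMark a) ≡ plain × tag (rightMark a) ≡ plain

normLast-plain : ∀ a → PlainRow a → PlainRow (normLast a)
normLast-plain (+ zero , _)   (p , q) = p , q
normLast-plain (+ suc _ , _)  (p , q) = q , p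
normLast-plain (-[1+ _ ] , _) (p , q) = p , q

true≢false : ∀ {A : Set} {b} → b ≡ true → b ≡ false → A
true≢false refl ()

-- Identification with ζ_D and d_D, and comparison of labels

module Assembly (m : ℕ) (π : List Step) (v : List ℤ)
  (norths≡ : countN' π ≡ suc (suc (suc m))) (easts≡ : countE π ≡ suc (suc m)) where

  open Rows m π v norths≡ easts≡

  last≤0 : h n′ ℤ.≤ 0ℤ
  last≤0 = subst (λ a → height a ℤ.≤ 0ℤ) (sym r-last) (normLast≤0 (ρ n′))

  opposite : ∀ k → opposed (r k)
  opposite zero    = normFirst-opposed (ρ 0) refl
  opposite (suc k) = if-preserves opposed (suc k ≡ᵇ n′) (normLast-opposed (ρ (suc k)) refl) refl

  plain-suc : ∀ k → PlainRow (r (suc k))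
  plain-suc k = if-preserves PlainRow (suc k ≡ᵇ n′) (normLast-plain (ρ (suc k)) plain-ρ) plain-ρ
    where
    plain-ρ : PlainRow (ρ (suc k))
    plain-ρ = leftTag-suc (P 0) k , rightTag-suc (P 0) k

  open Core n′ J r r-bound (λ p → Edge.slope (edge p)) (firstRow-ground {m} {π} {v} first-row) last≤0 opposite
    (proj₁ ∘ plain-suc) (proj₂ ∘ plain-suc) hiding (n; R; L)

  c : Bool
  c = evenℕ (countPos (mu n π))

  open Ending c using (β; w; valley⇔fall)

  zetaWord-steps : zetaWord n π ≡ steps (word J (doubled ρ n))
  zetaWord-steps = begin
    concatMap (λ j → SminusLeft j (mu n π) ++ Splus j (mu n π)) (reverse (upTo (2 ℕ.* n)))
      ≡⟨ cong (concatMap _) (reverse-upTo (2 ℕ.* n)) ⟩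
    concatMap (λ j → SminusLeft j (mu n π) ++ Splus j (mu n π)) (downFrom (suc J))
      ≡⟨ cong (λ a → concatMap (λ j → SminusLeft j a ++ Splus j a) (downFrom (suc J))) (mu≡applyUpTo n π) ⟩
    concatMap (λ j → SminusLeft j (applyUpTo (height ∘ ρ) n) ++ Splus j (applyUpTo (height ∘ ρ) n)) (downFrom (suc J))
      ≡⟨ blocks-word J ρ n ⟩
    steps (word J (doubled ρ n)) ∎
    where open ≡-Reasoning

  zetaD≡β : zetaD n π ≡ β
  zetaD≡β = cong (replAfterNorth n (if c then Ep else Em)) (begin
    dropLast (zetaWord n π)                   ≡⟨ cong dropLast zetaWord-steps ⟩
    dropLast (steps (word J (doubled ρ n)))   ≡⟨ dropLast-map step (word J (doubled ρ n)) ⟩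
    steps (dropLast (word J (doubled ρ n)))   ≡⟨ cong steps word-r ⟩
    steps (dropLast (word J (doubled r n))) ∎)
    where open ≡-Reasoning

  S : ℕ
  S = sum (map ∣_∣ (mu n π))

  ρ-sum-bound : ∀ {k} → k < n → ∣ height (ρ k) ∣ ≤ S
  ρ-sum-bound p = ℕP.≤-trans (∣∣≤sum (height ∘ ρ) n p) (ℕP.≤-reflexive (cong (sum ∘ map ∣_∣) (sym (mu≡applyUpTo n π))))

  ρ-J-bound : ∀ {k} → k < n → ∣ height (ρ k) ∣ ≤ J
  ρ-J-bound p = ℕP.≤-trans (ρ-bound p) (ℕP.<⇒≤ n<J)

  window≡d : window n π v S ≡ d
  window≡d = begin
    window n π v S
      ≡⟨ reverse-involutive (window n π v S) ⟨
    reverse (reverse (window n π v S))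
      ≡⟨ cong reverse (Window.reverse-window n π v ρ (λ _ → refl) (λ _ → refl) (λ _ → refl) S) ⟩
    reverse (map value (backward S (lefts ρ n) (rights ρ n)))
      ≡⟨ cong (reverse ∘ map value) (backward-irrelevant (within-lefts ρ n ρ-sum-bound) (within-rights ρ n ρ-sum-bound)
           (within-lefts ρ n ρ-J-bound) (within-rights ρ n ρ-J-bound)) ⟩
    reverse (map value (backward J (lefts ρ n) (rights ρ n)))
      ≡⟨ cong (reverse ∘ map value) backward-r ⟩
    d ∎
    where open ≡-Reasoning

  dD≡w : dD n π v ≡ w
  dD≡w = trans (dD≡signFirst-window n π v) (cong (signFirst c) window≡d)

  hasValley⇔fall : ∀ {l} → HasValley n (zetaD n π) (dD n π v) l ⇔ (∃₂ λ x y → Fall x y × label x y ≡ l)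
  hasValley⇔fall {l} = subst₂ (λ p u → HasValley n p u l ⇔ (∃₂ λ x y → Fall x y × label x y ≡ l)) (sym zetaD≡β) (sym dD≡w) valley⇔fall

  isFirst : ℕ → Bool
  isFirst k = beginsNN π ∧ (suc k ≡ᵇ 1)

  Flat : ℕ → Set
  Flat k = Flat-at 0 π k

  -- The sign of the height, which selects the half, is dropped: the way back to a rise uses only
  -- the label and the equality of neighbouring π's.
  data Falling : Label → Set where
    ordinary-left  : ∀ {k} → Flat k → isFirst k ≡ false → Falling (pr (V (suc k)) (V k))
    ordinary-right : ∀ {k} → Flat k → isFirst k ≡ false → Falling (pr (- V k) (- V (suc k)))
    formal-first   : Flat 0 → isFirst 0 ≡ true → Falling (pmR (V 1) ∣ V 0 ∣)

  <-n : ∀ {k} → Flat k → suc k < n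
  <-n (p , _) = subst (_ <_) norths≡ p

  rise-flat : ∀ {i} → i ∈ rises π → ∃ λ k → i ≡ suc k × Flat k
  rise-flat = rises⁻ 0 0 π

  flat-rise : ∀ {k} → Flat k → suc k ∈ rises π
  flat-rise = rises⁺ 0 0 π

  isFirst-suc : ∀ k → isFirst (suc k) ≡ false
  isFirst-suc k with beginsNN π
  ... | true  = refl
  ... | false = refl

  isFirst-ground : Flat 0 → P 0 ≡ 0 → isFirst 0 ≡ true
  isFirst-ground f z rewrite ≡0⇒beginsNN π z f = refl

  isFirst-raised : P 0 ≢ 0 → isFirst 0 ≡ false
  isFirst-raised nz with beginsNN π in eq
  ... | true  = ⊥-elim (nz (beginsNN⇒≡0 π eq))
  ... | false = refl

  first⇒ground : isFirst 0 ≡ true → P 0 ≡ 0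
  first⇒ground e with beginsNN π in eq
  ... | true  = beginsNN⇒≡0 π eq
  first⇒ground () | false

  first-low : ∀ {a} → FirstRow (P 0) a → height a ℤ.≤ 0ℤ →
    ∃ λ z → leftMark a ≡ (z , formal) × ∣ z ∣ ≡ ∣ V 0 ∣ × P 0 ≡ 0
  first-low (ground e z) _ = _ , refl , z , e
  first-low (raised _) (ℤ.+≤+ ())

  first-high : ∀ {a} → FirstRow (P 0) a → 0ℤ ℤ.< height a → rightMark a ≡ (- V 0 , plain) × P 0 ≢ 0
  first-high (ground _ _) (ℤ.+<+ ())
  first-high (raised e) _ = refl , λ z → ℕP.1+n≢0 (trans (sym e) z)

  middle-left : ∀ {k} → suc (suc k) < n → leftMark (r (suc k)) ≡ (V (suc k) , plain)
  middle-left p = cong leftMark (r-middle (ℕP.≤-pred p))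

  middle-right : ∀ {k} → suc (suc k) < n → rightMark (r (suc k)) ≡ (- V (suc k) , plain)
  middle-right p = cong rightMark (r-middle (ℕP.≤-pred p))

  flat-from : ∀ {k} → suc k < n → h k ≡ ℤ.suc (h (suc k)) → Flat k
  flat-from p e = subst (_ <_) (sym norths≡) p , Edge.≡⇒flat (edge p) e

  upper-marks : ∀ {k} → Flat k → leftMark (r (suc k)) ≡ (V (suc k) , plain) × rightMark (r (suc k)) ≡ (- V (suc k) , plain)
  upper-marks f@(_ , e) = Edge.marks (edge (<-n f)) e

  FallingMarks : Mark → Mark → Set
  FallingMarks x y = Falling (label x y)

  falling-ground : ∀ {y} → Flat 0 → (∃ λ z → y ≡ (z , formal) × ∣ z ∣ ≡ ∣ V 0 ∣ × P 0 ≡ 0) → FallingMarks (V 1 , plain) y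
  falling-ground f (z , refl , abs , P≡0) = subst (λ a → Falling (pmR (V 1) a)) (sym abs) (formal-first f (isFirst-ground f P≡0))

  falling-raised : ∀ {x} → Flat 0 → x ≡ (- V 0 , plain) × P 0 ≢ 0 → FallingMarks x (- V 1 , plain)
  falling-raised f (refl , P≢0) = ordinary-right f (isFirst-raised P≢0)

  falling : ∀ {x y} → Fall x y → FallingMarks x y
  falling (in-left {zero} p e q) =
    subst (λ x → FallingMarks x (leftMark (r 0))) (sym (proj₁ (upper-marks (flat-from p e)))) (falling-ground (flat-from p e) (first-low first-row q))
  falling (in-left {suc k} p e q) =
    subst₂ FallingMarks (sym (proj₁ (upper-marks (flat-from p e)))) (sym (middle-left p)) (ordinary-left (flat-from p e) (isFirst-suc k))
  falling (in-right {zero} p e q) =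
    subst (FallingMarks (rightMark (r 0))) (sym (proj₂ (upper-marks (flat-from p e)))) (falling-raised (flat-from p e) (first-high first-row q))
  falling (in-right {suc k} p e q) =
    subst₂ FallingMarks (sym (middle-right p)) (sym (proj₂ (upper-marks (flat-from p e)))) (ordinary-right (flat-from p e) (isFirst-suc k))

  Labelled : Label → Set
  Labelled l = ∃₂ λ x y → Fall x y × label x y ≡ l

  fall-down : ∀ {k} → Flat k → h k ≡ ℤ.suc (h (suc k))
  fall-down f@(_ , e) = Edge.flat⇒≡ (edge (<-n f)) e

  ordinary-low : ∀ k → Flat k → isFirst k ≡ false → h k ℤ.≤ 0ℤ → Labelled (pr (V (suc k)) (V k))
  -- A first height at most 0 means π_1 = 0, and then a rise at row 1 makes π begin with two North
  -- steps and carries the formal symbol.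
  ordinary-low zero f nf q = let (_ , _ , _ , P≡0) = first-low first-row q in true≢false (isFirst-ground f P≡0) nf
  ordinary-low (suc k) f nf q = _ , _ , in-left (<-n f) (fall-down f) q ,
    cong₂ label (proj₁ (upper-marks f)) (middle-left (<-n f))

  ordinary-high : ∀ k → Flat k → 0ℤ ℤ.< h k → Labelled (pr (- V k) (- V (suc k)))
  ordinary-high zero f q = _ , _ , in-right (<-n f) (fall-down f) q ,
    cong₂ label (proj₁ (first-high first-row q)) (proj₂ (upper-marks f))
  ordinary-high (suc k) f q = _ , _ , in-right (<-n f) (fall-down f) q ,
    cong₂ label (middle-right (<-n f)) (proj₂ (upper-marks f))

  ordinary : ∀ k → Flat k → isFirst k ≡ false → Labelled (pr (V (suc k)) (V k)) ⊎ Labelled (pr (- V k) (- V (suc k)))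
  ordinary k f nf = Data.Sum.map (ordinary-low k f nf) (ordinary-high k f) (≤0⊎>0 (h k))

  first-formal : Flat 0 → isFirst 0 ≡ true → Labelled (pmR (V 1) ∣ V 0 ∣)
  first-formal f fst = let (z , mark , abs , _) = first-low first-row h≤0 in
    _ , _ , in-left (<-n f) (fall-down f) h≤0 ,
    trans (cong₂ label (proj₁ (upper-marks f)) mark) (cong (pmR (V 1)) abs)
    where
    h≤0 : h 0 ℤ.≤ 0ℤ
    h≤0 = ℤP.≤-reflexive (trans h-first (cong (λ p → + p ℤ.- 0ℤ) (first⇒ground fst)))

  module Labels (σ : IsSignedPerm n v) (a b : ℤ) (a∈v : a ∈ v) (b∈v : b ∈ v) where

    V∈v : ∀ {k} → k < n → V k ∈ v
    V∈v p = getℤ-∈ v (subst (_ <_) (sym (signedPerm-length σ)) p)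

    -- Distinguishes the halves by their labels: ordinary labels of the left half lie in v([n]),
    -- those of the right half in its negative.
    clash : ∀ {z k} → z ∈ v → k < n → z ≢ - V k
    clash z∈v p e = signedPerm-no-opposite σ (V∈v p) (subst (_∈ v) e z∈v)

    riseLabel-pr : ∀ {k} → isFirst k ≡ false → riseLabel π v (suc k) ≡ pr (V k) (V (suc k))
    riseLabel-pr e rewrite e = refl

    riseLabel-pm : isFirst 0 ≡ true → riseLabel π v 1 ≡ pmL ∣ V 0 ∣ (V 1)
    riseLabel-pm e rewrite e = refl

    ValleyOf : Label → Set
    ValleyOf = HasValley n (zetaD n π) (dD n π v)

    toValley : ∀ {l} → Labelled l → ValleyOf l
    toValley = Equivalence.from hasValley⇔fall

    labelled⇒falling : ∀ {l} → Labelled l → Falling l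
    labelled⇒falling (_ , _ , f , refl) = falling f

    toFalling : ∀ {l} → ValleyOf l → Falling l
    toFalling vl = labelled⇒falling (Equivalence.to hasValley⇔fall vl)

    data RiseLabelled (k : ℕ) : Label → Set where
      ordinary-rise : isFirst k ≡ false → RiseLabelled k (pr (V k) (V (suc k)))
      formal-rise   : k ≡ 0 → isFirst 0 ≡ true → RiseLabelled k (pmL ∣ V 0 ∣ (V 1))

    riseLabelled-from : ∀ k t → isFirst k ≡ t → RiseLabelled k (riseLabel π v (suc k))
    riseLabelled-from k       false e = subst (RiseLabelled k) (sym (riseLabel-pr e)) (ordinary-rise e)
    riseLabelled-from zero    true  e = subst (RiseLabelled 0) (sym (riseLabel-pm e)) (formal-rise refl e)
    riseLabelled-from (suc k) true  e = true≢false e (isFirst-suc k)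

    riseLabelled : ∀ {l} → HasRise π v l → ∃ λ k → Flat k × RiseLabelled k l
    riseLabelled (_ , i∈ , eq) = from-flat (rise-flat i∈) eq
      where
      from-flat : ∀ {i l} → (∃ λ k → i ≡ suc k × Flat k) → riseLabel π v i ≡ l → ∃ λ k → Flat k × RiseLabelled k l
      from-flat (k , refl , f) refl = k , f , riseLabelled-from k (isFirst k) refl

    rise⇒valley : ∀ {x y} → (∃ λ k → Flat k × RiseLabelled k (pr x y)) → ValleyOf (pr y x) ⊎ ValleyOf (pr (- x) (- y))
    rise⇒valley (k , f , ordinary-rise nf) = Data.Sum.map toValley toValley (ordinary k f nf)

    rise⇒valley-formal : ∀ {x y} → (∃ λ k → Flat k × RiseLabelled k (pmL x y)) → ValleyOf (pmR y x)
    rise⇒valley-formal (_ , f , formal-rise refl first) = toValley (first-formal f first)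

    valley⇒rise-left : ∀ {x y} → Falling (pr x y) → x ∈ v → HasRise π v (pr y x)
    valley⇒rise-left (ordinary-left f nf) _    = _ , flat-rise f , riseLabel-pr nf
    valley⇒rise-left (ordinary-right f nf) x∈v = ⊥-elim (clash x∈v (ℕP.<⇒≤ (<-n f)) refl)

    valley⇒rise-right : ∀ {x y} → Falling (pr x y) → x ≡ - a → y ≡ - b → HasRise π v (pr a b)
    valley⇒rise-right (ordinary-left f nf) e _ = ⊥-elim (clash a∈v (<-n f) (trans (sym (ℤP.neg-involutive a)) (cong -_ (sym e))))
    valley⇒rise-right (ordinary-right f nf) e e′ = _ , flat-rise f , trans (riseLabel-pr nf) (cong₂ pr (ℤP.neg-injective e) (ℤP.neg-injective e′))

    valley⇒rise-formal : ∀ {x y} → Falling (pmR x y) → HasRise π v (pmL y x)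
    valley⇒rise-formal (formal-first f first) = 1 , flat-rise f , riseLabel-pm first

    labels-correspond :
      (HasRise π v (pr a b) ⇔ (ValleyOf (pr b a) ⊎ ValleyOf (pr (- a) (- b))))
      × (HasRise π v (pmL ∣ a ∣ b) ⇔ ValleyOf (pmR b ∣ a ∣))
    labels-correspond =
      mk⇔ (rise⇒valley ∘ riseLabelled) Data.Sum.[ (λ vl → valley⇒rise-left (toFalling vl) b∈v) , (λ vl → valley⇒rise-right (toFalling vl) refl refl) ]′ ,
      mk⇔ (rise⇒valley-formal ∘ riseLabelled) (valley⇒rise-formal ∘ toFalling)

path-counts : ∀ {n} π → InSignedPaths n π → countN' π ≡ n × countE π ≡ n ∸ 1
path-counts (_ ∷ _) (_ , _ , norths≡ , easts≡) = norths≡ , easts≡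

theorem5p26 : (n : ℕ) → 3 ≤ n → (π : List Step) (v : List ℤ) → InVert n π v →
    (a b : ℤ) → a ∈ v → b ∈ v →
    (HasRise π v (pr a b) ⇔
    (HasValley n (zetaD n π) (dD n π v) (pr b a) ⊎ HasValley n (zetaD n π) (dD n π v) (pr (- a) (- b))))
    × (HasRise π v (pmL ∣ a ∣ b) ⇔ HasValley n (zetaD n π) (dD n π v) (pmR b ∣ a ∣))
theorem5p26 (suc (suc (suc m))) (s≤s (s≤s (s≤s z≤n))) π v vert a b a∈v b∈v =
  Assembly.Labels.labels-correspond m π v (proj₁ counts) (proj₂ counts) (InVert.perm vert) a b a∈v b∈v
  where counts = path-counts π (InVert.path vert)
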